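{- Let $p\ge5$ be a prime, $e\ge1$, and let $\mathcal M$ be an orientably-regular embedding of $K_{p[p^e]}$ with $G=\mathrm{Aut}^+(\mathcal M)$. Suppose that a Sylow $p$-subgroup $P$ of $G$ has exponent $p^{e+1}$. Then $\mathcal M$ is isomorphic to $\mathcal M_1(p,e,j)$ for some $j\in\mathbb Z_{p^e(p-1)}^*$. Moreover, every map $\mathcal M_1(p,e,j)$, $j\in\mathbb Z_{p^e(p-1)}^*$, is an orientably-regular embedding of $K_{p[p^e]}$, and $\mathcal M_1(p,e,j_1)\cong\mathcal M_1(p,e,j_2)$ only if $j_1=j_2$ in $\mathbb Z_{p^e(p-1)}$.
   Context: $K_{m[n]}$ is the complete multipartite graph with $m$ parts of $n$ vertices each. An orientably-regular map is a map on an orientable surface whose group $\mathrm{Aut}^+(\mathcal M)$ of orientation-preserving automorphisms acts regularly on arcs; an orientably-regular embedding of a graph is such a map with that underlying graph. For $G=\langle a,b\rangle$ with $b$ an involution and $\langle a\rangle$ core-free, $\mathcal M(G;a,b)$ is the orientably-regular map on the coset graph with vertices $\{\langle a\rangle g\}$, arcs $\{(\langle a\rangle g,\langle a\rangle bg)\}$ and local rotation $(\langle a\rangle g,\langle a\rangle bg)\mapsto(\langle a\rangle g,\langle a\rangle bag)$; two such maps $\mathcal M(G;a,b),\mathcal M(G;a',b')$ are isomorphic iff an automorphism of $G$ sends $a\mapsto a'$, $b\mapsto b'$. $G_1(p,e)=\langle a,c\mid a^{p^e(p-1)}=c^{p^{e+1}}=1,\ c^a=c^r\rangle$ with $r$ a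 fixed generator of $\mathbb Z_{p^{e+1}}^*$ (with $c^a=a^{ -1}ca$), and $\mathcal M_1(p,e,j)=\mathcal M(G_1(p,e);a^j,a^{p^e(p-1)/2}c)$. -}

module Defs where

open import Data.Nat using (ℕ; zero; suc; _+_; _*_; _∸_; _^_; _≤_; _<_; s≤s; z≤n; NonZero; _/_)
open import Data.Nat.Properties using (m*n≢0; m^n≢0)
open import Data.Nat.DivMod using (_mod_)
open import Data.Nat.Divisibility using (_∣_)
open import Data.Fin using (Fin; toℕ)
open import Data.Product using (Σ; ∃; _×_; _,_; proj₁; proj₂)
open import Data.List using (List; length)
open import Data.List.Relation.Unary.Any using (Any)
open import Data.List.Relation.Unary.AllPairs using (AllPairs)
open import Relation.Binary.PropositionalEquality using (_≡_)
open import Relation.Nullary using (¬_)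
open import Function using (_∘_)

-- Oriented maps, combinatorially: a set of darts (arcs) D, the local
-- rotation R (with inverse Rinv) and the arc-reversing involution L.
-- Vertices are the R-orbits, edges are the L-orbits.

record MapData (D : Set) : Set where
  field
    R    : D → D
    Rinv : D → D
    L    : D → D
open MapData public

data Reach {D : Set} (M : MapData D) : D → D → Set where
  here  : ∀ {d} → Reach M d d
  stepR : ∀ {d d'} → Reach M (R M d) d' → Reach M d d'
  stepRinv : ∀ {d d'} → Reach M (Rinv M d) d' → Reach M d d'
  stepL : ∀ {d d'} → Reach M (L M d) d' → Reach M d d'

record IsOrientableMap {D : Set} (M : MapData D) : Set where
  field
    R-Rinv    : ∀ d → R M (Rinv M d) ≡ d
    Rinv-R    : ∀ d → Rinv M (R M d) ≡ d
    L-invol   : ∀ d → L M (L M d) ≡ d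
    L-nofix   : ∀ d → ¬ (L M d ≡ d)
    connected : ∀ d d' → Reach M d d'

record MapIso {D D' : Set} (M : MapData D) (M' : MapData D') : Set where
  field
    to    : D → D'
    from  : D' → D
    from-to : ∀ d → from (to d) ≡ d
    to-from : ∀ d → to (from d) ≡ d
    to-R  : ∀ d → to (R M d) ≡ R M' (to d)
    to-L  : ∀ d → to (L M d) ≡ L M' (to d)

record Aut {D : Set} (M : MapData D) : Set where
  field
    fun   : D → D
    inv   : D → D
    inv-fun : ∀ d → inv (fun d) ≡ d
    fun-inv : ∀ d → fun (inv d) ≡ d
    fun-R : ∀ d → fun (R M d) ≡ R M (fun d)
    fun-L : ∀ d → fun (L M d) ≡ L M (fun d)
open Aut public

_≈ᴬ_ : {D : Set} {M : MapData D} → Aut M → Aut M → Set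
f ≈ᴬ g = ∀ d → fun f d ≡ fun g d

idᴬ : {D : Set} {M : MapData D} → Aut M
idᴬ = record { fun = λ d → d ; inv = λ d → d ; inv-fun = λ d → Relation.Binary.PropositionalEquality.refl
             ; fun-inv = λ d → Relation.Binary.PropositionalEquality.refl
             ; fun-R = λ d → Relation.Binary.PropositionalEquality.refl
             ; fun-L = λ d → Relation.Binary.PropositionalEquality.refl }

open import Relation.Binary.PropositionalEquality using (refl; trans; cong; sym)

_∘ᴬ_ : {D : Set} {M : MapData D} → Aut M → Aut M → Aut M
f ∘ᴬ g = record
  { fun = fun f ∘ fun g
  ; inv = inv g ∘ inv f
  ; inv-fun = λ d → trans (cong (inv g) (inv-fun f (fun g d))) (inv-fun g d)
  ; fun-inv = λ d → trans (cong (fun f) (fun-inv g (inv f d))) (fun-inv f d)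
  ; fun-R = λ d → trans (cong (fun f) (fun-R g d)) (fun-R f (fun g d))
  ; fun-L = λ d → trans (cong (fun f) (fun-L g d)) (fun-L f (fun g d))
  }

_⁻¹ᴬ : {D : Set} {M : MapData D} → Aut M → Aut M
_⁻¹ᴬ {M = M} f = record
  { fun = inv f ; inv = fun f ; inv-fun = fun-inv f ; fun-inv = inv-fun f
  ; fun-R = λ d → trans (cong (λ x → inv f (R M x)) (sym (fun-inv f d)))
                   (trans (cong (inv f) (sym (fun-R f (inv f d)))) (inv-fun f (R M (inv f d))))
  ; fun-L = λ d → trans (cong (λ x → inv f (L M x)) (sym (fun-inv f d)))
                   (trans (cong (inv f) (sym (fun-L f (inv f d)))) (inv-fun f (L M (inv f d))))
  }

_^ᴬ_ : {D : Set} {M : MapData D} → Aut M → ℕ → Aut M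
f ^ᴬ zero  = idᴬ
f ^ᴬ suc k = f ∘ᴬ (f ^ᴬ k)

HasSize : (A : Set) → (A → A → Set) → ℕ → Set
HasSize A _≈_ k =
  Σ (List A) λ xs → (length xs ≡ k) × (∀ x → Any (x ≈_) xs)
                     × AllPairs (λ x y → ¬ (x ≈ y)) xs

record Subgroup {D : Set} (M : MapData D) : Set₁ where
  field
    mem      : Aut M → Set
    mem-resp : ∀ {f g} → f ≈ᴬ g → mem f → mem g
    mem-id   : mem idᴬ
    mem-mul  : ∀ {f g} → mem f → mem g → mem (f ∘ᴬ g)
    mem-inv  : ∀ {f} → mem f → mem (f ⁻¹ᴬ)
open Subgroup public

AutOrder : {D : Set} (M : MapData D) → ℕ → Set
AutOrder M k = HasSize (Aut M) _≈ᴬ_ k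

SubOrder : {D : Set} {M : MapData D} → Subgroup M → ℕ → Set
SubOrder {M = M} S k =
  HasSize (Σ (Aut M) (mem S)) (λ x y → proj₁ x ≈ᴬ proj₁ y) k

IsSylow : {D : Set} {M : MapData D} → ℕ → Subgroup M → Set
IsSylow {M = M} p S =
  ∃ λ a → ∃ λ m → AutOrder M (p ^ a * m) × SubOrder S (p ^ a) × ¬ (p ∣ m)

HasExponent : {D : Set} {M : MapData D} → Subgroup M → ℕ → Set
HasExponent {M = M} S k =
  (0 < k) × (∀ g → mem S g → (g ^ᴬ k) ≈ᴬ idᴬ)
  × (∀ k' → 0 < k' → (∀ g → mem S g → (g ^ᴬ k') ≈ᴬ idᴬ) → k ≤ k')

IsOrientablyRegular : {D : Set} → MapData D → Set
IsOrientablyRegular M =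
  IsOrientableMap M
  × (∀ d d' → Σ (Aut M) λ f → fun f d ≡ d')
  × (∀ (f : Aut M) d → fun f d ≡ d → f ≈ᴬ idᴬ)

SameVertex : {D : Set} → MapData D → D → D → Set
SameVertex M d d' = ∃ λ k → iter k d ≡ d'
  where
  iter : ℕ → _ → _
  iter zero x = x
  iter (suc k) x = R M (iter k x)

-- The underlying graph of M (vertices = R-orbits, edges = L-orbits) is
-- isomorphic to K_{m[n]}, whose vertex set is Fin m × Fin n with parts
-- given by the first coordinate.  φ labels each dart by its initial vertex.
UnderlyingIsKmn : {D : Set} → MapData D → ℕ → ℕ → Set
UnderlyingIsKmn {D} M m n =
  Σ (D → Fin m × Fin n) λ φ →
    (∀ d d' → φ d ≡ φ d' → SameVertex M d d')
    × (∀ d d' → SameVertex M d d' → φ d ≡ φ d')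
    × (∀ x → ∃ λ d → φ d ≡ x)
    × (∀ d → ¬ (proj₁ (φ d) ≡ proj₁ (φ (L M d))))
    × (∀ x y → ¬ (proj₁ x ≡ proj₁ y) → ∃ λ d → (φ d ≡ x) × (φ (L M d) ≡ y))
    × (∀ d d' → φ d ≡ φ d' → φ (L M d) ≡ φ (L M d') → d ≡ d')

IsOREmbeddingK : {D : Set} → MapData D → ℕ → ℕ → Set
IsOREmbeddingK M m n = IsOrientablyRegular M × UnderlyingIsKmn M m n

-- The coset map M(G;a,b), with darts = elements of G:
-- dart g is the arc (⟨a⟩g, ⟨a⟩bg); rotation g ↦ ag, reversal g ↦ bg.

cosetMap : {G : Set} → (G → G → G) → (G → G) → G → G → MapData G
cosetMap _·_ inv a b = record
  { R = λ g → a · g ; Rinv = λ g → inv a · g ; L = λ g → b · g }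

-- r is a generator of the unit group of ℤ_q, whose order is n
IsPrimitiveRoot : (q n r : ℕ) .{{_ : NonZero q}} → Set
IsPrimitiveRoot q n r =
  ((r ^ n) Data.Nat.% q ≡ 1 Data.Nat.% q)
  × (∀ k → 0 < k → k < n → ¬ ((r ^ k) Data.Nat.% q ≡ 1 Data.Nat.% q))

nG : ℕ → ℕ → ℕ
nG p e = p ^ e * (p ∸ 1)

qG : ℕ → ℕ → ℕ
qG p e = p ^ (e + 1)

-- The group G₁(p,e) = ⟨a,c | a^n = c^q = 1, c^a = c^r⟩ realised as
-- ℤ_n × ℤ_q, with (i,k) standing for a^i c^k; from c a = a c^r we get
-- (a^i c^k)(a^j c^l) = a^(i+j) c^(k r^j + l).
module G1 (n q r : ℕ) .{{_ : NonZero n}} .{{_ : NonZero q}} where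
  Carrier : Set
  Carrier = Fin n × Fin q

  _·_ : Carrier → Carrier → Carrier
  (i , k) · (j , l) = ((toℕ i + toℕ j) mod n , (toℕ k * r ^ toℕ j + toℕ l) mod q)

  inverse : Carrier → Carrier
  inverse (i , k) =
    ((n ∸ toℕ i) mod n , (q ∸ ((toℕ k * r ^ (n ∸ toℕ i)) Data.Nat.% q)) mod q)

  one : Carrier
  one = (0 mod n , 0 mod q)

  gen-a : Carrier
  gen-a = (1 mod n , 0 mod q)

  gen-c : Carrier
  gen-c = (0 mod n , 1 mod q)

  pow : Carrier → ℕ → Carrier
  pow x zero = one
  pow x (suc k) = x · pow x k

nG-nz : ∀ p e → 2 ≤ p → NonZero (nG p e)
nG-nz (suc (suc k)) e (s≤s (s≤s _)) =
  m*n≢0 (suc (suc k) ^ e) (suc k) {{m^n≢0 (suc (suc k)) e}}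

qG-nz : ∀ p e → 2 ≤ p → NonZero (qG p e)
qG-nz (suc (suc k)) e (s≤s (s≤s _)) = m^n≢0 (suc (suc k)) (e + 1)

IsGeneratorModPower : (p e r : ℕ) → 2 ≤ p → Set
IsGeneratorModPower p e r h =
  IsPrimitiveRoot (qG p e) (nG p e) r {{qG-nz p e h}}

Dart1 : ℕ → ℕ → Set
Dart1 p e = Fin (nG p e) × Fin (qG p e)

M1 : (p e r j : ℕ) → 2 ≤ p → MapData (Dart1 p e)
M1 p e r j h =
  cosetMap _·_ inverse (pow gen-a j) (pow gen-a (nG p e / 2) · gen-c)
  where open G1 (nG p e) (qG p e) r {{nG-nz p e h}} {{qG-nz p e h}}

5≤⇒2≤ : ∀ {p} → 5 ≤ p → 2 ≤ p
5≤⇒2≤ (s≤s (s≤s _)) = s≤s (s≤s z≤n)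

{-# OPTIONS --safe #-}

-- Darts are identified with G = Aut⁺(M), so that R and L become left multiplication by a and b and
-- the vertices are the cosets ⟨a⟩g.  Put d = p − 1, x = aᵈ, y = bxb, let τ be the involution of ⟨a⟩
-- and c = τb.  The kernel of the action of G on the p parts is ⟨y⟩⟨x⟩, the induced action is sharply
-- 2-transitive, c permutes the parts cyclically, and τ inverts c.  It suffices that a normalises
-- ⟨c⟩ and that c has order pᵉ⁺¹: then G = ⟨a⟩⟨c⟩, and a acts on ⟨c⟩ faithfully, hence as a
-- generator of the units mod pᵉ⁺¹.
--
-- This is proved by induction on e.  The permutation induced by x on the cosets of ⟨x⟩ in the kernel
-- has p-power order and a fixed point, hence a second one; this makes x₀ = x^(pᵉ⁻¹) central in the
-- kernel.  Then x₀ and y₀ = bx₀b generate a normal subgroup Ω of order p², and G/Ω satisfies the same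
-- hypotheses with e − 1, so a normalises ⟨c⟩ modulo Ω and c^(pᵉ) ∈ Ω.  If c^(pᵉ) ≠ 1, comparing how
-- τ acts on both sides of a⁻¹ca = ωcᵏ shows ω ∈ ⟨c^(pᵉ)⟩.  If c^(pᵉ) = 1, then g^(pᵉ) is a norm from
-- Ω for every g in the Sylow p-subgroup, and these norms are trivial because x₀ is not fixed by c;
-- this contradicts the exponent hypothesis.
module Submission where

open import Defs
open import Algebra.Bundles using (Group)
open import Algebra.Structures using (IsGroup)
import Algebra.Properties.Group as Groupₚ
open import Data.Bool using (Bool; true; false; not)
import Data.Bool.Properties as Boolₚ
open import Data.Empty using (⊥; ⊥-elim)
open import Data.Fin using (Fin; toℕ; fromℕ<; punchIn; punchOut; combine; remQuot)
import Data.Fin.Properties as Finₚ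
open import Data.List using (List; []; _∷_; _++_; length; filter; applyUpTo; allFin; tabulate)
import Data.List.Properties as Listₚ
open import Data.List.Membership.Propositional using (_∈_; _∉_)
open import Data.List.Membership.Propositional.Properties using (∈-++⁺ˡ; ∈-++⁺ʳ; ∈-++⁻; ∈-filter⁺; ∈-filter⁻; ∈-applyUpTo⁺; ∈-applyUpTo⁻; ∈-allFin; ∈-tabulate⁺; ∈-tabulate⁻)
open import Data.List.Membership.Propositional.Properties.WithK using (unique∧set⇒bag)
open import Data.List.Relation.Binary.BagAndSetEquality using (∼bag⇒↭)
open import Data.List.Relation.Binary.Permutation.Propositional.Properties using (↭-length)
open import Data.List.Relation.Unary.Any using (here)
open import Data.List.Relation.Unary.Unique.Propositional using (Unique)
import Data.List.Relation.Unary.Unique.Propositional.Properties as Uniqueₚ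
open import Data.Nat using (ℕ; zero; suc; _+_; _*_; _∸_; _^_; _≤_; _<_; s≤s; z≤n; NonZero; ≢-nonZero; _/_; _%_; _<?_; >-nonZero; >-nonZero⁻¹)
open import Data.Nat.Coprimality as Coprimality using (Coprime; coprime-divisor; coprime-Bézout)
open import Data.Nat.Divisibility
open import Data.Nat.DivMod
open import Data.Nat.GCD using (module Bézout)
open import Data.Nat.Induction using (<-wellFounded)
open import Data.Nat.Primality using (Prime; euclidsLemma; prime⇒irreducible; prime⇒nonZero; ¬prime[1])
import Data.Nat.Properties as ℕₚ
open import Data.Nat.Tactic.RingSolver using (solve-∀)
open import Data.Product using (Σ; ∃; ∃₂; _×_; _,_; proj₁; proj₂)
open import Data.Sum using (_⊎_; inj₁; inj₂)
open import Data.Vec as Vec using (Vec)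
open import Function using (_∘_; mk⇔)
open import Function.Definitions using (Injective)
open import Induction.WellFounded using (Acc; acc)
open import Level using (0ℓ)
open import Relation.Binary.Bundles using (Setoid)
open import Relation.Binary.Definitions using (DecidableEquality; tri<; tri≈; tri>)
open import Relation.Binary.PropositionalEquality
import Relation.Binary.Reasoning.Setoid as SetoidReasoning
import Relation.Binary.Reflection
open import Relation.Binary.Structures using (IsEquivalence)
open import Relation.Nullary using (¬_; Dec; yes; no; ¬?; contradiction)
open import Relation.Nullary.Decidable using (_×-dec_; map′)
open import Relation.Unary using (Decidable)

-- The fixed-point count only shows that y₀ normalises ⟨x⟩. Centrality needs a third part, distinct
-- from those of ε and b: conjugates of x₀ taken there still normalise ⟨x⟩, while ⟨x⟩ meets its
-- conjugates belonging to other parts trivially, so the relation x₀y = yʳx₀ collapses to yʳ = y. Ω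
-- is divided out because it has exponent p: if pᵉ⁻¹ killed the p-elements of G/Ω, then pᵉ would
-- kill those of G, so the exponent hypothesis descends. All quotients are congruences on the one
-- set of darts; a, b, c, x, y stay the same elements and only the equality changes. Elements of P
-- have p-power order and therefore lie in the kernel times ⟨c⟩; the exponent hypothesis is carried
-- through the induction for this set. The parameter j arises as follows. If a acts on ⟨c⟩ as the
-- generator k of the units, then r = k^j′ and k = rʲ for suitable j′ and j; a^j′ takes the place of
-- the generator a of G₁, and a is its j-th power. Conversely the map recovers c as Rʰ L with h =
-- n/2, and the way c passes the rotation determines rʲ, hence j.

-- Periods, cycles and elementary arithmetic.

injective⇒surjective : ∀ {n} (f : Fin n → Fin n) → Injective _≡_ _≡_ f → ∀ y → ∃ λ x → f x ≡ y
injective⇒surjective {suc n} f inj y with Finₚ.any? (λ x → f x Finₚ.≟ y)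
... | yes hit = hit
... | no miss = ⊥-elim (Finₚ.<⇒notInjective {f = λ x → punchOut (avoid x)} (ℕₚ.n<1+n n)
                  (λ {i} {j} eq → inj (Finₚ.punchOut-injective (avoid i) (avoid j) eq)))
  where
  avoid : ∀ x → y ≢ f x
  avoid x eq = miss (x , sym eq)

least-positive : {S : ℕ → Set} → Decidable S → ∀ T → 0 < T → S T →
                 ∃ λ s → 0 < s × S s × (∀ t → 0 < t → t < s → ¬ S t)
least-positive {S} S? T = go T (<-wellFounded T)
  where
  go : ∀ T → Acc _<_ T → 0 < T → S T → ∃ λ s → 0 < s × S s × (∀ t → 0 < t → t < s → ¬ S t)
  go T (acc rec) T>0 ST with Finₚ.any? {n = T} (λ i → (0 <? toℕ i) ×-dec S? (toℕ i))
  ... | yes (i , i>0 , Si) = go (toℕ i) (rec (Finₚ.toℕ<n i)) i>0 Si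
  ... | no none = T , T>0 , ST , λ t t>0 t<T St →
          none (fromℕ< t<T , subst (λ u → 0 < u × S u) (sym (Finₚ.toℕ-fromℕ< t<T)) (t>0 , St))

-- Encodes that `S` consists of the nonnegative elements of the subgroup sℤ; orders of elements and
-- lengths of orbits all appear in this form.
IsPeriod : (ℕ → Set) → ℕ → Set
IsPeriod S s = 0 < s × (∀ i → S i → s ∣ i) × (∀ i → s ∣ i → S i)

-- Division with remainder by the least positive member. Closure under differences is stated as
-- cancellation from a sum, because exponents are natural numbers.
period : {S : ℕ → Set} → Decidable S → (∀ m n → S m → S n → S (m + n)) →
         (∀ m n → S (m + n) → S m → S n) → ∀ T → 0 < T → S T → ∃ (IsPeriod S)
period {S} S? add sub T T>0 ST with least-positive S? T T>0 ST
... | s , s>0 , Ss , min = s , s>0 , divides-of , λ { i (divides q refl) → multiple q }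
  where
  instance
    s≢0 : NonZero s
    s≢0 = >-nonZero s>0
  multiple : ∀ q → S (q * s)
  multiple zero = sub s 0 (subst S (sym (ℕₚ.+-identityʳ s)) Ss) Ss
  multiple (suc q) = add s (q * s) Ss (multiple q)
  divides-of : ∀ i → S i → s ∣ i
  divides-of i Si with i % s in eq
  ... | zero = m%n≡0⇒n∣m i s eq
  ... | suc r = contradiction
    (sub (i / s * s) (suc r)
      (subst S (trans (m≡m%n+[m/n]*n i s) (trans (ℕₚ.+-comm (i % s) _) (cong (i / s * s +_) eq))) Si)
      (multiple (i / s)))
    (min (suc r) (s≤s z≤n) (subst (_< s) eq (m%n<n i s)))

iterate : {A : Set} → (A → A) → ℕ → A → A
iterate f zero x = x
iterate f (suc t) x = f (iterate f t x)

iterate-+ : ∀ {A : Set} (f : A → A) m n x → iterate f (m + n) x ≡ iterate f m (iterate f n x)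
iterate-+ f zero n x = refl
iterate-+ f (suc m) n x = cong f (iterate-+ f m n x)

-- Removing a full cycle from a σ-closed list keeps it σ-closed, and a cycle has length divisible by k.
module Cycles {A : Set} (_≟_ : DecidableEquality A) (σ : A → A) (T : ℕ) (T>0 : 0 < T)
              (σ^T : ∀ x → iterate σ T x ≡ x) where

  open import Data.List.Membership.DecPropositional _≟_ using (_∈?_)

  -- Since σᵀ is the identity, `m * T ∸ m` further steps undo `m` steps; this serves as an inverse
  -- of σ.
  σ-cancel : ∀ {m n x y} → iterate σ (m + n) x ≡ iterate σ m y → iterate σ n x ≡ y
  σ-cancel {m} {n} {x} {y} eq = begin
    iterate σ n x ≡⟨ unwind m (iterate σ n x) ⟨
    iterate σ (m * T ∸ m) (iterate σ m (iterate σ n x)) ≡⟨ cong (iterate σ (m * T ∸ m)) (iterate-+ σ m n x) ⟨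
    iterate σ (m * T ∸ m) (iterate σ (m + n) x) ≡⟨ cong (iterate σ (m * T ∸ m)) eq ⟩
    iterate σ (m * T ∸ m) (iterate σ m y) ≡⟨ unwind m y ⟩
    y ∎
    where
    open ≡-Reasoning
    wrap : ∀ q z → iterate σ (q * T) z ≡ z
    wrap zero z = refl
    wrap (suc q) z = trans (iterate-+ σ T (q * T) z) (trans (σ^T _) (wrap q z))
    unwind : ∀ m z → iterate σ (m * T ∸ m) (iterate σ m z) ≡ z
    unwind m z = trans (sym (iterate-+ σ (m * T ∸ m) m z))
      (trans (cong (λ t → iterate σ t z) (ℕₚ.m∸n+n≡m (ℕₚ.m≤m*n m T {{>-nonZero T>0}}))) (wrap m z))

  cycle-period : ∀ x → ∃ (IsPeriod (λ t → iterate σ t x ≡ x))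
  cycle-period x = period (λ t → iterate σ t x ≟ x)
    (λ m n Sm Sn → trans (iterate-+ σ m n x) (trans (cong (iterate σ m) Sn) Sm))
    (λ m n Smn Sm → σ-cancel {m} (trans Smn (sym Sm)))
    T T>0 (σ^T x)

  module _ {k : ℕ} where

    private
      Good : List A → Set
      Good ps = Unique ps × (∀ x → x ∈ ps → σ x ∈ ps) × (∀ x → x ∈ ps → ∀ t → iterate σ t x ≡ x → k ∣ t)

      go : ∀ ps → Acc _<_ (length ps) → Good ps → k ∣ length ps
      go [] _ _ = k ∣0
      go (x ∷ xs) (acc rec) (uniq , closed , per) with cycle-period x
      ... | t , t>0 , t∣ , ∣t = subst (k ∣_) (sym split)
              (∣m∣n⇒∣m+n k∣t (go rest (rec shorter) (rest-unique , rest-closed , λ y y∈ → per y (proj₁ (rest⁻ y∈)))))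
        where
        ps cyc rest : List A
        ps = x ∷ xs
        cyc = applyUpTo (λ i → iterate σ i x) t
        rest = filter (λ y → ¬? (y ∈? cyc)) ps

        k∣t : k ∣ t
        k∣t = per x (here refl) t (∣t t ∣-refl)

        rest⁻ : ∀ {y} → y ∈ rest → y ∈ ps × y ∉ cyc
        rest⁻ = ∈-filter⁻ (λ y → ¬? (y ∈? cyc))

        distinct : ∀ {i j} → i < j → j < t → iterate σ i x ≢ iterate σ j x
        distinct {i} {j} i<j j<t eq = ℕₚ.<⇒≱ (ℕₚ.≤-<-trans (ℕₚ.m∸n≤m j i) j<t)
          (∣⇒≤ {{>-nonZero (ℕₚ.m<n⇒0<n∸m i<j)}}
            (t∣ (j ∸ i) (σ-cancel {i} (trans (cong (λ s → iterate σ s x) (ℕₚ.m+[n∸m]≡n (ℕₚ.<⇒≤ i<j))) (sym eq)))))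

        iterate-∈ : ∀ i → iterate σ i x ∈ ps
        iterate-∈ zero = here refl
        iterate-∈ (suc i) = closed _ (iterate-∈ i)

        rest-unique : Unique rest
        rest-unique = Uniqueₚ.filter⁺ (λ y → ¬? (y ∈? cyc)) uniq

        whole-unique : Unique (cyc ++ rest)
        whole-unique = Uniqueₚ.++⁺ (Uniqueₚ.applyUpTo⁺₁ _ t distinct) rest-unique
          (λ (y∈cyc , y∈rest) → proj₂ (rest⁻ y∈rest) y∈cyc)

        to-whole : ∀ {y} → y ∈ ps → y ∈ cyc ++ rest
        to-whole {y} y∈ps with y ∈? cyc
        ... | yes y∈cyc = ∈-++⁺ˡ y∈cyc
        ... | no y∉cyc = ∈-++⁺ʳ cyc (∈-filter⁺ (λ z → ¬? (z ∈? cyc)) y∈ps y∉cyc)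

        from-whole : ∀ {y} → y ∈ cyc ++ rest → y ∈ ps
        from-whole y∈ with ∈-++⁻ cyc y∈
        ... | inj₂ y∈rest = proj₁ (rest⁻ y∈rest)
        ... | inj₁ y∈cyc with ∈-applyUpTo⁻ (λ i → iterate σ i x) y∈cyc
        ...   | i , _ , refl = iterate-∈ i

        split : length ps ≡ t + length rest
        split = trans (↭-length (∼bag⇒↭ (unique∧set⇒bag uniq whole-unique (mk⇔ to-whole from-whole))))
          (trans (Listₚ.length-++ cyc) (cong (_+ length rest) (Listₚ.length-applyUpTo _ t)))

        shorter : length rest < length ps
        shorter = subst (length rest <_) (sym split) (ℕₚ.m<n+m (length rest) t>0)

        rest-closed : ∀ y → y ∈ rest → σ y ∈ rest
        rest-closed y y∈ with rest⁻ y∈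
        ... | y∈ps , y∉cyc = ∈-filter⁺ (λ z → ¬? (z ∈? cyc)) (closed y y∈ps) λ σy∈ → y∉cyc (pull σy∈)
          where
          pull : σ y ∈ cyc → y ∈ cyc
          pull σy∈ with ∈-applyUpTo⁻ (λ i → iterate σ i x) σy∈
          ... | suc i , i<t , eq = subst (_∈ cyc) (sym (σ-cancel {1} {0} eq))
                  (∈-applyUpTo⁺ (λ i → iterate σ i x) (ℕₚ.<-trans (ℕₚ.n<1+n i) i<t))
          ... | zero , _ , eq = subst (_∈ cyc) (sym (σ-cancel {1} {0} (trans eq (sym pre))))
                  (∈-applyUpTo⁺ (λ i → iterate σ i x) (pred< t>0))
            where
            pred< : ∀ {t} → 0 < t → t ∸ 1 < t
            pred< {suc t} _ = ℕₚ.n<1+n t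
            pre : iterate σ (suc (t ∸ 1)) x ≡ x
            pre = trans (cong (λ s → iterate σ s x) (ℕₚ.m+[n∸m]≡n t>0)) (∣t t ∣-refl)

    cycles-divide : ∀ ps → Unique ps → (∀ x → x ∈ ps → σ x ∈ ps) →
                    (∀ x → x ∈ ps → ∀ t → iterate σ t x ≡ x → k ∣ t) → k ∣ length ps
    cycles-divide ps u c p = go ps (<-wellFounded _) (u , c , p)

prime-coprime : ∀ {p q} → Prime p → ¬ (p ∣ q) → Coprime p q
prime-coprime pr p∤q {i} (i∣p , i∣q) with prime⇒irreducible pr i∣p
... | inj₁ i≡1 = i≡1
... | inj₂ refl = contradiction i∣q p∤q

coprime-∣^ : ∀ {m p} k {n} → Coprime m p → m ∣ p ^ k * n → m ∣ n
coprime-∣^ zero {n} cop m∣ = subst (_ ∣_) (ℕₚ.+-identityʳ n) m∣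
coprime-∣^ {m} {p} (suc k) {n} cop m∣ =
  coprime-∣^ k cop (coprime-divisor cop (subst (m ∣_) (ℕₚ.*-assoc p (p ^ k) n) m∣))

-- If `z` were the only fixed point, the other points would split into cycles of length divisible by
-- `k`, so `k` would divide both the number of points and that number minus one.
another-fixed-point : ∀ {k m} (σ : Fin m → Fin m) (z : Fin m) T → 0 < T → (∀ i → iterate σ T i ≡ i) → σ z ≡ z →
  (∀ i t → iterate σ t i ≡ i → k ∣ t ⊎ σ i ≡ i) → k ∣ m → ¬ (k ∣ 1) → ∃ λ i → i ≢ z × σ i ≡ i
another-fixed-point {k} {suc m} σ z T T>0 σ^T σz cyc k∣m k∤1
  with Finₚ.any? (λ i → ¬? (i Finₚ.≟ z) ×-dec (σ i Finₚ.≟ i))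
... | yes found = found
... | no none = contradiction
        (∣m+n∣m⇒∣n (subst (k ∣_) (ℕₚ.+-comm 1 m) k∣m) (subst (k ∣_) len (cycles-divide others unique closed periods))) k∤1
  where
  open Cycles Finₚ._≟_ σ T T>0 σ^T
  others : List (Fin (suc m))
  others = tabulate (punchIn z)
  len : length others ≡ m
  len = Listₚ.length-tabulate (punchIn z)
  unique : Unique others
  unique = Uniqueₚ.tabulate⁺ (λ {i} {j} → Finₚ.punchIn-injective z i j)
  ≢z⇒∈ : ∀ {i} → i ≢ z → i ∈ others
  ≢z⇒∈ {i} i≢z = subst (_∈ others) (Finₚ.punchIn-punchOut (i≢z ∘ sym)) (∈-tabulate⁺ {f = punchIn z} (punchOut (i≢z ∘ sym)))
  ∈⇒≢z : ∀ {i} → i ∈ others → i ≢ z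
  ∈⇒≢z i∈ with ∈-tabulate⁻ {f = punchIn z} i∈
  ... | j , refl = Finₚ.punchInᵢ≢i z j
  closed : ∀ i → i ∈ others → σ i ∈ others
  closed i i∈ = ≢z⇒∈ λ σi≡z → ∈⇒≢z i∈ (σ-cancel {1} {0} {i} {z} (trans σi≡z (sym σz)))
  periods : ∀ i → i ∈ others → ∀ t → iterate σ t i ≡ i → k ∣ t
  periods i i∈ t eq with cyc i t eq
  ... | inj₁ k∣t = k∣t
  ... | inj₂ σi≡i = contradiction (i , ∈⇒≢z i∈ , σi≡i) none

-- The cofactor either contains a factor p, which can be cancelled, or is prime to p and therefore
-- 1.
∣p^1+f⇒∣p^f⊎ : ∀ {p} → Prime p → ∀ f s → s ∣ p ^ suc f → s ∣ p ^ f ⊎ p ^ suc f ∣ s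
∣p^1+f⇒∣p^f⊎ {p} pr f s (divides q eq) with p ∣? q
... | yes (divides q′ refl) = inj₁ (divides q′ (ℕₚ.*-cancelˡ-≡ _ _ p {{prime⇒nonZero pr}}
        (trans eq (trans (cong (_* s) (ℕₚ.*-comm q′ p)) (ℕₚ.*-assoc p q′ s)))))
... | no p∤q = inj₂ (divides 1 (sym (trans (ℕₚ.*-identityˡ _) (trans eq (trans (cong (_* s) q≡1) (ℕₚ.*-identityˡ s))))))
  where
  q∣ : q ∣ p ^ suc f * 1
  q∣ = subst (q ∣_) (sym (ℕₚ.*-identityʳ _)) (divides s (trans eq (ℕₚ.*-comm q s)))
  q≡1 : q ≡ 1
  q≡1 = ∣1⇒≡1 (coprime-∣^ (suc f) (Coprimality.sym (prime-coprime pr p∤q)) q∣)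

inverse-mod : ∀ {i p} → Coprime i p → ¬ (p ∣ 1) → ∃₂ λ u t → i * u ≡ 1 + t * p
inverse-mod {i} {p} cop p∤1 = go (coprime-Bézout cop)
  where
  go : Bézout.Identity 1 i p → ∃₂ λ u t → i * u ≡ 1 + t * p
  go (Bézout.+- u t eq) = u , t , trans (ℕₚ.*-comm i u) (sym eq)
  go (Bézout.-+ u t eq) with u * i in ui
  ... | zero = contradiction (divides t eq) p∤1
  -- Here u i ≡ -1 modulo p, so its square is 1 and u (u i) is an inverse of `i`.
  ... | suc z = u * suc z , z * t , trans (trans (arith i u (suc z)) (cong (_* suc z) ui))
                  (trans (square z) (cong suc (trans (cong (z *_) eq) (sym (ℕₚ.*-assoc z t p)))))
    where
    arith : ∀ i u z → i * (u * z) ≡ (u * i) * z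
    arith = solve-∀
    square : ∀ z → suc z * suc z ≡ 1 + z * suc (suc z)
    square = solve-∀

power-1mod : ∀ t p n → ∃ λ s → (1 + t * p) ^ n ≡ 1 + s * p
power-1mod t p zero = 0 , refl
power-1mod t p (suc n) with power-1mod t p n
... | s , eq = s + t * (1 + s * p) , trans (cong ((1 + t * p) *_) eq) (arith s t p)
  where
  arith : ∀ s t p → (1 + t * p) * (1 + s * p) ≡ 1 + (s + t * (1 + s * p)) * p
  arith = solve-∀

-- Groups: a word solver, powers, conjugation and congruences.

data Word (n : ℕ) : Set where
  var  : Fin n → Word n
  _⊕_  : Word n → Word n → Word n
  _⁻   : Word n → Word n
  :ε   : Word n

infixr 7 _⊕_
infixl 8 _⁻

record GroupOn (D : Set) : Set where
  infixl 7 _∙_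
  infix 8 _⁻¹
  field
    _∙_ : D → D → D
    ε : D
    _⁻¹ : D → D
    isGroup : IsGroup _≡_ _∙_ ε _⁻¹

module GroupTheory {D : Set} (𝔾 : GroupOn D) where

  open GroupOn 𝔾 public
  group : Group 0ℓ 0ℓ
  group = record { isGroup = isGroup }

  open IsGroup isGroup using (assoc; identityˡ; identityʳ; inverseˡ; inverseʳ) public
  open Groupₚ group using (⁻¹-anti-homo-∙; ⁻¹-involutive; ε⁻¹≈ε) public

  module WordSolver where

    Letter : ℕ → Set
    Letter n = Bool × Fin n

    ⟦_⟧ : ∀ {n} → Word n → Vec D n → D
    ⟦ var i ⟧ ρ = Vec.lookup ρ i
    ⟦ e ⊕ f ⟧ ρ = ⟦ e ⟧ ρ ∙ ⟦ f ⟧ ρ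
    ⟦ e ⁻ ⟧ ρ = ⟦ e ⟧ ρ ⁻¹
    ⟦ :ε ⟧ ρ = ε

    letter : ∀ {n} → Letter n → Vec D n → D
    letter (true , i) ρ = Vec.lookup ρ i
    letter (false , i) ρ = Vec.lookup ρ i ⁻¹

    word : ∀ {n} → List (Letter n) → Vec D n → D
    word [] ρ = ε
    word (l ∷ w) ρ = letter l ρ ∙ word w ρ

    cons : ∀ {n} → Letter n → List (Letter n) → List (Letter n)
    cons l [] = l ∷ []
    cons (s , i) ((t , j) ∷ w) with i Finₚ.≟ j | s Boolₚ.≟ not t
    ... | yes _ | yes _ = w
    ... | _ | _ = (s , i) ∷ (t , j) ∷ w

    cancel : ∀ {n} t (i : Fin n) ρ → letter (not t , i) ρ ∙ letter (t , i) ρ ≡ ε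
    cancel true i ρ = inverseˡ _
    cancel false i ρ = inverseʳ _

    cons-sound : ∀ {n} (l : Letter n) w ρ → word (cons l w) ρ ≡ letter l ρ ∙ word w ρ
    cons-sound l [] ρ = refl
    cons-sound (s , i) ((t , j) ∷ w) ρ with i Finₚ.≟ j | s Boolₚ.≟ not t
    ... | yes refl | yes refl = sym (trans (sym (assoc _ _ _)) (trans (cong (_∙ word w ρ) (cancel t i ρ)) (identityˡ _)))
    ... | yes _ | no _ = refl
    ... | no _ | yes _ = refl
    ... | no _ | no _ = refl

    mutual
      -- Accumulator form: the reduced word of `e`, respectively of its inverse, is put in front of
      -- `w`. Since `cons` cancels inverse neighbours at once, equal elements of the free group end
      -- in the same list.
      pos neg : ∀ {n} → Word n → List (Letter n) → List (Letter n)
      pos (var i) w = cons (true , i) w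
      pos (e ⊕ f) w = pos e (pos f w)
      pos (e ⁻) w = neg e w
      pos :ε w = w
      neg (var i) w = cons (false , i) w
      neg (e ⊕ f) w = neg f (neg e w)
      neg (e ⁻) w = pos e w
      neg :ε w = w

    mutual
      pos-sound : ∀ {n} (e : Word n) w ρ → word (pos e w) ρ ≡ ⟦ e ⟧ ρ ∙ word w ρ
      pos-sound (var i) w ρ = cons-sound (true , i) w ρ
      pos-sound (e ⊕ f) w ρ = trans (pos-sound e _ ρ) (trans (cong (⟦ e ⟧ ρ ∙_) (pos-sound f w ρ)) (sym (assoc _ _ _)))
      pos-sound (e ⁻) w ρ = neg-sound e w ρ
      pos-sound :ε w ρ = sym (identityˡ _)
      neg-sound : ∀ {n} (e : Word n) w ρ → word (neg e w) ρ ≡ ⟦ e ⟧ ρ ⁻¹ ∙ word w ρ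
      neg-sound (var i) w ρ = cons-sound (false , i) w ρ
      neg-sound (e ⊕ f) w ρ = trans (neg-sound f _ ρ) (trans (cong (⟦ f ⟧ ρ ⁻¹ ∙_) (neg-sound e w ρ))
        (trans (sym (assoc _ _ _)) (cong (_∙ word w ρ) (sym (⁻¹-anti-homo-∙ _ _)))))
      neg-sound (e ⁻) w ρ = trans (pos-sound e w ρ) (cong (_∙ word w ρ) (sym (⁻¹-involutive _)))
      neg-sound :ε w ρ = sym (trans (cong (_∙ word w ρ) ε⁻¹≈ε) (identityˡ _))

    ⟦_⇓⟧ : ∀ {n} → Word n → Vec D n → D
    ⟦ e ⇓⟧ ρ = word (pos e []) ρ

    correct : ∀ {n} (e : Word n) ρ → ⟦ e ⇓⟧ ρ ≡ ⟦ e ⟧ ρ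
    correct e ρ = trans (pos-sound e [] ρ) (identityʳ _)

  open Relation.Binary.Reflection (setoid D) var WordSolver.⟦_⟧ WordSolver.⟦_⇓⟧ WordSolver.correct
    using (solve; _⊜_) public

  infixl 9 _↑_
  _↑_ : D → ℕ → D
  g ↑ zero = ε
  g ↑ suc n = g ∙ (g ↑ n)

  conj : D → D → D
  conj h g = (h ⁻¹) ∙ (g ∙ h)

  ↑-+ : ∀ g m n → g ↑ (m + n) ≡ (g ↑ m) ∙ (g ↑ n)
  ↑-+ g zero n = sym (identityˡ _)
  ↑-+ g (suc m) n = trans (cong (g ∙_) (↑-+ g m n)) (sym (assoc _ _ _))

  ε↑ : ∀ n → ε ↑ n ≡ ε
  ε↑ zero = refl
  ε↑ (suc n) = trans (identityˡ _) (ε↑ n)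

  ↑-* : ∀ g m n → g ↑ (m * n) ≡ (g ↑ m) ↑ n
  ↑-* g m zero = cong (g ↑_) (ℕₚ.*-zeroʳ m)
  ↑-* g m (suc n) = trans (cong (g ↑_) (ℕₚ.*-suc m n)) (trans (↑-+ g m (m * n)) (cong ((g ↑ m) ∙_) (↑-* g m n)))

  ↑-suc : ∀ g n → g ∙ g ↑ n ≡ g ↑ n ∙ g
  ↑-suc g zero = trans (identityʳ g) (sym (identityˡ g))
  ↑-suc g (suc n) = trans (cong (g ∙_) (↑-suc g n)) (sym (assoc g (g ↑ n) g))

  ↑-comm : ∀ g m n → (g ↑ m) ∙ (g ↑ n) ≡ (g ↑ n) ∙ (g ↑ m)
  ↑-comm g m n = trans (sym (↑-+ g m n)) (trans (cong (g ↑_) (ℕₚ.+-comm m n)) (↑-+ g n m))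

  conj-∙ : ∀ h g k → conj h (g ∙ k) ≡ conj h g ∙ conj h k
  conj-∙ = solve 3 (λ h g k → h ⁻ ⊕ ((g ⊕ k) ⊕ h) ⊜ (h ⁻ ⊕ (g ⊕ h)) ⊕ (h ⁻ ⊕ (k ⊕ h))) refl

  conj-conj : ∀ h k g → conj k (conj h g) ≡ conj (h ∙ k) g
  conj-conj = solve 3 (λ h k g → k ⁻ ⊕ ((h ⁻ ⊕ (g ⊕ h)) ⊕ k) ⊜ ((h ⊕ k) ⁻) ⊕ (g ⊕ (h ⊕ k))) refl

  conj-⁻¹ : ∀ h g → conj h (g ⁻¹) ≡ (conj h g) ⁻¹
  conj-⁻¹ = solve 2 (λ h g → h ⁻ ⊕ (g ⁻ ⊕ h) ⊜ (h ⁻ ⊕ (g ⊕ h)) ⁻) refl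

  conj-cancel : ∀ h g → conj (h ⁻¹) (conj h g) ≡ g
  conj-cancel = solve 2 (λ h g → (h ⁻ ⁻) ⊕ ((h ⁻ ⊕ (g ⊕ h)) ⊕ h ⁻) ⊜ g) refl

  conj-ε : ∀ h → conj h ε ≡ ε
  conj-ε = solve 1 (λ h → h ⁻ ⊕ (:ε ⊕ h) ⊜ :ε) refl

  conj-by-ε : ∀ g → conj ε g ≡ g
  conj-by-ε = solve 1 (λ g → (:ε ⁻) ⊕ (g ⊕ :ε) ⊜ g) refl

  conj-↑ : ∀ h g n → conj h (g ↑ n) ≡ (conj h g) ↑ n
  conj-↑ h g zero = conj-ε h
  conj-↑ h g (suc n) = trans (conj-∙ h g (g ↑ n)) (cong (conj h g ∙_) (conj-↑ h g n))

  ⁻¹-↑ : ∀ g n → (g ↑ n) ⁻¹ ≡ (g ⁻¹) ↑ n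
  ⁻¹-↑ g zero = ε⁻¹≈ε
  ⁻¹-↑ g (suc n) = trans (cong _⁻¹ (↑-suc g n)) (trans (⁻¹-anti-homo-∙ _ _) (cong (g ⁻¹ ∙_) (⁻¹-↑ g n)))

  -- A quotient group kept as a relation on `D`: passing to a further quotient changes the equality
  -- but neither the elements nor the word solver. Compatibility with inverses is derived in
  -- `⁻¹-cong`.
  record Congruence : Set₁ where
    infix 4 _≈_
    field
      _≈_ : D → D → Set
      ≈-isEquivalence : IsEquivalence _≈_
      ∙-cong : ∀ {g g′ h h′} → g ≈ g′ → h ≈ h′ → (g ∙ h) ≈ (g′ ∙ h′)

  normal-congruence : (N : D → Set) → N ε → (∀ {g h} → N g → N h → N (g ∙ h)) → (∀ {g} → N g → N (g ⁻¹)) →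
                      (∀ h {g} → N g → N (conj h g)) → Congruence
  normal-congruence N N-ε N-∙ N-⁻¹ N-conj = record
    { _≈_ = λ g h → N (g ∙ h ⁻¹)
    ; ≈-isEquivalence = record
      { refl = λ {g} → subst N (sym (inverseʳ g)) N-ε
      ; sym = λ {g} {h} k → subst N (solve 2 (λ g h → (g ⊕ h ⁻) ⁻ ⊜ h ⊕ g ⁻) refl g h) (N-⁻¹ k)
      ; trans = λ {g} {h} {k} l l′ → subst N (solve 3 (λ g h k → (g ⊕ h ⁻) ⊕ (h ⊕ k ⁻) ⊜ g ⊕ k ⁻) refl g h k) (N-∙ l l′) }
    ; ∙-cong = λ {g} {g′} {h} {h′} k k′ → subst N
        (solve 4 (λ g g′ h h′ → ((g ⁻ ⁻) ⊕ ((h ⊕ h′ ⁻) ⊕ g ⁻)) ⊕ (g ⊕ g′ ⁻) ⊜ (g ⊕ h) ⊕ ((g′ ⊕ h′) ⁻)) refl g g′ h h′)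
        (N-∙ (N-conj (g ⁻¹) k′) k) }

  ≡-congruence : Congruence
  ≡-congruence = record { _≈_ = _≡_ ; ≈-isEquivalence = isEquivalence ; ∙-cong = cong₂ _∙_ }

  module Modulo (C : Congruence) where
    open Congruence C public
    open IsEquivalence ≈-isEquivalence public
      renaming (refl to ≈-refl; sym to ≈-sym; trans to ≈-trans; reflexive to ≡⇒≈)

    ≈-setoid : Setoid 0ℓ 0ℓ
    ≈-setoid = record { isEquivalence = ≈-isEquivalence }

    module ≈-Reasoning = SetoidReasoning ≈-setoid

    ∙-congˡ : ∀ {g h h′} → h ≈ h′ → (g ∙ h) ≈ (g ∙ h′)
    ∙-congˡ = ∙-cong ≈-refl

    ∙-congʳ : ∀ {g g′ h} → g ≈ g′ → (g ∙ h) ≈ (g′ ∙ h)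
    ∙-congʳ eq = ∙-cong eq ≈-refl

    cancelˡ : ∀ k {g h} → (k ∙ g) ≈ (k ∙ h) → g ≈ h
    cancelˡ k {g} {h} eq = ≈-trans (≡⇒≈ (solve 2 (λ k g → g ⊜ k ⁻ ⊕ (k ⊕ g)) refl k g))
      (≈-trans (∙-congˡ eq) (≡⇒≈ (solve 2 (λ k g → k ⁻ ⊕ (k ⊕ g) ⊜ g) refl k h)))

    cancelʳ : ∀ k {g h} → (g ∙ k) ≈ (h ∙ k) → g ≈ h
    cancelʳ k {g} {h} eq = ≈-trans (≡⇒≈ (solve 2 (λ k g → g ⊜ (g ⊕ k) ⊕ k ⁻) refl k g))
      (≈-trans (∙-congʳ eq) (≡⇒≈ (solve 2 (λ k g → (g ⊕ k) ⊕ k ⁻ ⊜ g) refl k h)))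

    ⁻¹-cong : ∀ {g h} → g ≈ h → (g ⁻¹) ≈ (h ⁻¹)
    ⁻¹-cong {g} {h} eq = cancelˡ g (≈-trans (≡⇒≈ (trans (inverseʳ g) (sym (inverseʳ h)))) (∙-congʳ (≈-sym eq)))

    ↑-cong : ∀ {g h} n → g ≈ h → (g ↑ n) ≈ (h ↑ n)
    ↑-cong zero eq = ≈-refl
    ↑-cong (suc n) eq = ∙-cong eq (↑-cong n eq)

    conj-cong : ∀ h {g g′} → g ≈ g′ → conj h g ≈ conj h g′
    conj-cong h eq = ∙-congˡ (∙-congʳ eq)

    conj-cong₂ : ∀ {h h′ g g′} → h ≈ h′ → g ≈ g′ → conj h g ≈ conj h′ g′
    conj-cong₂ eq eq′ = ∙-cong (⁻¹-cong eq) (∙-cong eq′ eq)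

    ↑-∣ : ∀ {g m n} → (g ↑ m) ≈ ε → m ∣ n → (g ↑ n) ≈ ε
    ↑-∣ {g} {m} eq (divides q refl) = ≈-trans (≡⇒≈ (trans (cong (g ↑_) (ℕₚ.*-comm q m)) (↑-* g m q)))
      (≈-trans (↑-cong q eq) (≡⇒≈ (ε↑ q)))

    ↑-% : ∀ {g m} .{{_ : NonZero m}} → g ↑ m ≈ ε → ∀ i → g ↑ (i % m) ≈ g ↑ i
    ↑-% {g} {m} eq i = begin
      g ↑ (i % m) ≡⟨ identityʳ _ ⟨
      g ↑ (i % m) ∙ ε ≈⟨ ∙-congˡ (↑-∣ {g} {m} {i / m * m} eq (n∣m*n (i / m))) ⟨
      g ↑ (i % m) ∙ g ↑ (i / m * m) ≡⟨ ↑-+ g (i % m) (i / m * m) ⟨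
      g ↑ (i % m + i / m * m) ≡⟨ cong (g ↑_) (m≡m%n+[m/n]*n i m) ⟨
      g ↑ i ∎
      where open ≈-Reasoning

    ↑-mod : ∀ {g m} .{{_ : NonZero m}} → g ↑ m ≈ ε → ∀ i → g ↑ toℕ (i mod m) ≈ g ↑ i
    ↑-mod {g} {m} eq i = ≈-trans (≡⇒≈ (cong (g ↑_) (Finₚ.toℕ-fromℕ< (m%n<n i m)))) (↑-% {g} {m} eq i)

    ↑-pred : ∀ {g T} → 0 < T → (g ↑ T) ≈ ε → (g ⁻¹) ≈ (g ↑ (T ∸ 1))
    ↑-pred {g} {suc T} _ eq = cancelˡ g (≈-trans (≡⇒≈ (inverseʳ g)) (≈-sym eq))

    -- Exponents are natural numbers, so from here on `(T ∸ 1) * n` stands for -n.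
    ↑⁻¹ : ∀ {g T} → 0 < T → (g ↑ T) ≈ ε → ∀ n → ((g ↑ n) ⁻¹) ≈ (g ↑ ((T ∸ 1) * n))
    ↑⁻¹ {g} {T} T>0 eq n = ≈-trans (≡⇒≈ (⁻¹-↑ g n))
      (≈-trans (↑-cong n (↑-pred T>0 eq)) (≡⇒≈ (sym (↑-* g (T ∸ 1) n))))

    ↑-diff : ∀ {g i j} → j ≤ i → (g ↑ i) ≈ (g ↑ j) → (g ↑ (i ∸ j)) ≈ ε
    ↑-diff {g} {i} {j} j≤i eq = cancelˡ (g ↑ j) (≈-trans (≡⇒≈ (trans (sym (↑-+ g j (i ∸ j))) (cong (g ↑_) (ℕₚ.m+[n∸m]≡n j≤i))))
      (≈-trans eq (≡⇒≈ (sym (identityʳ _)))))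

    Commute : D → D → Set
    Commute g h = (g ∙ h) ≈ (h ∙ g)

    commute⇒conj : ∀ {g h} → Commute g h → conj h g ≈ g
    commute⇒conj {g} {h} c = ≈-trans (∙-congˡ c) (≡⇒≈ (solve 2 (λ g h → h ⁻ ⊕ (h ⊕ g) ⊜ g) refl g h))

    conj⇒commute : ∀ {g h} → conj h g ≈ g → Commute g h
    conj⇒commute {g} {h} c = ≈-trans (≡⇒≈ (solve 2 (λ g h → g ⊕ h ⊜ h ⊕ (h ⁻ ⊕ (g ⊕ h))) refl g h)) (∙-congˡ c)

    commute-ε : ∀ g → Commute g ε
    commute-ε g = ≡⇒≈ (trans (identityʳ g) (sym (identityˡ g)))

    commute-∙ : ∀ {g h k} → Commute g h → Commute g k → Commute g (h ∙ k)
    commute-∙ {g} {h} {k} c c′ = begin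
      g ∙ (h ∙ k) ≡⟨ assoc g h k ⟨
      (g ∙ h) ∙ k ≈⟨ ∙-congʳ c ⟩
      (h ∙ g) ∙ k ≡⟨ assoc h g k ⟩
      h ∙ (g ∙ k) ≈⟨ ∙-congˡ c′ ⟩
      h ∙ (k ∙ g) ≡⟨ assoc h k g ⟨
      (h ∙ k) ∙ g ∎
      where open ≈-Reasoning

    commute-↑ : ∀ {g h} n → Commute g h → Commute g (h ↑ n)
    commute-↑ {g} zero c = commute-ε g
    commute-↑ (suc n) c = commute-∙ c (commute-↑ n c)

    commute-⁻¹ : ∀ {g h} → Commute g h → Commute g (h ⁻¹)
    commute-⁻¹ {g} {h} c = cancelˡ h (begin
      h ∙ (g ∙ (h ⁻¹)) ≡⟨ assoc _ _ _ ⟨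
      (h ∙ g) ∙ (h ⁻¹) ≈⟨ ∙-congʳ c ⟨
      (g ∙ h) ∙ (h ⁻¹) ≡⟨ solve 2 (λ g h → (g ⊕ h) ⊕ h ⁻ ⊜ h ⊕ (h ⁻ ⊕ g)) refl g h ⟩
      h ∙ ((h ⁻¹) ∙ g) ∎)
      where open ≈-Reasoning

    commute-respʳ : ∀ {g h h′} → h ≈ h′ → Commute g h → Commute g h′
    commute-respʳ eq c = ≈-trans (∙-congˡ (≈-sym eq)) (≈-trans c (∙-congʳ eq))

    ∙-↑ : ∀ {g h} n → Commute g h → ((g ∙ h) ↑ n) ≈ ((g ↑ n) ∙ (h ↑ n))
    ∙-↑ zero c = ≡⇒≈ (sym (identityˡ ε))
    ∙-↑ {g} {h} (suc n) c = begin
      (g ∙ h) ∙ ((g ∙ h) ↑ n) ≈⟨ ∙-congˡ (∙-↑ n c) ⟩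
      (g ∙ h) ∙ ((g ↑ n) ∙ (h ↑ n)) ≡⟨ solve 4 (λ g h k l → (g ⊕ h) ⊕ (k ⊕ l) ⊜ g ⊕ ((h ⊕ k) ⊕ l)) refl _ _ _ _ ⟩
      g ∙ ((h ∙ (g ↑ n)) ∙ (h ↑ n)) ≈⟨ ∙-congˡ (∙-congʳ (commute-↑ n (≈-sym c))) ⟩
      g ∙ (((g ↑ n) ∙ h) ∙ (h ↑ n)) ≡⟨ solve 4 (λ g h k l → g ⊕ ((k ⊕ h) ⊕ l) ⊜ (g ⊕ k) ⊕ (h ⊕ l)) refl _ _ _ _ ⟩
      (g ∙ (g ↑ n)) ∙ (h ∙ (h ↑ n)) ∎
      where open ≈-Reasoning

prime-∤1 : ∀ {p} → Prime p → ¬ (p ∣ 1)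
prime-∤1 pr p∣1 with ∣1⇒≡1 p∣1
... | refl = ¬prime[1] pr

∣prime∧≢1⇒≡ : ∀ {p s} → Prime p → s ∣ p → s ≢ 1 → s ≡ p
∣prime∧≢1⇒≡ pr s∣p s≢1 with prime⇒irreducible pr s∣p
... | inj₁ s≡1 = contradiction s≡1 s≢1
... | inj₂ s≡p = s≡p

pred-coprime : ∀ d → Coprime d (suc d)
pred-coprime d {i} (i∣d , i∣1+d) = ∣1⇒≡1 (∣m+n∣m⇒∣n (subst (i ∣_) (ℕₚ.+-comm 1 d) i∣1+d) i∣d)

-- The action on the parts

-- The prime is p = d + 1.
record OddPrime (d : ℕ) : Set where
  field
    prime : Prime (suc d)
    half : ℕ
    half>0 : 0 < half
    d≡2half : d ≡ half + half

  1<d : 1 < d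
  1<d = subst (1 <_) (sym d≡2half) (ℕₚ.+-mono-≤ half>0 half>0)

  d>0 : 0 < d
  d>0 = ℕₚ.<-trans (s≤s z≤n) 1<d

  p∤1 : ¬ (suc d ∣ 1)
  p∤1 = prime-∤1 prime

  p∤2 : ¬ (suc d ∣ 2)
  p∤2 p∣2 = ℕₚ.<⇒≱ (s≤s 1<d) (∣⇒≤ p∣2)

-- Darts form a group in which R and L are left multiplication by a and b: the vertices are the
-- cosets ⟨a⟩g, and β g is the part containing the vertex of g.
record Geometry {D : Set} (𝔾 : GroupOn D) (d e : ℕ) : Set where
  open GroupTheory 𝔾
  field
    _≟_ : DecidableEquality D
    a b : D
    b∙b : b ∙ b ≡ ε
    β : D → Fin (suc d)
    β-right : ∀ {g h} k → β g ≡ β h → β (g ∙ k) ≡ β (h ∙ k)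
    β-a : ∀ g → β (a ∙ g) ≡ β g
    β-b : ∀ g → β (b ∙ g) ≢ β g
    β-onto : ∀ i → ∃ λ g → β g ≡ i
    cell : ∀ g → β g ≢ β ε → ∃₂ λ i j → g ≡ a ↑ i ∙ (b ∙ a ↑ j)
    cell-unique : ∀ i j → a ↑ i ∙ (b ∙ a ↑ j) ≡ b → a ↑ i ≡ ε × a ↑ j ≡ ε
    a-order : ∀ i → a ↑ i ≡ ε → suc d ^ e * d ∣ i
    a-finite : a ↑ (suc d ^ e * d) ≡ ε
    blocks : ∀ i → β (b ∙ a ↑ i) ≡ β b → d ∣ i
    blocks-finite : β (b ∙ a ↑ d) ≡ β b

module Blocks {D : Set} {𝔾 : GroupOn D} {d e : ℕ} (Γ : Geometry 𝔾 d e) (π : OddPrime d) where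

  open OddPrime π
  open GroupTheory 𝔾
  open Geometry Γ
  open Modulo ≡-congruence using (cancelˡ)

  p n : ℕ
  p = suc d
  n = p ^ e * d

  instance
    d≢0 : NonZero d
    d≢0 = >-nonZero d>0

  p^≢0 : ∀ k → NonZero (p ^ k)
  p^≢0 k = ℕₚ.m^n≢0 p k

  x y τ c : D
  x = a ↑ d
  y = b ∙ (x ∙ b)
  τ = a ↑ (p ^ e * half)
  c = τ ∙ b

  b⁻¹ : b ⁻¹ ≡ b
  b⁻¹ = cancelˡ b (trans (inverseʳ b) (sym b∙b))

  bb : ∀ g → b ∙ (b ∙ g) ≡ g
  bb g = trans (sym (assoc b b g)) (trans (cong (_∙ g) b∙b) (identityˡ g))

  ττ : τ ∙ τ ≡ ε
  ττ = trans (sym (↑-+ a (p ^ e * half) _)) (trans (cong (a ↑_) (trans (sym (ℕₚ.*-distribˡ-+ (p ^ e) half half)) (cong (p ^ e *_) (sym d≡2half)))) a-finite)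

  τ⁻¹ : τ ⁻¹ ≡ τ
  τ⁻¹ = cancelˡ τ (trans (inverseʳ τ) (sym ττ))

  x↑ : ∀ i → x ↑ i ≡ a ↑ (d * i)
  x↑ i = sym (↑-* a d i)

  y↑ : ∀ i → y ↑ i ≡ b ∙ (x ↑ i ∙ b)
  y↑ i = trans (cong (_↑ i) (cong (_∙ (x ∙ b)) (sym b⁻¹))) (trans (sym (conj-↑ b x i)) (cong (_∙ (x ↑ i ∙ b)) b⁻¹))

  x-finite : x ↑ (p ^ e) ≡ ε
  x-finite = trans (x↑ (p ^ e)) (trans (cong (a ↑_) (ℕₚ.*-comm d (p ^ e))) a-finite)

  a-order′ : ∀ {i} → d ∣ i → ∃ λ j → a ↑ i ≡ x ↑ j
  a-order′ (divides q refl) = q , trans (cong (a ↑_) (ℕₚ.*-comm q d)) (↑-* a d q)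

  -- As y = bxb, multiplication by b turns the relation into xⁱ b xʲ = b, and `cell-unique` allows
  -- this only if both powers of x vanish.
  yx-unique : ∀ i j → y ↑ i ∙ x ↑ j ≡ ε → p ^ e ∣ i × p ^ e ∣ j
  yx-unique i j eq = div i (proj₁ both) , div j (proj₂ both)
    where
    open ≡-Reasoning
    both : a ↑ (d * i) ≡ ε × a ↑ (d * j) ≡ ε
    both = cell-unique (d * i) (d * j) (begin
      a ↑ (d * i) ∙ (b ∙ a ↑ (d * j)) ≡⟨ cong₂ (λ u v → u ∙ (b ∙ v)) (x↑ i) (x↑ j) ⟨
      x ↑ i ∙ (b ∙ x ↑ j) ≡⟨ bb _ ⟨
      b ∙ (b ∙ (x ↑ i ∙ (b ∙ x ↑ j))) ≡⟨ cong (b ∙_) (solve 3 (λ b u v → b ⊕ (u ⊕ (b ⊕ v)) ⊜ (b ⊕ (u ⊕ b)) ⊕ v) refl b _ _) ⟩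
      b ∙ ((b ∙ (x ↑ i ∙ b)) ∙ x ↑ j) ≡⟨ cong (λ u → b ∙ (u ∙ x ↑ j)) (y↑ i) ⟨
      b ∙ (y ↑ i ∙ x ↑ j) ≡⟨ cong (b ∙_) eq ⟩
      b ∙ ε ≡⟨ identityʳ b ⟩
      b ∎)
    div : ∀ i → a ↑ (d * i) ≡ ε → p ^ e ∣ i
    div i eq′ = *-cancelˡ-∣ d (subst (_∣ d * i) (ℕₚ.*-comm (p ^ e) d) (a-order (d * i) eq′))

  β-a↑ : ∀ i g → β (a ↑ i ∙ g) ≡ β g
  β-a↑ zero g = cong β (identityˡ g)
  β-a↑ (suc i) g = trans (cong β (assoc _ _ _)) (trans (β-a _) (β-a↑ i g))

  β-right⁻ : ∀ {g h} k → β (g ∙ k) ≡ β (h ∙ k) → β g ≡ β h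
  β-right⁻ {g} {h} k eq = trans (cong β (strip g)) (trans (β-right (k ⁻¹) eq) (cong β (sym (strip h))))
    where
    strip : ∀ g → g ≡ (g ∙ k) ∙ k ⁻¹
    strip g = solve 2 (λ g k → g ⊜ (g ⊕ k) ⊕ k ⁻) refl g k

  b≁ε : β b ≢ β ε
  b≁ε eq = β-b ε (trans (cong β (identityʳ b)) eq)

  -- The kernel of the action on the parts: automorphisms are right multiplications, so `g ∙ k` is
  -- the image of the dart `g` under `k`.
  Fix : D → Set
  Fix k = ∀ g → β (g ∙ k) ≡ β g

  fix-ε : Fix ε
  fix-ε g = cong β (identityʳ g)

  fix-∙ : ∀ {k l} → Fix k → Fix l → Fix (k ∙ l)
  fix-∙ {k} {l} fk fl g = trans (cong β (sym (assoc g k l))) (trans (fl (g ∙ k)) (fk g))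

  fix-⁻¹ : ∀ {k} → Fix k → Fix (k ⁻¹)
  fix-⁻¹ {k} fk g = trans (sym (fk (g ∙ k ⁻¹))) (cong β (solve 2 (λ g k → (g ⊕ k ⁻) ⊕ k ⊜ g) refl g k))

  fix-conj : ∀ h {k} → Fix k → Fix (conj h k)
  fix-conj h {k} fk g = trans (cong β (solve 3 (λ g h k → g ⊕ (h ⁻ ⊕ (k ⊕ h)) ⊜ ((g ⊕ h ⁻) ⊕ k) ⊕ h) refl g h k))
    (trans (β-right h (fk (g ∙ h ⁻¹))) (cong β (solve 2 (λ g h → (g ⊕ h ⁻) ⊕ h ⊜ g) refl g h)))

  fix-↑ : ∀ {k} i → Fix k → Fix (k ↑ i)
  fix-↑ zero fk = fix-ε
  fix-↑ (suc i) fk = fix-∙ fk (fix-↑ i fk)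

  -- Every part other than that of ε contains some b aʲ. As x = aᵈ commutes with aʲ,
  -- `blocks-finite`, a statement about the part of b, carries over to all of them.
  fix-x : Fix x
  fix-x g with β g Finₚ.≟ β ε
  ... | yes g∼ε = trans (β-right x g∼ε) (trans (cong β (trans (identityˡ x) (sym (identityʳ x)))) (trans (β-a↑ d ε) (sym g∼ε)))
  ... | no g≁ε with cell g g≁ε
  ...   | i , j , refl = trans (cong β shift) (trans (β-a↑ i _) (trans (β-right (a ↑ j) blocks-finite) (sym (β-a↑ i _))))
    where
    shift : (a ↑ i ∙ (b ∙ a ↑ j)) ∙ x ≡ a ↑ i ∙ ((b ∙ x) ∙ a ↑ j)
    shift = trans (solve 4 (λ u b v x → (u ⊕ (b ⊕ v)) ⊕ x ⊜ u ⊕ (b ⊕ (v ⊕ x))) refl _ _ _ _)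
      (cong (a ↑ i ∙_) (trans (cong (b ∙_) (↑-comm a j d)) (sym (assoc _ _ _))))

  y≡conj : y ≡ conj b x
  y≡conj = cong (_∙ (x ∙ b)) (sym b⁻¹)

  fix-y : Fix y
  fix-y = subst Fix (sym y≡conj) (fix-conj b fix-x)

  -- Since bk lies outside the part of ε, it has the form aⁱbaʲ. Fixing the part of b makes aʲ a
  -- power of x; once this is removed, fixing the part of ε makes aⁱ one too, and baⁱb becomes a
  -- power of y.
  two-blocks : ∀ k → β k ≡ β ε → β (b ∙ k) ≡ β b → ∃₂ λ i j → k ≡ y ↑ i ∙ x ↑ j
  two-blocks k k∼ε bk∼b with cell (b ∙ k) (λ eq → b≁ε (trans (sym bk∼b) eq))
  ... | i , j , eq with a-order′ (blocks j (trans (sym (trans (cong β eq) (β-a↑ i _))) bk∼b))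
  ...   | j′ , aj≡ with a-order′ (blocks i bai∼b)
    where
    k≡ : k ≡ (b ∙ (a ↑ i ∙ b)) ∙ x ↑ j′
    k≡ = trans (sym (bb k)) (trans (cong (b ∙_) eq) (trans (cong (λ u → b ∙ (a ↑ i ∙ (b ∙ u))) aj≡)
           (solve 3 (λ b u v → b ⊕ (u ⊕ (b ⊕ v)) ⊜ (b ⊕ (u ⊕ b)) ⊕ v) refl _ _ _)))
    bai∼b : β (b ∙ a ↑ i) ≡ β b
    bai∼b = β-right⁻ b (trans (cong β (assoc b _ b)) (trans (sym (fix-↑ j′ fix-x _))
      (trans (sym (cong β k≡)) (trans k∼ε (cong β (sym b∙b))))))
  ...     | i′ , ai≡ = i′ , j′ , trans (sym (bb k)) (trans (cong (b ∙_) eq) (trans (cong₂ (λ u v → b ∙ (u ∙ (b ∙ v))) ai≡ aj≡)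
           (trans (solve 3 (λ b u v → b ⊕ (u ⊕ (b ⊕ v)) ⊜ (b ⊕ (u ⊕ b)) ⊕ v) refl b (x ↑ i′) (x ↑ j′))
             (cong (_∙ x ↑ j′) (sym (y↑ i′))))))

  fix⇒yx : ∀ k → Fix k → ∃₂ λ i j → k ≡ y ↑ i ∙ x ↑ j
  fix⇒yx k fk = two-blocks k (trans (cong β (sym (identityˡ k))) (fk ε)) (fk b)

  conj-b-b : ∀ g → conj b (conj b g) ≡ g
  conj-b-b g = trans (cong (λ u → conj u (conj b g)) (sym b⁻¹)) (conj-cancel b g)

  conj-y↑ : ∀ i → conj b (y ↑ i) ≡ x ↑ i
  conj-y↑ i = trans (cong (λ u → conj b (u ↑ i)) y≡conj) (trans (cong (conj b) (sym (conj-↑ b x i))) (conj-b-b (x ↑ i)))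

  conj-x↑ : ∀ i → conj b (x ↑ i) ≡ y ↑ i
  conj-x↑ i = trans (conj-↑ b x i) (cong (_↑ i) (sym y≡conj))

  fix⇒xy : ∀ k → Fix k → ∃₂ λ i j → k ≡ x ↑ i ∙ y ↑ j
  fix⇒xy k fk = let (i , j , eq) = fix⇒yx (conj b k) (fix-conj b fk) in
          i , j , trans (sym (conj-b-b k)) (trans (cong (conj b) eq)
          (trans (conj-∙ b (y ↑ i) (x ↑ j)) (cong₂ _∙_ (conj-y↑ i) (conj-x↑ j))))

  yx⇒fix : ∀ {k} → (∃₂ λ i j → k ≡ y ↑ i ∙ x ↑ j) → Fix k
  yx⇒fix (i , j , refl) = fix-∙ (fix-↑ i fix-y) (fix-↑ j fix-x)

  -- Sharpness of the 2-transitive action. For f = aʲg one has h = aⁱbf, so conjugation by f moves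
  -- the two fixed parts to those of ε and b, where `two-blocks` applies.
  two-fixed⇒fix : ∀ g h k → β (g ∙ k) ≡ β g → β (h ∙ k) ≡ β h → β g ≢ β h → Fix k
  two-fixed⇒fix g h k gk hk g≁h with cell (h ∙ g ⁻¹) (λ eq → g≁h (sym (β-right⁻ (g ⁻¹) (trans eq (cong β (sym (inverseʳ g)))))))
  ... | i , j , eq = subst Fix (solve 2 (λ f k → f ⁻ ⊕ ((f ⊕ (k ⊕ f ⁻)) ⊕ f) ⊜ k) refl f k)
                       (fix-conj f (yx⇒fix k′-yx))
    where
    f k′ : D
    f = a ↑ j ∙ g
    k′ = f ∙ (k ∙ f ⁻¹)
    h≡ : h ≡ a ↑ i ∙ (b ∙ f)
    h≡ = trans (solve 2 (λ h g → h ⊜ (h ⊕ g ⁻) ⊕ g) refl h g) (trans (cong (_∙ g) eq)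
           (solve 4 (λ u b v g → (u ⊕ (b ⊕ v)) ⊕ g ⊜ u ⊕ (b ⊕ (v ⊕ g))) refl _ _ _ _))
    bf∼ : β (b ∙ f ∙ k) ≡ β (b ∙ f)
    bf∼ = trans (sym (β-a↑ i _)) (trans (cong β (trans (sym (assoc _ _ _)) (cong (_∙ k) (sym h≡))))
            (trans hk (trans (cong β h≡) (β-a↑ i _))))
    f∼ : β (f ∙ k) ≡ β f
    f∼ = trans (cong β (assoc _ _ _)) (trans (β-a↑ j _) (trans gk (sym (β-a↑ j g))))
    k′-yx : ∃₂ λ i j → k′ ≡ y ↑ i ∙ x ↑ j
    k′-yx = two-blocks k′
      (trans (cong β (sym (assoc _ _ _))) (trans (β-right (f ⁻¹) f∼) (cong β (inverseʳ f))))
      (trans (cong β (solve 3 (λ b f k → b ⊕ (f ⊕ (k ⊕ f ⁻)) ⊜ ((b ⊕ f) ⊕ k) ⊕ f ⁻) refl b f k))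
        (trans (β-right (f ⁻¹) bf∼) (cong β (solve 2 (λ b f → (b ⊕ f) ⊕ f ⁻ ⊜ b) refl b f))))

-- The geometric sum 1 + k + ... + kᵐ⁻¹.
geo : ℕ → ℕ → ℕ
geo k zero = 0
geo k (suc m) = k ^ m + geo k m

module Metacyclic {D : Set} (𝔾 : GroupOn D) (C : GroupTheory.Congruence 𝔾) where

  open GroupTheory 𝔾
  open Modulo C

  module _ {u c : D} (k : ℕ) (act : conj u c ≈ c ↑ k) where

    conj-↑-act : ∀ i → conj u (c ↑ i) ≈ c ↑ (k * i)
    conj-↑-act i = ≈-trans (≡⇒≈ (conj-↑ u c i)) (≈-trans (↑-cong i act) (≡⇒≈ (sym (↑-* c k i))))

    iterated-act : ∀ j → conj (u ↑ j) c ≈ c ↑ (k ^ j)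
    iterated-act zero = ≡⇒≈ (trans (conj-by-ε c) (sym (identityʳ c)))
    iterated-act (suc j) = begin
      conj (u ∙ u ↑ j) c ≡⟨ conj-conj u (u ↑ j) c ⟨
      conj (u ↑ j) (conj u c) ≈⟨ conj-cong (u ↑ j) act ⟩
      conj (u ↑ j) (c ↑ k) ≡⟨ conj-↑ (u ↑ j) c k ⟩
      conj (u ↑ j) c ↑ k ≈⟨ ↑-cong k (iterated-act j) ⟩
      c ↑ (k ^ j) ↑ k ≡⟨ ↑-* c (k ^ j) k ⟨
      c ↑ (k ^ j * k) ≡⟨ cong (c ↑_) (ℕₚ.*-comm (k ^ j) k) ⟩
      c ↑ (k * k ^ j) ∎
      where open ≈-Reasoning

  module _ {u c : D} (k : ℕ) (act : conj u c ≈ c ↑ k) where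

    push : ∀ i j → c ↑ i ∙ u ↑ j ≈ u ↑ j ∙ c ↑ (k ^ j * i)
    push i j = ≈-trans (≡⇒≈ (solve 2 (λ c u → c ⊕ u ⊜ u ⊕ (u ⁻ ⊕ (c ⊕ u))) refl (c ↑ i) (u ↑ j)))
      (∙-congˡ (conj-↑-act (k ^ j) (iterated-act k act j) i))

    -- Moving each cⁱ to the right past the later factors u multiplies its exponent by a power of k;
    -- these powers add up to `geo k m`.
    collect : ∀ i m → (u ∙ c ↑ i) ↑ m ≈ u ↑ m ∙ c ↑ (i * geo k m)
    collect i zero = ≡⇒≈ (trans (sym (identityʳ ε)) (cong (λ t → ε ∙ c ↑ t) (sym (ℕₚ.*-zeroʳ i))))
    collect i (suc m) = begin
      (u ∙ c ↑ i) ∙ (u ∙ c ↑ i) ↑ m ≈⟨ ∙-congˡ (collect i m) ⟩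
      (u ∙ c ↑ i) ∙ (u ↑ m ∙ c ↑ (i * geo k m)) ≡⟨ solve 4 (λ u c v w → (u ⊕ c) ⊕ (v ⊕ w) ⊜ u ⊕ ((c ⊕ v) ⊕ w)) refl u (c ↑ i) (u ↑ m) (c ↑ (i * geo k m)) ⟩
      u ∙ ((c ↑ i ∙ u ↑ m) ∙ c ↑ (i * geo k m)) ≈⟨ ∙-congˡ (∙-congʳ (push i m)) ⟩
      u ∙ ((u ↑ m ∙ c ↑ (k ^ m * i)) ∙ c ↑ (i * geo k m)) ≡⟨ solve 4 (λ u v c w → u ⊕ ((v ⊕ c) ⊕ w) ⊜ (u ⊕ v) ⊕ (c ⊕ w)) refl u (u ↑ m) (c ↑ (k ^ m * i)) (c ↑ (i * geo k m)) ⟩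
      (u ∙ u ↑ m) ∙ (c ↑ (k ^ m * i) ∙ c ↑ (i * geo k m)) ≡⟨ cong ((u ∙ u ↑ m) ∙_) (↑-+ c (k ^ m * i) (i * geo k m)) ⟨
      (u ∙ u ↑ m) ∙ c ↑ (k ^ m * i + i * geo k m) ≡⟨ cong (λ t → (u ∙ u ↑ m) ∙ c ↑ t) (arith i (k ^ m) (geo k m)) ⟩
      (u ∙ u ↑ m) ∙ c ↑ (i * (k ^ m + geo k m)) ∎
      where
      open ≈-Reasoning
      arith : ∀ i s t → s * i + i * t ≡ i * (s + t)
      arith = solve-∀

module Translation {D : Set} {𝔾 : GroupOn D} {d e : ℕ} (Γ : Geometry 𝔾 d e) (π : OddPrime d) where

  open OddPrime π
  open GroupTheory 𝔾
  open Geometry Γ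
  open Blocks Γ π

  half<d : half < d
  half<d = subst (half <_) (sym d≡2half) (ℕₚ.m<m+n half half>0)

  d∤half : ¬ (d ∣ half)
  d∤half d∣ = ℕₚ.<⇒≱ half<d (∣⇒≤ {{>-nonZero half>0}} d∣)

  β-a↑ε : ∀ i → β (a ↑ i) ≡ β ε
  β-a↑ε i = trans (cong β (sym (identityʳ _))) (β-a↑ i ε)

  -- If τ fixed another part, d would divide the exponent pᵉ·d/2 of τ, hence d/2, because d = p - 1
  -- is prime to p.
  τ-moves : ∀ g → β g ≢ β ε → β (g ∙ τ) ≢ β g
  τ-moves g g≁ε = go (cell g g≁ε)
    where
    go : (∃₂ λ i j → g ≡ a ↑ i ∙ (b ∙ a ↑ j)) → β (g ∙ τ) ≢ β g
    go (i , j , refl) eq = d∤half (coprime-∣^ e (pred-coprime d) (blocks (p ^ e * half) (β-right⁻ (a ↑ j) (begin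
      β ((b ∙ τ) ∙ a ↑ j) ≡⟨ cong β (assoc b τ (a ↑ j)) ⟩
      β (b ∙ (τ ∙ a ↑ j)) ≡⟨ cong (λ u → β (b ∙ u)) (↑-comm a (p ^ e * half) j) ⟩
      β (b ∙ (a ↑ j ∙ τ)) ≡⟨ β-a↑ i _ ⟨
      β (a ↑ i ∙ (b ∙ (a ↑ j ∙ τ))) ≡⟨ cong β (solve 4 (λ u b v t → u ⊕ (b ⊕ (v ⊕ t)) ⊜ (u ⊕ (b ⊕ v)) ⊕ t) refl (a ↑ i) b (a ↑ j) τ) ⟩
      β ((a ↑ i ∙ (b ∙ a ↑ j)) ∙ τ) ≡⟨ eq ⟩
      β (a ↑ i ∙ (b ∙ a ↑ j)) ≡⟨ β-a↑ i _ ⟩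
      β (b ∙ a ↑ j) ∎))))
      where open ≡-Reasoning

  -- If c fixes the part of g, then gτ ∼ gb, and since (gτ)c = gb the part of gτ is fixed too. The
  -- two parts differ: τ moves every part but that of ε, and g ∼ gτ ∼ ε would force b ∼ ε. So c
  -- would lie in the kernel, although it moves ε to the part of b.
  c-free : ∀ g → β (g ∙ c) ≢ β g
  c-free g eq = b≁ε (trans (sym (β-a↑ (p ^ e * half) b)) (trans (cong β (sym (identityˡ c))) (fixed ε)))
    where
    gτ∼gb : β (g ∙ τ) ≡ β (g ∙ b)
    gτ∼gb = β-right⁻ b (trans (cong β (assoc g τ b)) (trans eq (cong β (sym (trans (assoc g b b) (trans (cong (g ∙_) b∙b) (identityʳ g)))))))
    gτ≁g : β g ≢ β (g ∙ τ)
    gτ≁g g∼gτ with β g Finₚ.≟ β ε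
    ... | no g≁ε = τ-moves g g≁ε (sym g∼gτ)
    ... | yes g∼ε = b≁ε (trans (cong β (sym (identityˡ b))) (trans (sym (β-right b g∼ε)) (trans (sym gτ∼gb) (trans (sym g∼gτ) g∼ε))))
    gτc : (g ∙ τ) ∙ c ≡ g ∙ b
    gτc = trans (solve 3 (λ g t b → (g ⊕ t) ⊕ (t ⊕ b) ⊜ (g ⊕ (t ⊕ t)) ⊕ b) refl g τ b) (cong (_∙ b) (trans (cong (g ∙_) ττ) (identityʳ g)))
    fixed : Fix c
    fixed = two-fixed⇒fix g (g ∙ τ) c eq (trans (cong β gτc) (sym gτ∼gb)) gτ≁g

  -- cⁱ commutes with c, so it also fixes the part of gc, which is a different one.
  fixes-block⇒fix : ∀ g i → β (g ∙ c ↑ i) ≡ β g → Fix (c ↑ i)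
  fixes-block⇒fix g i eq = two-fixed⇒fix g (g ∙ c) (c ↑ i) eq
    (trans (cong β (trans (assoc g c _) (trans (cong (g ∙_) (↑-suc c i)) (sym (assoc g _ c)))))
      (β-right c eq))
    (λ eq′ → c-free g (sym eq′))

  fix⇒∼ε : ∀ {k} → Fix k → β k ≡ β ε
  fix⇒∼ε {k} fk = trans (cong β (sym (identityˡ k))) (fk ε)

  ∼ε⇒fix : ∀ i → β (c ↑ i) ≡ β ε → Fix (c ↑ i)
  ∼ε⇒fix i eq = fixes-block⇒fix ε i (trans (cong β (identityˡ _)) eq)

  private
    S : ℕ → Set
    S i = β (c ↑ i) ≡ β ε

    c-returns : ∃ λ T → 0 < T × S T
    c-returns = let (i , j , i<j , eq) = Finₚ.pigeonhole (ℕₚ.n<1+n p) (λ (i : Fin (suc p)) → β (c ↑ toℕ i)) in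
      toℕ j ∸ toℕ i , ℕₚ.m<n⇒0<n∸m i<j ,
      β-right⁻ (c ↑ toℕ i) (trans (cong β (trans (sym (↑-+ c (toℕ j ∸ toℕ i) (toℕ i))) (cong (c ↑_) (ℕₚ.m∸n+n≡m (ℕₚ.<⇒≤ i<j)))))
        (trans (sym eq) (cong β (sym (identityˡ _)))))

    S-period : ∃ (IsPeriod S)
    S-period = period (λ i → β (c ↑ i) Finₚ.≟ β ε)
      (λ m n Sm Sn → trans (cong β (↑-+ c m n)) (trans (∼ε⇒fix n Sn (c ↑ m)) Sm))
      (λ m n Smn Sm → trans (sym (∼ε⇒fix m Sm (c ↑ n))) (trans (cong β (trans (↑-comm c n m) (sym (↑-+ c m n)))) Smn))
      (proj₁ c-returns) (proj₁ (proj₂ c-returns)) (proj₂ (proj₂ c-returns))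

    s : ℕ
    s = proj₁ S-period

    rep : Fin p → D
    rep i = proj₁ (β-onto i)

    σ : Fin p → Fin p
    σ i = β (rep i ∙ c)

    σ-iterate : ∀ t i → iterate σ t i ≡ β (rep i ∙ c ↑ t)
    σ-iterate zero i = sym (trans (cong β (identityʳ _)) (proj₂ (β-onto i)))
    σ-iterate (suc t) i = trans (cong σ (σ-iterate t i))
      (trans (β-right c (proj₂ (β-onto (β (rep i ∙ c ↑ t)))))
        (cong β (trans (assoc _ _ c) (cong (rep i ∙_) (sym (↑-suc c t))))))

    -- A power of c that fixes one part fixes all, so every cycle of c on the p parts has length
    -- divisible by s.
    s∣p : s ∣ p
    s∣p = subst (s ∣_) (Listₚ.length-tabulate {n = p} (λ i → i))
      (cycles-divide (allFin p) (Uniqueₚ.allFin⁺ p) (λ x _ → ∈-allFin (σ x))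
        (λ i _ t eq → proj₁ (proj₂ (proj₂ S-period)) t
          (fix⇒∼ε (fixes-block⇒fix (rep i) t (trans (sym (σ-iterate t i)) (trans eq (sym (proj₂ (β-onto i)))))))))
      where
      open Cycles Finₚ._≟_ σ s (proj₁ (proj₂ S-period))
        (λ i → trans (σ-iterate s i) (trans (∼ε⇒fix s (proj₂ (proj₂ (proj₂ S-period)) s ∣-refl) (rep i)) (proj₂ (β-onto i))))

    s≡p : s ≡ p
    s≡p = ∣prime∧≢1⇒≡ prime s∣p λ s≡1 → c-free ε
      (trans (cong β (trans (identityˡ c) (sym (identityʳ c)))) (proj₂ (proj₂ (proj₂ S-period)) 1 (subst (_∣ 1) (sym s≡1) ∣-refl)))

  c-period : ∀ i → β (c ↑ i) ≡ β ε → p ∣ i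
  c-period i eq = subst (_∣ i) s≡p (proj₁ (proj₂ (proj₂ S-period)) i eq)

  fix-c↑ : ∀ i → p ∣ i → Fix (c ↑ i)
  fix-c↑ i p∣i = ∼ε⇒fix i (proj₂ (proj₂ (proj₂ S-period)) i (subst (_∣ i) (sym s≡p) p∣i))

  c-separates : ∀ {i j} → i < j → j < p → β (c ↑ i) ≢ β (c ↑ j)
  c-separates {i} {j} i<j j<p eq = ℕₚ.<⇒≱ (ℕₚ.≤-<-trans (ℕₚ.m∸n≤m j i) j<p)
    (∣⇒≤ {{>-nonZero (ℕₚ.m<n⇒0<n∸m i<j)}} (c-period (j ∸ i)
      (β-right⁻ (c ↑ i) (trans (cong β (trans (sym (↑-+ c (j ∸ i) i)) (cong (c ↑_) (ℕₚ.m∸n+n≡m (ℕₚ.<⇒≤ i<j)))))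
        (trans (sym eq) (cong β (sym (identityˡ _))))))))

  c-onto : ∀ g → ∃ λ (i : Fin p) → β (c ↑ toℕ i) ≡ β g
  c-onto g = injective⇒surjective (λ (i : Fin p) → β (c ↑ toℕ i)) inj (β g)
    where
    inj : ∀ {i j : Fin p} → β (c ↑ toℕ i) ≡ β (c ↑ toℕ j) → i ≡ j
    inj {i} {j} eq with ℕₚ.<-cmp (toℕ i) (toℕ j)
    ... | tri< i<j _ _ = contradiction eq (c-separates i<j (Finₚ.toℕ<n j))
    ... | tri≈ _ i≡j _ = Finₚ.toℕ-injective i≡j
    ... | tri> _ _ j<i = contradiction (sym eq) (c-separates j<i (Finₚ.toℕ<n i))

  K-congruence : Congruence
  K-congruence = normal-congruence Fix fix-ε fix-∙ fix-⁻¹ fix-conj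

  module K = Modulo K-congruence

  K-ε : ∀ {k} → k K.≈ ε → Fix k
  K-ε {k} = subst Fix (solve 1 (λ k → k ⊕ (:ε ⁻) ⊜ k) refl k)

  conj-c-free : ∀ g → β (g ∙ conj a c) ≢ β g
  conj-c-free g eq = c-free (g ∙ a ⁻¹) (β-right⁻ a (trans (cong β (solve 3 (λ g a c → ((g ⊕ a ⁻) ⊕ c) ⊕ a ⊜ g ⊕ (a ⁻ ⊕ (c ⊕ a))) refl g a c))
    (trans eq (cong β (solve 2 (λ g a → g ⊜ (g ⊕ a ⁻) ⊕ a) refl g a)))))

  Shift : Fin p → Fin d → Set
  Shift i m = β (c ↑ toℕ i ∙ conj a c) ≡ β (c ↑ suc (toℕ m) ∙ c ↑ toℕ i)

  shift : ∀ i → ∃ (Shift i)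
  shift i = pick (c-onto (u ∙ (conj a c ∙ u ⁻¹)))
    where
    u : D
    u = c ↑ toℕ i
    pick : (∃ λ (j : Fin p) → β (c ↑ toℕ j) ≡ β (u ∙ (conj a c ∙ u ⁻¹))) → ∃ (Shift i)
    pick (j , eq) = nonzero j (trans (cong β (solve 2 (λ u f → u ⊕ f ⊜ (u ⊕ (f ⊕ u ⁻)) ⊕ u) refl u (conj a c))) (sym (β-right u eq)))
      where
      nonzero : ∀ (j : Fin p) → β (u ∙ conj a c) ≡ β (c ↑ toℕ j ∙ u) → ∃ (Shift i)
      nonzero Fin.zero eq = contradiction (trans eq (cong β (identityˡ u))) (conj-c-free u)
      nonzero (Fin.suc m) eq = m , eq

  shift-fixes : ∀ i m → Shift i m → β (c ↑ toℕ i ∙ (conj a c ∙ (c ↑ suc (toℕ m)) ⁻¹)) ≡ β (c ↑ toℕ i)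
  shift-fixes i m eq = begin
    β (u ∙ (conj a c ∙ v ⁻¹)) ≡⟨ cong β (assoc u (conj a c) (v ⁻¹)) ⟨
    β ((u ∙ conj a c) ∙ v ⁻¹) ≡⟨ β-right (v ⁻¹) eq ⟩
    β ((v ∙ u) ∙ v ⁻¹) ≡⟨ cong (λ w → β (w ∙ v ⁻¹)) (↑-comm c (suc (toℕ m)) (toℕ i)) ⟩
    β ((u ∙ v) ∙ v ⁻¹) ≡⟨ cong β (solve 2 (λ u v → (u ⊕ v) ⊕ v ⁻ ⊜ u) refl u v) ⟩
    β u ∎
    where
    open ≡-Reasoning
    u v : D
    u = c ↑ toℕ i
    v = c ↑ suc (toℕ m)

  -- The fixed-point-free conj a c moves each of the p blocks cⁱ by some c¹⁺ᵐ with m < p − 1,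
  -- so two blocks are moved alike.
  conj-c : ∃ λ k → conj a c K.≈ c ↑ k
  conj-c = alike (Finₚ.pigeonhole (ℕₚ.n<1+n d) (λ i → proj₁ (shift i)))
    where
    alike : (∃₂ λ i j → toℕ i < toℕ j × proj₁ (shift i) ≡ proj₁ (shift j)) → ∃ λ k → conj a c K.≈ c ↑ k
    alike (i , j , i<j , eq) = suc (toℕ (proj₁ (shift i))) ,
      two-fixed⇒fix (c ↑ toℕ i) (c ↑ toℕ j) _ (shift-fixes i (proj₁ (shift i)) (proj₂ (shift i)))
        (shift-fixes j (proj₁ (shift i)) (subst (Shift j) (sym eq) (proj₂ (shift j))))
        (c-separates i<j (Finₚ.toℕ<n j))

  -- Modulo the kernel, ⟨a⟩ stabilises a part and ⟨c⟩ is regular on the parts, so the two meet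
  -- trivially.
  split-fix : ∀ m i → Fix (a ↑ m ∙ c ↑ i) → d ∣ m × p ∣ i
  split-fix m i f = blocks m (fa b) , p∣i
    where
    p∣i : p ∣ i
    p∣i = c-period i (trans (sym (β-a↑ m _)) (fix⇒∼ε f))
    fa : Fix (a ↑ m)
    fa = subst Fix (solve 2 (λ u v → (u ⊕ v) ⊕ v ⁻ ⊜ u) refl (a ↑ m) (c ↑ i)) (fix-∙ f (fix-⁻¹ (fix-c↑ i p∣i)))

  module KM = Metacyclic 𝔾 K-congruence

  -- With bh = aˡbaʲ, the element h a⁻ʲ fixes both the part of ε and that of b.
  stabiliser : ∀ h → β h ≡ β ε → ∃ λ j → Fix (h ∙ (a ↑ j) ⁻¹)
  stabiliser h h∼ε = go (cell (b ∙ h) (λ bh∼ε → β-b h (trans bh∼ε (sym h∼ε))))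
    where
    go : (∃₂ λ l j → b ∙ h ≡ a ↑ l ∙ (b ∙ a ↑ j)) → ∃ λ j → Fix (h ∙ (a ↑ j) ⁻¹)
    go (l , j , eq) = j , yx⇒fix (two-blocks (h ∙ u ⁻¹)
        (trans (β-right (u ⁻¹) (trans h∼ε (sym (β-a↑ε j)))) (cong β (inverseʳ u)))
        (begin
          β (b ∙ (h ∙ u ⁻¹)) ≡⟨ cong β (assoc b h (u ⁻¹)) ⟨
          β ((b ∙ h) ∙ u ⁻¹) ≡⟨ cong (λ w → β (w ∙ u ⁻¹)) eq ⟩
          β ((a ↑ l ∙ (b ∙ u)) ∙ u ⁻¹) ≡⟨ cong β (solve 3 (λ s b u → (s ⊕ (b ⊕ u)) ⊕ u ⁻ ⊜ s ⊕ b) refl (a ↑ l) b u) ⟩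
          β (a ↑ l ∙ b) ≡⟨ β-a↑ l b ⟩
          β b ∎))
      where
      open ≡-Reasoning
      u : D
      u = a ↑ j

  ac-mod-K : ∀ g → ∃₂ λ j i → g K.≈ a ↑ j ∙ c ↑ i
  ac-mod-K g = go (c-onto g)
    where
    go : (∃ λ (i : Fin p) → β (c ↑ toℕ i) ≡ β g) → ∃₂ λ j i → g K.≈ a ↑ j ∙ c ↑ i
    go (i , ci∼g) = finish (stabiliser (g ∙ v ⁻¹) (trans (β-right (v ⁻¹) (sym ci∼g)) (cong β (inverseʳ v))))
      where
      v : D
      v = c ↑ toℕ i
      finish : (∃ λ j → Fix ((g ∙ v ⁻¹) ∙ (a ↑ j) ⁻¹)) → ∃₂ λ j i → g K.≈ a ↑ j ∙ c ↑ i
      finish (j , f) = j , toℕ i , subst Fix (solve 3 (λ g v u → (g ⊕ v ⁻) ⊕ u ⁻ ⊜ g ⊕ ((u ⊕ v) ⁻)) refl g v (a ↑ j)) f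

  -- Modulo the kernel, the pᴺ-th power of aʲcⁱ is a^(j pᴺ) times a power of c. Hence d divides j
  -- pᴺ, so it divides j, and aʲ is a power of x. This locates the elements of a Sylow p-subgroup.
  p-element : ∀ N g → g ↑ (p ^ N) ≡ ε → ∃ λ i → g K.≈ c ↑ i
  p-element N g gT = go conj-c (ac-mod-K g)
    where
    go : (∃ λ k → conj a c K.≈ c ↑ k) → (∃₂ λ j i → g K.≈ a ↑ j ∙ c ↑ i) → ∃ λ i → g K.≈ c ↑ i
    go (k , act) (j , i , g≈) = i , K.≈-trans g≈ (subst Fix (solve 2 (λ u v → u ⊜ (u ⊕ v) ⊕ v ⁻) refl (a ↑ j) (c ↑ i)) (fix-a↑ (a-order′ d∣j)))
      where
      open K.≈-Reasoning
      exponent : ℕ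
      exponent = i * geo (k ^ j) (p ^ N)
      fixed : Fix (a ↑ (j * p ^ N) ∙ c ↑ exponent)
      fixed = K-ε (begin
        a ↑ (j * p ^ N) ∙ c ↑ exponent ≡⟨ cong (_∙ c ↑ exponent) (↑-* a j (p ^ N)) ⟩
        a ↑ j ↑ (p ^ N) ∙ c ↑ exponent ≈⟨ KM.collect (k ^ j) (KM.iterated-act k act j) i (p ^ N) ⟨
        (a ↑ j ∙ c ↑ i) ↑ (p ^ N) ≈⟨ K.↑-cong (p ^ N) g≈ ⟨
        g ↑ (p ^ N) ≡⟨ gT ⟩
        ε ∎)
      d∣j : d ∣ j
      d∣j = coprime-∣^ N (pred-coprime d) (subst (d ∣_) (ℕₚ.*-comm j (p ^ N)) (proj₁ (split-fix (j * p ^ N) exponent fixed)))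
      fix-a↑ : (∃ λ j′ → a ↑ j ≡ x ↑ j′) → Fix (a ↑ j)
      fix-a↑ (j′ , eq) = subst Fix (sym eq) (fix-↑ j′ fix-x)

-- Descent through the central series of the kernel

module Layers {D : Set} {𝔾 : GroupOn D} {d e : ℕ} (Γ : Geometry 𝔾 d e) (π : OddPrime d) where

  open OddPrime π
  open GroupTheory 𝔾
  open Geometry Γ
  open Blocks Γ π

  -- The quotient of G in which x and y have order pᶠ, as a congruence on G.
  record Layer (f : ℕ) : Set₁ where
    field
      C : Congruence
    open Congruence C
    field
      _≈?_ : ∀ g h → Dec (g ≈ h)
      fine : ∀ {g} → g ≈ ε → Fix g
      x-order : x ↑ (p ^ f) ≈ ε
      independent : ∀ i j → y ↑ i ∙ x ↑ j ≈ ε → p ^ f ∣ i × p ^ f ∣ j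

  module Centre {f : ℕ} (L : Layer (suc f)) where

    open Layer L
    open Modulo C

    m : ℕ
    m = p ^ suc f

    instance
      m≢0 : NonZero m
      m≢0 = p^≢0 (suc f)

    m>0 : 0 < m
    m>0 = >-nonZero⁻¹ m

    x₀ y₀ : D
    x₀ = x ↑ (p ^ f)
    y₀ = y ↑ (p ^ f)

    y-order : y ↑ m ≈ ε
    y-order = ≈-trans (≡⇒≈ (sym (conj-x↑ m))) (≈-trans (conj-cong b x-order) (≡⇒≈ (conj-ε b)))

    x↑⁻¹ : ∀ i → (x ↑ i) ⁻¹ ≈ x ↑ ((m ∸ 1) * i)
    x↑⁻¹ = ↑⁻¹ m>0 x-order

    y↑⁻¹ : ∀ i → (y ↑ i) ⁻¹ ≈ y ↑ ((m ∸ 1) * i)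
    y↑⁻¹ = ↑⁻¹ m>0 y-order

    y∈⟨x⟩ : ∀ {i j} → y ↑ i ≈ x ↑ j → m ∣ i
    y∈⟨x⟩ {i} {j} eq = proj₁ (independent i ((m ∸ 1) * j)
      (≈-trans (∙-cong eq (≈-sym (x↑⁻¹ j))) (≡⇒≈ (inverseʳ (x ↑ j)))))

    coset-unique : ∀ {i j l} → y ↑ i ≈ x ↑ j ∙ y ↑ l → i % m ≡ l % m
    coset-unique {i} {j} {l} eq = quotient-form (y∈⟨x⟩ {i + (m ∸ 1) * l} {j} (begin
      y ↑ (i + (m ∸ 1) * l) ≡⟨ ↑-+ y i _ ⟩
      y ↑ i ∙ y ↑ ((m ∸ 1) * l) ≈⟨ ∙-cong eq (≈-sym (y↑⁻¹ l)) ⟩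
      (x ↑ j ∙ y ↑ l) ∙ (y ↑ l) ⁻¹ ≡⟨ solve 2 (λ u v → (u ⊕ v) ⊕ v ⁻ ⊜ u) refl (x ↑ j) (y ↑ l) ⟩
      x ↑ j ∎))
      where
      open ≈-Reasoning
      quotient-form : m ∣ i + (m ∸ 1) * l → i % m ≡ l % m
      quotient-form m∣ = trans (sym (%-remove-+ʳ i (m∣m*n l))) (trans (cong (_% m) rearranged) (%-remove-+ˡ l m∣))
        where
        rearranged : i + m * l ≡ (i + (m ∸ 1) * l) + l
        rearranged = trans (cong (λ t → i + t * l) (sym (ℕₚ.m+[n∸m]≡n m>0)))
          (trans (cong (i +_) (ℕₚ.+-comm l _)) (sym (ℕₚ.+-assoc i _ l)))

    -- Right multiplication by xᵗ takes the coset ⟨x⟩yʲ to ⟨x⟩yˡ.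
    Row : ℕ → ℕ → ℕ → Set
    Row t j l = ∃ λ i → y ↑ j ∙ x ↑ t ≈ x ↑ i ∙ y ↑ l

    row : ∀ j → ∃ λ (l : Fin m) → Row 1 j (toℕ l)
    row j = go (fix⇒xy (y ↑ j ∙ x) (fix-∙ (fix-↑ j fix-y) fix-x))
      where
      open ≈-Reasoning
      go : (∃₂ λ i l → y ↑ j ∙ x ≡ x ↑ i ∙ y ↑ l) → ∃ λ (l : Fin m) → Row 1 j (toℕ l)
      go (i , l , eq) = l mod m , i , (begin
        y ↑ j ∙ x ↑ 1 ≡⟨ cong (y ↑ j ∙_) (identityʳ x) ⟩
        y ↑ j ∙ x ≡⟨ eq ⟩
        x ↑ i ∙ y ↑ l ≈⟨ ∙-congˡ (↑-mod {y} {m} y-order l) ⟨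
        x ↑ i ∙ y ↑ toℕ (l mod m) ∎)

    row-∙ : ∀ {t u j k l} → Row t j k → Row u k l → Row (t + u) j l
    row-∙ {t} {u} {j} {k} {l} (i , eq) (i′ , eq′) = i + i′ , (begin
      y ↑ j ∙ x ↑ (t + u) ≡⟨ cong (y ↑ j ∙_) (↑-+ x t u) ⟩
      y ↑ j ∙ (x ↑ t ∙ x ↑ u) ≡⟨ assoc _ _ _ ⟨
      (y ↑ j ∙ x ↑ t) ∙ x ↑ u ≈⟨ ∙-congʳ eq ⟩
      (x ↑ i ∙ y ↑ k) ∙ x ↑ u ≡⟨ assoc _ _ _ ⟩
      x ↑ i ∙ (y ↑ k ∙ x ↑ u) ≈⟨ ∙-congˡ eq′ ⟩
      x ↑ i ∙ (x ↑ i′ ∙ y ↑ l) ≡⟨ assoc _ _ _ ⟨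
      (x ↑ i ∙ x ↑ i′) ∙ y ↑ l ≡⟨ cong (_∙ y ↑ l) (↑-+ x i i′) ⟨
      x ↑ (i + i′) ∙ y ↑ l ∎)
      where open ≈-Reasoning

    row-unique : ∀ {t j l l′} → Row t j l → Row t j l′ → l % m ≡ l′ % m
    row-unique {t} {j} {l} {l′} (i , eq) (i′ , eq′) = coset-unique {l} {(m ∸ 1) * i + i′} {l′} (begin
      y ↑ l ≡⟨ solve 2 (λ u v → v ⊜ u ⁻ ⊕ (u ⊕ v)) refl (x ↑ i) (y ↑ l) ⟩
      (x ↑ i) ⁻¹ ∙ (x ↑ i ∙ y ↑ l) ≈⟨ ∙-cong (x↑⁻¹ i) (≈-trans (≈-sym eq) eq′) ⟩
      x ↑ ((m ∸ 1) * i) ∙ (x ↑ i′ ∙ y ↑ l′) ≡⟨ assoc _ _ _ ⟨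
      (x ↑ ((m ∸ 1) * i) ∙ x ↑ i′) ∙ y ↑ l′ ≡⟨ cong (_∙ y ↑ l′) (↑-+ x ((m ∸ 1) * i) i′) ⟨
      x ↑ ((m ∸ 1) * i + i′) ∙ y ↑ l′ ∎)
      where open ≈-Reasoning

    -- The coset ⟨x⟩yᵗ is fixed by x exactly when yᵗxy⁻ᵗ ∈ ⟨x⟩. In this form the fixed cosets are
    -- seen to be closed under addition of exponents.
    Normal : ℕ → Set
    Normal t = Row 1 t t

    abstract

      σ : Fin m → Fin m
      σ j = proj₁ (row (toℕ j))

      σ-row : ∀ j → Row 1 (toℕ j) (toℕ (σ j))
      σ-row j = proj₂ (row (toℕ j))

    toℕ-unique : ∀ {i j : Fin m} → toℕ i % m ≡ toℕ j % m → i ≡ j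
    toℕ-unique {i} {j} eq = Finₚ.toℕ-injective
      (trans (sym (m<n⇒m%n≡m (Finₚ.toℕ<n i))) (trans eq (m<n⇒m%n≡m (Finₚ.toℕ<n j))))

    iterate-row : ∀ t j → Row t (toℕ j) (toℕ (iterate σ t j))
    iterate-row zero j = 0 , ≡⇒≈ (trans (identityʳ _) (sym (identityˡ _)))
    iterate-row (suc t) j = subst (λ u → Row u (toℕ j) (toℕ (iterate σ (suc t) j))) (ℕₚ.+-comm t 1)
      (row-∙ {t} {1} {toℕ j} {toℕ (iterate σ t j)} {toℕ (iterate σ (suc t) j)} (iterate-row t j) (σ-row (iterate σ t j)))

    row-trivial : ∀ j → Row m j j
    row-trivial j = 0 , ≈-trans (∙-congˡ x-order) (≡⇒≈ (trans (identityʳ _) (sym (identityˡ _))))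

    row-fixed : ∀ t j → Row t (toℕ j) (toℕ j) → iterate σ t j ≡ j
    row-fixed t j r = toℕ-unique (row-unique {t} {toℕ j} (iterate-row t j) r)

    fixed-row : ∀ t j → iterate σ t j ≡ j → Row t (toℕ j) (toℕ j)
    fixed-row t j eq = subst (λ l → Row t (toℕ j) (toℕ l)) eq (iterate-row t j)

    -- Every cycle length divides m, a power of p; a cycle whose length also divides a number prime
    -- to p is a single point.
    σ-cycles : ∀ i t → iterate σ t i ≡ i → p ∣ t ⊎ σ i ≡ i
    σ-cycles i t eq with p ∣? t
    ... | yes p∣t = inj₁ p∣t
    ... | no p∤t = inj₂ (go (cycle-period i))
      where
      open Cycles Finₚ._≟_ σ m m>0 (λ j → row-fixed m j (row-trivial (toℕ j)))
      go : ∃ (IsPeriod (λ t → iterate σ t i ≡ i)) → σ i ≡ i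
      go (s , _ , s∣ , ∣s) = ∣s 1 (∣-reflexive (Coprimality.sym (prime-power-coprime (suc f)) (s∣ m (row-fixed m i (row-trivial (toℕ i))) , s∣ t eq)))
        where
        prime-power-coprime : ∀ k → Coprime t (p ^ k)
        prime-power-coprime k {r} (r∣t , r∣pk) = ∣1⇒≡1 (coprime-∣^ k
          (λ (s∣r , s∣p) → Coprimality.sym (prime-coprime prime p∤t) (∣-trans s∣r r∣t , s∣p)) (subst (r ∣_) (sym (ℕₚ.*-identityʳ _)) r∣pk))

    normal-add : ∀ t u → Normal t → Normal u → Normal (t + u)
    normal-add t u (i , eq) (i′ , eq′) = i * i′ , (begin
      y ↑ (t + u) ∙ x ↑ 1 ≡⟨ cong₂ _∙_ (↑-+ y t u) refl ⟩
      (y ↑ t ∙ y ↑ u) ∙ x ↑ 1 ≡⟨ assoc _ _ _ ⟩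
      y ↑ t ∙ (y ↑ u ∙ x ↑ 1) ≈⟨ ∙-congˡ eq′ ⟩
      y ↑ t ∙ (x ↑ i′ ∙ y ↑ u) ≡⟨ assoc _ _ _ ⟨
      (y ↑ t ∙ x ↑ i′) ∙ y ↑ u ≈⟨ ∙-congʳ (power i′) ⟩
      (x ↑ (i * i′) ∙ y ↑ t) ∙ y ↑ u ≡⟨ assoc _ _ _ ⟩
      x ↑ (i * i′) ∙ (y ↑ t ∙ y ↑ u) ≡⟨ cong (x ↑ (i * i′) ∙_) (↑-+ y t u) ⟨
      x ↑ (i * i′) ∙ y ↑ (t + u) ∎)
      where
      open ≈-Reasoning
      power : ∀ s → y ↑ t ∙ x ↑ s ≈ x ↑ (i * s) ∙ y ↑ t
      power zero = ≡⇒≈ (trans (identityʳ _) (trans (sym (identityˡ _)) (cong (λ r → x ↑ r ∙ y ↑ t) (sym (ℕₚ.*-zeroʳ i)))))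
      power (suc s) = begin
        y ↑ t ∙ x ↑ suc s ≡⟨ cong (λ w → y ↑ t ∙ (w ∙ x ↑ s)) (identityʳ x) ⟨
        y ↑ t ∙ (x ↑ 1 ∙ x ↑ s) ≡⟨ assoc _ _ _ ⟨
        (y ↑ t ∙ x ↑ 1) ∙ x ↑ s ≈⟨ ∙-congʳ eq ⟩
        (x ↑ i ∙ y ↑ t) ∙ x ↑ s ≡⟨ assoc _ _ _ ⟩
        x ↑ i ∙ (y ↑ t ∙ x ↑ s) ≈⟨ ∙-congˡ (power s) ⟩
        x ↑ i ∙ (x ↑ (i * s) ∙ y ↑ t) ≡⟨ assoc _ _ _ ⟨
        (x ↑ i ∙ x ↑ (i * s)) ∙ y ↑ t ≡⟨ cong (_∙ y ↑ t) (↑-+ x i (i * s)) ⟨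
        x ↑ (i + i * s) ∙ y ↑ t ≡⟨ cong (λ r → x ↑ r ∙ y ↑ t) (ℕₚ.*-suc i s) ⟨
        x ↑ (i * suc s) ∙ y ↑ t ∎

    normal-zero : Normal 0
    normal-zero = 1 , ≡⇒≈ (trans (identityˡ _) (sym (identityʳ _)))

    normal-multiple : ∀ q t → Normal t → Normal (q * t)
    normal-multiple zero t nt = normal-zero
    normal-multiple (suc q) t nt = normal-add t (q * t) nt (normal-multiple q t nt)

    normal-resp : ∀ {t u} → y ↑ t ≈ y ↑ u → Normal t → Normal u
    normal-resp eq (i , eq′) = i , ≈-trans (∙-congʳ (≈-sym eq)) (≈-trans eq′ (∙-congˡ eq))

    normal-sub : ∀ t u → Normal (t + u) → Normal t → Normal u
    normal-sub t u ntu nt = normal-resp {(m ∸ 1) * t + (t + u)} {u} (begin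
      y ↑ ((m ∸ 1) * t + (t + u)) ≡⟨ cong (y ↑_) (ℕₚ.+-assoc ((m ∸ 1) * t) t u) ⟨
      y ↑ (((m ∸ 1) * t + t) + u) ≡⟨ cong (λ s → y ↑ (s + u)) wrap ⟩
      y ↑ (m * t + u) ≡⟨ ↑-+ y (m * t) u ⟩
      y ↑ (m * t) ∙ y ↑ u ≈⟨ ∙-congʳ (↑-∣ {y} {m} {m * t} y-order (m∣m*n t)) ⟩
      ε ∙ y ↑ u ≡⟨ identityˡ _ ⟩
      y ↑ u ∎)
      (normal-add ((m ∸ 1) * t) (t + u) (normal-multiple (m ∸ 1) t nt) ntu)
      where
      open ≈-Reasoning
      wrap : (m ∸ 1) * t + t ≡ m * t
      wrap = trans (ℕₚ.+-comm ((m ∸ 1) * t) t) (cong (_* t) (ℕₚ.m+[n∸m]≡n m>0))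

    normal? : ∀ t → Dec (Normal t)
    normal? t = map′ (λ (i , eq) → toℕ i , eq)
      (λ (i , eq) → i mod m , ≈-trans eq (∙-congʳ (≈-sym (↑-mod {x} {m} x-order i))))
      (Finₚ.any? (λ (i : Fin m) → (y ↑ t ∙ x ↑ 1) ≈? (x ↑ toℕ i ∙ y ↑ t)))

    normal-m : Normal m
    normal-m = normal-resp {0} {m} (≈-sym y-order) normal-zero

    -- x permutes the m = pᶠ⁺¹ cosets ⟨x⟩yʲ and fixes one of them, hence another one.
    y₀-normal : Normal (p ^ f)
    y₀-normal = go (another-fixed-point σ z m m>0 (λ j → row-fixed m j (row-trivial (toℕ j))) σz σ-cycles (m∣m*n (p ^ f)) p∤1)
                   (period normal? normal-add normal-sub m m>0 normal-m)
      where
      z : Fin m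
      z = 0 mod m
      toℕz : toℕ z ≡ 0
      toℕz = trans (Finₚ.toℕ-fromℕ< (m%n<n 0 m)) (m<n⇒m%n≡m m>0)
      σz : σ z ≡ z
      σz = row-fixed 1 z (subst Normal (sym toℕz) normal-zero)
      go : (∃ λ j → j ≢ z × σ j ≡ j) → ∃ (IsPeriod Normal) → Normal (p ^ f)
      go (j , j≢z , σj) (s , _ , s∣ , ∣s) = decide (∣p^1+f⇒∣p^f⊎ prime f s (s∣ m normal-m))
        where
        s∣j : s ∣ toℕ j
        s∣j = s∣ (toℕ j) (fixed-row 1 j σj)
        -- The exponents t with `Normal t` are the multiples of s, and s divides pᶠ⁺¹. The second
        -- fixed coset rules out s = pᶠ⁺¹.
        decide : s ∣ p ^ f ⊎ m ∣ s → Normal (p ^ f)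
        decide (inj₁ s∣pf) = ∣s (p ^ f) s∣pf
        decide (inj₂ m∣s) = contradiction
          (toℕ-unique {j} {z} (trans (n∣m⇒m%n≡0 (toℕ j) m (∣-trans m∣s s∣j)) (sym (trans (cong (_% m) toℕz) (m<n⇒m%n≡m m>0))))) j≢z

module CentralPair {D : Set} {𝔾 : GroupOn D} {d e : ℕ} (Γ : Geometry 𝔾 d e) (π : OddPrime d)
                   {f : ℕ} (L : Layers.Layer Γ π (suc f)) where

  open OddPrime π
  open GroupTheory 𝔾
  open Geometry Γ
  open Blocks Γ π
  open Layers Γ π
  open Centre L public
  open Layer L
  open Modulo C

  x↑-a : ∀ i j → x ↑ i ∙ a ↑ j ≡ a ↑ j ∙ x ↑ i
  x↑-a i j = trans (cong (_∙ a ↑ j) (x↑ i)) (trans (↑-comm a (d * i) j) (cong (a ↑ j ∙_) (sym (x↑ i))))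

  Normalises : D → Set
  Normalises g = ∃ λ i → g ∙ x ≈ x ↑ i ∙ g

  normalises-y₀ : Normalises y₀
  normalises-y₀ = go y₀-normal
    where
    go : Normal (p ^ f) → Normalises y₀
    go (i , eq) = i , ≈-trans (≡⇒≈ (cong (y₀ ∙_) (sym (identityʳ x)))) eq

  normalises↑ : ∀ {g i} → g ∙ x ≈ x ↑ i ∙ g → ∀ s → g ∙ x ↑ s ≈ x ↑ (i * s) ∙ g
  normalises↑ {g} {i} eq zero = ≡⇒≈ (trans (identityʳ _) (trans (sym (identityˡ _)) (cong (λ r → x ↑ r ∙ g) (sym (ℕₚ.*-zeroʳ i)))))
  normalises↑ {g} {i} eq (suc s) = begin
    g ∙ (x ∙ x ↑ s) ≡⟨ assoc g x (x ↑ s) ⟨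
    (g ∙ x) ∙ x ↑ s ≈⟨ ∙-congʳ eq ⟩
    (x ↑ i ∙ g) ∙ x ↑ s ≡⟨ assoc (x ↑ i) g (x ↑ s) ⟩
    x ↑ i ∙ (g ∙ x ↑ s) ≈⟨ ∙-congˡ (normalises↑ {g} {i} eq s) ⟩
    x ↑ i ∙ (x ↑ (i * s) ∙ g) ≡⟨ assoc (x ↑ i) (x ↑ (i * s)) g ⟨
    (x ↑ i ∙ x ↑ (i * s)) ∙ g ≡⟨ cong (_∙ g) (↑-+ x i (i * s)) ⟨
    x ↑ (i + i * s) ∙ g ≡⟨ cong (λ r → x ↑ r ∙ g) (ℕₚ.*-suc i s) ⟨
    x ↑ (i * suc s) ∙ g ∎
    where open ≈-Reasoning

  -- For w = aⁱbaʲ the factor aʲ commutes with x₀, so w x₀ w⁻¹ = aⁱ y₀ a⁻ⁱ; the outer factors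
  -- centralise x.
  normalises-x₀ : ∀ w → β w ≢ β ε → Normalises (w ∙ (x₀ ∙ w ⁻¹))
  normalises-x₀ w w≁ε = go (cell w w≁ε) normalises-y₀
    where
    go : (∃₂ λ i j → w ≡ a ↑ i ∙ (b ∙ a ↑ j)) → Normalises y₀ → Normalises (w ∙ (x₀ ∙ w ⁻¹))
    go (i , j , w≡) (k , eq) = k , (begin
      (w ∙ (x₀ ∙ w ⁻¹)) ∙ x ≡⟨ cong (_∙ x) reduced ⟩
      (u ∙ (y₀ ∙ u ⁻¹)) ∙ x ≡⟨ solve 3 (λ u y x → (u ⊕ (y ⊕ u ⁻)) ⊕ x ⊜ u ⊕ (y ⊕ (u ⁻ ⊕ (x ⊕ (u ⊕ u ⁻))))) refl u y₀ x ⟩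
      u ∙ (y₀ ∙ (u ⁻¹ ∙ (x ∙ (u ∙ u ⁻¹)))) ≡⟨ cong (λ v → u ∙ (y₀ ∙ v)) x-pass ⟩
      u ∙ (y₀ ∙ (x ∙ u ⁻¹)) ≡⟨ cong (u ∙_) (assoc y₀ x (u ⁻¹)) ⟨
      u ∙ ((y₀ ∙ x) ∙ u ⁻¹) ≈⟨ ∙-congˡ (∙-congʳ eq) ⟩
      u ∙ ((x ↑ k ∙ y₀) ∙ u ⁻¹) ≡⟨ solve 4 (λ u v y u′ → u ⊕ ((v ⊕ y) ⊕ u′) ⊜ (u ⊕ v) ⊕ (y ⊕ u′)) refl u (x ↑ k) y₀ (u ⁻¹) ⟩
      (u ∙ x ↑ k) ∙ (y₀ ∙ u ⁻¹) ≡⟨ cong (_∙ (y₀ ∙ u ⁻¹)) (x↑-a k i) ⟨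
      (x ↑ k ∙ u) ∙ (y₀ ∙ u ⁻¹) ≡⟨ assoc (x ↑ k) u _ ⟩
      x ↑ k ∙ (u ∙ (y₀ ∙ u ⁻¹)) ≡⟨ cong (x ↑ k ∙_) reduced ⟨
      x ↑ k ∙ (w ∙ (x₀ ∙ w ⁻¹)) ∎)
      where
      open ≈-Reasoning
      u v : D
      u = a ↑ i
      v = a ↑ j
      x-pass : u ⁻¹ ∙ (x ∙ (u ∙ u ⁻¹)) ≡ x ∙ u ⁻¹
      x-pass = trans (cong (u ⁻¹ ∙_) (trans (sym (assoc x u (u ⁻¹))) (cong (_∙ u ⁻¹) (↑-comm a d i))))
        (solve 2 (λ u x → u ⁻ ⊕ ((u ⊕ x) ⊕ u ⁻) ⊜ x ⊕ u ⁻) refl u x)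
      reduced : w ∙ (x₀ ∙ w ⁻¹) ≡ u ∙ (y₀ ∙ u ⁻¹)
      reduced = ≡R.begin
        w ∙ (x₀ ∙ w ⁻¹) ≡R.≡⟨ cong (λ w → w ∙ (x₀ ∙ w ⁻¹)) w≡ ⟩
        (u ∙ (b ∙ v)) ∙ (x₀ ∙ (u ∙ (b ∙ v)) ⁻¹) ≡R.≡⟨ solve 4 (λ u b v x → (u ⊕ (b ⊕ v)) ⊕ (x ⊕ ((u ⊕ (b ⊕ v)) ⁻)) ⊜ u ⊕ (b ⊕ (((v ⊕ x) ⊕ v ⁻) ⊕ (b ⁻ ⊕ u ⁻)))) refl u b v x₀ ⟩
        u ∙ (b ∙ (((v ∙ x₀) ∙ v ⁻¹) ∙ (b ⁻¹ ∙ u ⁻¹))) ≡R.≡⟨ cong (λ t → u ∙ (b ∙ ((t ∙ v ⁻¹) ∙ (b ⁻¹ ∙ u ⁻¹)))) (x↑-a (p ^ f) j) ⟨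
        u ∙ (b ∙ (((x₀ ∙ v) ∙ v ⁻¹) ∙ (b ⁻¹ ∙ u ⁻¹))) ≡R.≡⟨ solve 4 (λ u b v x → u ⊕ (b ⊕ (((x ⊕ v) ⊕ v ⁻) ⊕ (b ⁻ ⊕ u ⁻))) ⊜ u ⊕ ((b ⊕ (x ⊕ b ⁻)) ⊕ u ⁻)) refl u b v x₀ ⟩
        u ∙ ((b ∙ (x₀ ∙ b ⁻¹)) ∙ u ⁻¹) ≡R.≡⟨ cong (λ t → u ∙ ((b ∙ (x₀ ∙ t)) ∙ u ⁻¹)) b⁻¹ ⟩
        u ∙ ((b ∙ (x₀ ∙ b)) ∙ u ⁻¹) ≡R.≡⟨ cong (λ t → u ∙ (t ∙ u ⁻¹)) (y↑ (p ^ f)) ⟨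
        u ∙ (y₀ ∙ u ⁻¹) ≡R.∎
        where module ≡R = ≡-Reasoning

  -- Powers of a commute with x, so w may be replaced by b; then yˡ ∈ ⟨x⟩, and by independence pᶠ⁺¹
  -- divides l.
  trivial-intersection : ∀ w l u → β w ≢ β ε → w ∙ x ↑ l ≈ x ↑ u ∙ w → x ↑ l ≈ ε
  trivial-intersection w l u w≁ε eq = go (cell w w≁ε)
    where
    open ≈-Reasoning
    go : (∃₂ λ i j → w ≡ a ↑ i ∙ (b ∙ a ↑ j)) → x ↑ l ≈ ε
    go (i , j , w≡) = ↑-∣ {x} {m} {l} x-order (y∈⟨x⟩ {l} {u} (begin
      y ↑ l ≡⟨ y↑ l ⟩
      b ∙ (x ↑ l ∙ b) ≡⟨ assoc b (x ↑ l) b ⟨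
      (b ∙ x ↑ l) ∙ b ≈⟨ ∙-congʳ bx ⟩
      (x ↑ u ∙ b) ∙ b ≡⟨ assoc (x ↑ u) b b ⟩
      x ↑ u ∙ (b ∙ b) ≡⟨ cong (x ↑ u ∙_) b∙b ⟩
      x ↑ u ∙ ε ≡⟨ identityʳ _ ⟩
      x ↑ u ∎))
      where
      s t : D
      s = a ↑ i
      t = a ↑ j
      bx : b ∙ x ↑ l ≈ x ↑ u ∙ b
      bx = cancelˡ s (cancelʳ t (begin
        (s ∙ (b ∙ x ↑ l)) ∙ t ≡⟨ solve 4 (λ s b v t → (s ⊕ (b ⊕ v)) ⊕ t ⊜ s ⊕ (b ⊕ (v ⊕ t))) refl s b (x ↑ l) t ⟩
        s ∙ (b ∙ (x ↑ l ∙ t)) ≡⟨ cong (λ v → s ∙ (b ∙ v)) (x↑-a l j) ⟩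
        s ∙ (b ∙ (t ∙ x ↑ l)) ≡⟨ solve 4 (λ s b v t → s ⊕ (b ⊕ (t ⊕ v)) ⊜ (s ⊕ (b ⊕ t)) ⊕ v) refl s b (x ↑ l) t ⟩
        (s ∙ (b ∙ t)) ∙ x ↑ l ≡⟨ cong (_∙ x ↑ l) w≡ ⟨
        w ∙ x ↑ l ≈⟨ eq ⟩
        x ↑ u ∙ w ≡⟨ cong (x ↑ u ∙_) w≡ ⟩
        x ↑ u ∙ (s ∙ (b ∙ t)) ≡⟨ assoc (x ↑ u) s (b ∙ t) ⟨
        (x ↑ u ∙ s) ∙ (b ∙ t) ≡⟨ cong (_∙ (b ∙ t)) (x↑-a u i) ⟩
        (s ∙ x ↑ u) ∙ (b ∙ t) ≡⟨ solve 4 (λ s b v t → (s ⊕ v) ⊕ (b ⊕ t) ⊜ (s ⊕ (v ⊕ b)) ⊕ t) refl s b (x ↑ u) t ⟩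
        (s ∙ (x ↑ u ∙ b)) ∙ t ∎))

  -- A dart in a third part, distinct from those of ε and of b; `w≁ε` and `wb≁ε` say so, the latter
  -- because d > 1.
  w : D
  w = b ∙ a

  w≁ε : β w ≢ β ε
  w≁ε eq = b≁ε (β-right⁻ a (trans eq (trans (sym (β-a ε)) (cong β (trans (identityʳ a) (sym (identityˡ a)))))))

  d∤1 : ¬ (d ∣ 1)
  d∤1 d∣1 = ℕₚ.<⇒≱ 1<d (∣⇒≤ d∣1)

  wb≁ε : β (w ∙ b) ≢ β ε
  wb≁ε eq = d∤1 (blocks 1 (trans (cong (λ u → β (b ∙ u)) (identityʳ a))
    (β-right⁻ b (trans eq (cong β (sym b∙b))))))

  -- y and some power of x take the vertex ⟨a⟩w to the same vertex, since ⟨x⟩ is transitive on its part.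
  y-at-w : ∃₂ λ u i → w ∙ y ≡ x ↑ u ∙ (w ∙ x ↑ i)
  y-at-w = go (cell (w ∙ y) (λ eq → w≁ε (trans (sym (fix-y w)) eq)))
    where
    go : (∃₂ λ r l → w ∙ y ≡ a ↑ r ∙ (b ∙ a ↑ l)) → ∃₂ λ u i → w ∙ y ≡ x ↑ u ∙ (w ∙ x ↑ i)
    go (r , l , eq) = right (a-order′ d∣l′)
      where
      l′ : ℕ
      -- This is l - 1 modulo the order n of a: one factor a is split off to complete b to w = ba.
      l′ = l + n ∸ 1
      1+l′ : 1 + l′ ≡ l + n
      1+l′ = ℕₚ.m+[n∸m]≡n (ℕₚ.≤-trans n>0 (ℕₚ.m≤n+m n l))
        where
        n>0 : 0 < n
        n>0 = >-nonZero⁻¹ n {{ℕₚ.m*n≢0 (p ^ e) d {{p^≢0 e}} {{d≢0}}}}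
      a↑l : a ↑ l ≡ a ↑ l′ ∙ a
      a↑l = ≡R.begin
        a ↑ l ≡R.≡⟨ identityʳ _ ⟨
        a ↑ l ∙ ε ≡R.≡⟨ cong (a ↑ l ∙_) a-finite ⟨
        a ↑ l ∙ a ↑ n ≡R.≡⟨ ↑-+ a l n ⟨
        a ↑ (l + n) ≡R.≡⟨ cong (a ↑_) (trans (sym 1+l′) (ℕₚ.+-comm 1 l′)) ⟩
        a ↑ (l′ + 1) ≡R.≡⟨ ↑-+ a l′ 1 ⟩
        a ↑ l′ ∙ (a ∙ ε) ≡R.≡⟨ cong (a ↑ l′ ∙_) (identityʳ a) ⟩
        a ↑ l′ ∙ a ≡R.∎
        where module ≡R = ≡-Reasoning
      d∣l′ : d ∣ l′
      d∣l′ = blocks l′ (β-right⁻ a (trans (cong β (trans (assoc b (a ↑ l′) a) (cong (b ∙_) (sym a↑l))))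
               (trans (sym (β-a↑ r _)) (trans (cong β (sym eq)) (fix-y w)))))
      right : (∃ λ i → a ↑ l′ ≡ x ↑ i) → ∃₂ λ u i → w ∙ y ≡ x ↑ u ∙ (w ∙ x ↑ i)
      right (i , al′) = left (a-order′ (blocks r (fix-r b)))
        where
        bal : b ∙ a ↑ l ≡ w ∙ x ↑ i
        bal = trans (cong (b ∙_) (trans a↑l (trans (sym (↑-suc a l′)) (cong (a ∙_) al′))))
                (sym (assoc b a (x ↑ i)))
        shape : w ∙ y ≡ a ↑ r ∙ (w ∙ x ↑ i)
        shape = trans eq (cong (a ↑ r ∙_) bal)
        fix-r : Fix (a ↑ r)
        fix-r = subst Fix (trans (solve 3 (λ w y x → (w ⁻ ⁻) ⊕ ((y ⊕ x ⁻) ⊕ w ⁻) ⊜ (w ⊕ y) ⊕ ((w ⊕ x) ⁻)) refl w y (x ↑ i))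
              (trans (cong (_∙ (w ∙ x ↑ i) ⁻¹) shape) (solve 2 (λ u v → (u ⊕ v) ⊕ v ⁻ ⊜ u) refl (a ↑ r) (w ∙ x ↑ i))))
          (fix-conj (w ⁻¹) (fix-∙ fix-y (fix-⁻¹ (fix-↑ i fix-x))))
        left : (∃ λ u → a ↑ r ≡ x ↑ u) → ∃₂ λ u i → w ∙ y ≡ x ↑ u ∙ (w ∙ x ↑ i)
        left (u , ar) = u , i , trans shape (cong (_∙ (w ∙ x ↑ i)) ar)

  -- Conjugating the relation for y₀ by b gives x₀y = yʳx₀. Comparison in the third part shows w
  -- y¹⁻ʳ w⁻¹ ∈ ⟨x⟩. As y = bxb and wb lies outside the part of ε, `trivial-intersection` yields
  -- x¹⁻ʳ = 1, hence yʳ = y.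
  commute-x₀-y : Commute x₀ y
  commute-x₀-y = go y-at-w (normalises-x₀ w w≁ε) normalises-y₀
    where
    open ≈-Reasoning
    go : (∃₂ λ u i → w ∙ y ≡ x ↑ u ∙ (w ∙ x ↑ i)) → Normalises (w ∙ (x₀ ∙ w ⁻¹)) → Normalises y₀ → Commute x₀ y
    go (u , i , wy) (s , at-w) (r , at-b) = ≈-trans x₀y (∙-congʳ (≈-sym y≈yr))
      where
      x₀y : x₀ ∙ y ≈ y ↑ r ∙ x₀
      x₀y = begin
        x₀ ∙ y ≡⟨ cong₂ _∙_ (conj-y↑ (p ^ f)) (sym y≡conj) ⟨
        conj b y₀ ∙ conj b x ≡⟨ conj-∙ b y₀ x ⟨
        conj b (y₀ ∙ x) ≈⟨ conj-cong b at-b ⟩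
        conj b (x ↑ r ∙ y₀) ≡⟨ conj-∙ b (x ↑ r) y₀ ⟩
        conj b (x ↑ r) ∙ conj b y₀ ≡⟨ cong₂ _∙_ (conj-x↑ r) (conj-y↑ (p ^ f)) ⟩
        y ↑ r ∙ x₀ ∎
      W : D
      W = w ∙ (x₀ ∙ w ⁻¹)
      -- w x₀ y computed through (wx₀w⁻¹)(wy) and through x₀y = yʳx₀.
      two-ways : w ∙ y ↑ r ≈ x ↑ (s * u) ∙ (w ∙ x ↑ i)
      two-ways = cancelʳ x₀ (begin
        (w ∙ y ↑ r) ∙ x₀ ≡⟨ assoc w (y ↑ r) x₀ ⟩
        w ∙ (y ↑ r ∙ x₀) ≈⟨ ∙-congˡ x₀y ⟨
        w ∙ (x₀ ∙ y) ≡⟨ solve 3 (λ w x y → w ⊕ (x ⊕ y) ⊜ (w ⊕ (x ⊕ w ⁻)) ⊕ (w ⊕ y)) refl w x₀ y ⟩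
        W ∙ (w ∙ y) ≡⟨ cong (W ∙_) wy ⟩
        W ∙ (x ↑ u ∙ (w ∙ x ↑ i)) ≡⟨ assoc W (x ↑ u) (w ∙ x ↑ i) ⟨
        (W ∙ x ↑ u) ∙ (w ∙ x ↑ i) ≈⟨ ∙-congʳ (normalises↑ {W} {s} at-w u) ⟩
        (x ↑ (s * u) ∙ W) ∙ (w ∙ x ↑ i) ≡⟨ solve 4 (λ v w x z → (v ⊕ (w ⊕ (x ⊕ w ⁻))) ⊕ (w ⊕ z) ⊜ v ⊕ (w ⊕ (x ⊕ z))) refl (x ↑ (s * u)) w x₀ (x ↑ i) ⟩
        x ↑ (s * u) ∙ (w ∙ (x₀ ∙ x ↑ i)) ≡⟨ cong (λ z → x ↑ (s * u) ∙ (w ∙ z)) (↑-comm x (p ^ f) i) ⟩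
        x ↑ (s * u) ∙ (w ∙ (x ↑ i ∙ x₀)) ≡⟨ solve 4 (λ v w x z → v ⊕ (w ⊕ (z ⊕ x)) ⊜ (v ⊕ (w ⊕ z)) ⊕ x) refl (x ↑ (s * u)) w x₀ (x ↑ i) ⟩
        (x ↑ (s * u) ∙ (w ∙ x ↑ i)) ∙ x₀ ∎)
      l v : ℕ
      l = (m ∸ 1) * r
      v = (m ∸ 1) * (s * u)
      difference : w ∙ (y ∙ y ↑ l) ≈ x ↑ (u + v) ∙ w
      difference = begin
        w ∙ (y ∙ y ↑ l) ≈⟨ ∙-congˡ (∙-congˡ (y↑⁻¹ r)) ⟨
        w ∙ (y ∙ (y ↑ r) ⁻¹) ≡⟨ solve 3 (λ w y z → w ⊕ (y ⊕ z ⁻) ⊜ (w ⊕ y) ⊕ (((w ⊕ z) ⁻) ⊕ w)) refl w y (y ↑ r) ⟩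
        (w ∙ y) ∙ ((w ∙ y ↑ r) ⁻¹ ∙ w) ≈⟨ ∙-cong (≡⇒≈ wy) (∙-congʳ (⁻¹-cong two-ways)) ⟩
        (x ↑ u ∙ (w ∙ x ↑ i)) ∙ ((x ↑ (s * u) ∙ (w ∙ x ↑ i)) ⁻¹ ∙ w) ≡⟨ solve 4 (λ t z q w → (t ⊕ z) ⊕ (((q ⊕ z) ⁻) ⊕ w) ⊜ (t ⊕ q ⁻) ⊕ w) refl (x ↑ u) (w ∙ x ↑ i) (x ↑ (s * u)) w ⟩
        (x ↑ u ∙ (x ↑ (s * u)) ⁻¹) ∙ w ≈⟨ ∙-congʳ (∙-congˡ (x↑⁻¹ (s * u))) ⟩
        (x ↑ u ∙ x ↑ v) ∙ w ≡⟨ cong (_∙ w) (↑-+ x u v) ⟨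
        x ↑ (u + v) ∙ w ∎
      xl : x ↑ suc l ≈ ε
      xl = trivial-intersection (w ∙ b) (suc l) (u + v) wb≁ε (begin
        (w ∙ b) ∙ x ↑ suc l ≡⟨ cong ((w ∙ b) ∙_) (identityʳ _) ⟨
        (w ∙ b) ∙ (x ↑ suc l ∙ ε) ≡⟨ cong (λ z → (w ∙ b) ∙ (x ↑ suc l ∙ z)) b∙b ⟨
        (w ∙ b) ∙ (x ↑ suc l ∙ (b ∙ b)) ≡⟨ solve 3 (λ w b v → (w ⊕ b) ⊕ (v ⊕ (b ⊕ b)) ⊜ (w ⊕ (b ⊕ (v ⊕ b))) ⊕ b) refl w b (x ↑ suc l) ⟩
        (w ∙ (b ∙ (x ↑ suc l ∙ b))) ∙ b ≡⟨ cong (λ z → (w ∙ z) ∙ b) (y↑ (suc l)) ⟨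
        (w ∙ y ↑ suc l) ∙ b ≈⟨ ∙-congʳ difference ⟩
        (x ↑ (u + v) ∙ w) ∙ b ≡⟨ assoc _ w b ⟩
        x ↑ (u + v) ∙ (w ∙ b) ∎)
      y≈yr : y ≈ y ↑ r
      y≈yr = begin
        y ≡⟨ solve 2 (λ y z → y ⊜ (y ⊕ z ⁻) ⊕ z) refl y (y ↑ r) ⟩
        (y ∙ (y ↑ r) ⁻¹) ∙ y ↑ r ≈⟨ ∙-congʳ (∙-congˡ (y↑⁻¹ r)) ⟩
        (y ↑ suc l) ∙ y ↑ r ≡⟨ cong (_∙ y ↑ r) (conj-x↑ (suc l)) ⟨
        conj b (x ↑ suc l) ∙ y ↑ r ≈⟨ ∙-congʳ (≈-trans (conj-cong b xl) (≡⇒≈ (conj-ε b))) ⟩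
        ε ∙ y ↑ r ≡⟨ identityˡ _ ⟩
        y ↑ r ∎

module NextLayer {D : Set} {𝔾 : GroupOn D} {d e : ℕ} (Γ : Geometry 𝔾 d e) (π : OddPrime d)
                 {f : ℕ} (L : Layers.Layer Γ π (suc f)) where

  open OddPrime π
  open GroupTheory 𝔾
  open Geometry Γ
  open Blocks Γ π
  open Layers Γ π
  open CentralPair Γ π L public
  open Layer L
  open Modulo C

  conj-x₀ : conj b x₀ ≡ y₀
  conj-x₀ = conj-x↑ (p ^ f)

  conj-y₀ : conj b y₀ ≡ x₀
  conj-y₀ = conj-y↑ (p ^ f)

  x₀-central : ∀ {k} → Fix k → Commute x₀ k
  x₀-central {k} fk = go (fix⇒xy k fk)
    where
    go : (∃₂ λ i j → k ≡ x ↑ i ∙ y ↑ j) → Commute x₀ k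
    go (i , j , eq) = commute-respʳ (≡⇒≈ (sym eq)) (commute-∙ (≡⇒≈ (↑-comm x (p ^ f) i)) (commute-↑ j commute-x₀-y))

  conjugate-central : ∀ g {k} → Fix k → Commute (conj g x₀) k
  conjugate-central g {k} fk = begin
    conj g x₀ ∙ k ≡⟨ solve 3 (λ g x k → (g ⁻ ⊕ (x ⊕ g)) ⊕ k ⊜ g ⁻ ⊕ ((x ⊕ ((g ⁻ ⁻) ⊕ (k ⊕ g ⁻))) ⊕ g)) refl g x₀ k ⟩
    conj g (x₀ ∙ conj (g ⁻¹) k) ≈⟨ conj-cong g (x₀-central (fix-conj (g ⁻¹) fk)) ⟩
    conj g (conj (g ⁻¹) k ∙ x₀) ≡⟨ solve 3 (λ g x k → g ⁻ ⊕ ((((g ⁻ ⁻) ⊕ (k ⊕ g ⁻)) ⊕ x) ⊕ g) ⊜ k ⊕ (g ⁻ ⊕ (x ⊕ g))) refl g x₀ k ⟩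
    k ∙ conj g x₀ ∎
    where open ≈-Reasoning

  y₀-central : ∀ {k} → Fix k → Commute y₀ k
  y₀-central {k} fk = subst (λ z → Commute z k) conj-x₀ (conjugate-central b fk)

  x₀-order : x₀ ↑ p ≈ ε
  x₀-order = ≈-trans (≡⇒≈ (trans (sym (↑-* x (p ^ f) p)) (cong (x ↑_) (ℕₚ.*-comm (p ^ f) p)))) x-order

  y₀-order : y₀ ↑ p ≈ ε
  y₀-order = ≈-trans (≡⇒≈ (trans (sym (↑-* y (p ^ f) p)) (cong (y ↑_) (ℕₚ.*-comm (p ^ f) p)))) y-order

  fix-x₀ : Fix x₀
  fix-x₀ = fix-↑ (p ^ f) fix-x

  fix-y₀ : Fix y₀
  fix-y₀ = fix-↑ (p ^ f) fix-y

  p>0 : 0 < p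
  p>0 = s≤s z≤n

  y₀x₀-independent : ∀ i j → y₀ ↑ i ∙ x₀ ↑ j ≈ ε → p ∣ i × p ∣ j
  y₀x₀-independent i j eq = go (independent (p ^ f * i) (p ^ f * j) (≈-trans (≡⇒≈ (cong₂ _∙_ (↑-* y (p ^ f) i) (↑-* x (p ^ f) j))) eq))
    where
    cancel : ∀ i → p ^ suc f ∣ p ^ f * i → p ∣ i
    cancel i div = *-cancelˡ-∣ (p ^ f) {{p^≢0 f}} (subst (_∣ p ^ f * i) (ℕₚ.*-comm p (p ^ f)) div)
    go : p ^ suc f ∣ p ^ f * i × p ^ suc f ∣ p ^ f * j → p ∣ i × p ∣ j
    go (di , dj) = cancel i di , cancel j dj

  Ω : D → Set
  Ω g = ∃₂ λ i j → g ≈ y₀ ↑ i ∙ x₀ ↑ j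

  Ω-resp : ∀ {g h} → g ≈ h → Ω g → Ω h
  Ω-resp eq (i , j , eq′) = i , j , ≈-trans (≈-sym eq) eq′

  Ω⇒fix : ∀ {g} → Ω g → Fix g
  Ω⇒fix {g} (i , j , eq) = subst Fix (solve 2 (λ g h → (g ⊕ h ⁻) ⊕ h ⊜ g) refl g (y₀ ↑ i ∙ x₀ ↑ j))
    (fix-∙ (fine (≈-trans (∙-congʳ eq) (≡⇒≈ (inverseʳ (y₀ ↑ i ∙ x₀ ↑ j))))) (fix-∙ (fix-↑ i fix-y₀) (fix-↑ j fix-x₀)))

  Ω-commute : ∀ {g k} → Ω g → Fix k → Commute g k
  Ω-commute {g} {k} (i , j , eq) fk = ≈-sym (commute-respʳ (≈-sym eq)
    (commute-∙ (commute-↑ i (≈-sym (y₀-central fk))) (commute-↑ j (≈-sym (x₀-central fk)))))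

  Ω-ε : Ω ε
  Ω-ε = 0 , 0 , ≡⇒≈ (sym (identityʳ ε))

  Ω-∙ : ∀ {g h} → Ω g → Ω h → Ω (g ∙ h)
  Ω-∙ {g} {h} (i , j , eq) (i′ , j′ , eq′) = i + i′ , j + j′ , (begin
    g ∙ h ≈⟨ ∙-cong eq eq′ ⟩
    (y₀ ↑ i ∙ x₀ ↑ j) ∙ (y₀ ↑ i′ ∙ x₀ ↑ j′) ≡⟨ solve 4 (λ s t u v → (s ⊕ t) ⊕ (u ⊕ v) ⊜ s ⊕ ((t ⊕ u) ⊕ v)) refl (y₀ ↑ i) (x₀ ↑ j) (y₀ ↑ i′) (x₀ ↑ j′) ⟩
    y₀ ↑ i ∙ ((x₀ ↑ j ∙ y₀ ↑ i′) ∙ x₀ ↑ j′) ≈⟨ ∙-congˡ (∙-congʳ (Ω-commute (0 , j , ≡⇒≈ (sym (identityˡ _))) (fix-↑ i′ fix-y₀))) ⟩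
    y₀ ↑ i ∙ ((y₀ ↑ i′ ∙ x₀ ↑ j) ∙ x₀ ↑ j′) ≡⟨ solve 4 (λ s t u v → s ⊕ ((u ⊕ t) ⊕ v) ⊜ (s ⊕ u) ⊕ (t ⊕ v)) refl (y₀ ↑ i) (x₀ ↑ j) (y₀ ↑ i′) (x₀ ↑ j′) ⟩
    (y₀ ↑ i ∙ y₀ ↑ i′) ∙ (x₀ ↑ j ∙ x₀ ↑ j′) ≡⟨ cong₂ _∙_ (↑-+ y₀ i i′) (↑-+ x₀ j j′) ⟨
    y₀ ↑ (i + i′) ∙ x₀ ↑ (j + j′) ∎)
    where open ≈-Reasoning

  Ω-⁻¹ : ∀ {g} → Ω g → Ω (g ⁻¹)
  Ω-⁻¹ {g} (i , j , eq) = Ω-resp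
    (≈-trans (∙-cong (≈-sym (↑⁻¹ p>0 x₀-order j)) (≈-sym (↑⁻¹ p>0 y₀-order i)))
      (≈-trans (≡⇒≈ (sym (⁻¹-anti-homo-∙ (y₀ ↑ i) (x₀ ↑ j)))) (⁻¹-cong (≈-sym eq))))
    (Ω-∙ {x₀ ↑ ((p ∸ 1) * j)} (0 , (p ∸ 1) * j , ≡⇒≈ (sym (identityˡ _))) ((p ∸ 1) * i , 0 , ≡⇒≈ (sym (identityʳ _))))

  Ω-↑ : ∀ {g} i → Ω g → Ω (g ↑ i)
  Ω-↑ zero Ωg = Ω-ε
  Ω-↑ (suc i) Ωg = Ω-∙ Ωg (Ω-↑ i Ωg)

  Ω-exponent : ∀ {g} → Ω g → g ↑ p ≈ ε
  Ω-exponent {g} (i , j , eq) = begin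
    g ↑ p ≈⟨ ↑-cong p eq ⟩
    (y₀ ↑ i ∙ x₀ ↑ j) ↑ p ≈⟨ ∙-↑ p (Ω-commute (i , 0 , ≡⇒≈ (sym (identityʳ _))) (fix-↑ j fix-x₀)) ⟩
    y₀ ↑ i ↑ p ∙ x₀ ↑ j ↑ p ≈⟨ ∙-cong (power i y₀-order) (power j x₀-order) ⟩
    ε ∙ ε ≡⟨ identityʳ ε ⟩
    ε ∎
    where
    open ≈-Reasoning
    power : ∀ {z} i → z ↑ p ≈ ε → z ↑ i ↑ p ≈ ε
    power {z} i eq = ≈-trans (≡⇒≈ (sym (↑-* z i p))) (↑-∣ {z} {p} {i * p} eq (n∣m*n i))

  Ω-y₀ : Ω y₀
  Ω-y₀ = 1 , 0 , ≡⇒≈ (trans (sym (identityʳ y₀)) (sym (identityʳ _)))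

  Ω-x₀ : Ω x₀
  Ω-x₀ = 0 , 1 , ≡⇒≈ (trans (sym (identityʳ x₀)) (sym (identityˡ _)))

  -- A central z = yⁱxʲ with zᵖ = 1 forces both factors to be central of order dividing p.
  Ω-conj-x₀ : ∀ g → Ω (conj g x₀)
  Ω-conj-x₀ g = go (fix⇒yx z (fix-conj g fix-x₀))
    where
    z : D
    z = conj g x₀
    z-order : z ↑ p ≈ ε
    z-order = ≈-trans (≡⇒≈ (sym (conj-↑ g x₀ p))) (≈-trans (conj-cong g x₀-order) (≡⇒≈ (conj-ε g)))
    go : (∃₂ λ i j → z ≡ y ↑ i ∙ x ↑ j) → Ω z
    go (i , j , z≡) = roots (independent (i * p) (j * p) (begin
        y ↑ (i * p) ∙ x ↑ (j * p) ≡⟨ cong₂ _∙_ (↑-* y i p) (↑-* x j p) ⟩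
        y ↑ i ↑ p ∙ x ↑ j ↑ p ≈⟨ ∙-↑ p (commute-↑ j yi-x) ⟨
        (y ↑ i ∙ x ↑ j) ↑ p ≡⟨ cong (_↑ p) z≡ ⟨
        z ↑ p ≈⟨ z-order ⟩
        ε ∎))
      where
      open ≈-Reasoning
      yi-x : Commute (y ↑ i) x
      yi-x = cancelʳ (x ↑ j) (begin
        (y ↑ i ∙ x) ∙ x ↑ j ≡⟨ assoc (y ↑ i) x (x ↑ j) ⟩
        y ↑ i ∙ (x ∙ x ↑ j) ≡⟨ cong (y ↑ i ∙_) (↑-suc x j) ⟩
        y ↑ i ∙ (x ↑ j ∙ x) ≡⟨ assoc (y ↑ i) (x ↑ j) x ⟨
        (y ↑ i ∙ x ↑ j) ∙ x ≡⟨ cong (_∙ x) z≡ ⟨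
        z ∙ x ≈⟨ conjugate-central g fix-x ⟩
        x ∙ z ≡⟨ cong (x ∙_) z≡ ⟩
        x ∙ (y ↑ i ∙ x ↑ j) ≡⟨ assoc x (y ↑ i) (x ↑ j) ⟨
        (x ∙ y ↑ i) ∙ x ↑ j ∎)
      cancel : ∀ i → p ^ suc f ∣ i * p → p ^ f ∣ i
      cancel i div = *-cancelˡ-∣ p (subst (p ^ suc f ∣_) (ℕₚ.*-comm i p) div)
      root : ∀ {i} z → p ^ f ∣ i → ∃ λ q → z ↑ i ≡ z ↑ (p ^ f) ↑ q
      root z (divides q refl) = q , trans (cong (z ↑_) (ℕₚ.*-comm q (p ^ f))) (↑-* z (p ^ f) q)
      collected : (∃ λ q → y ↑ i ≡ y₀ ↑ q) → (∃ λ q → x ↑ j ≡ x₀ ↑ q) → Ω z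
      collected (q , eq) (r , eq′) = q , r , ≡⇒≈ (trans z≡ (cong₂ _∙_ eq eq′))
      roots : p ^ suc f ∣ i * p × p ^ suc f ∣ j * p → Ω z
      roots (di , dj) = collected (root y (cancel i di)) (root x (cancel j dj))

  Ω-conj : ∀ h {g} → Ω g → Ω (conj h g)
  Ω-conj h {g} (i , j , eq) = Ω-resp
    (≈-trans (≡⇒≈ (trans (sym (cong₂ _∙_ (conj-↑ h y₀ i) (conj-↑ h x₀ j))) (sym (conj-∙ h (y₀ ↑ i) (x₀ ↑ j))))) (conj-cong h (≈-sym eq)))
    (Ω-∙ (Ω-↑ i (subst Ω (trans (sym (conj-conj b h x₀)) (cong (conj h) conj-x₀)) (Ω-conj-x₀ (b ∙ h)))) (Ω-↑ j (Ω-conj-x₀ h)))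

  Ω-C : Congruence
  Ω-C = normal-congruence Ω Ω-ε Ω-∙ Ω-⁻¹ Ω-conj

  module Q = Modulo Ω-C

  ≈Ω⇒ : ∀ {g h} → g Q.≈ h → ∃ λ ω → Ω ω × g ≡ ω ∙ h
  ≈Ω⇒ {g} {h} w = g ∙ h ⁻¹ , w , solve 2 (λ g h → g ⊜ (g ⊕ h ⁻) ⊕ h) refl g h

  Ω? : ∀ g → Dec (Ω g)
  Ω? g = map′ (λ (i , j , eq) → toℕ i , toℕ j , eq)
    (λ (i , j , eq) → i mod p , j mod p , ≈-trans eq (∙-cong (≈-sym (↑-mod {y₀} {p} y₀-order i)) (≈-sym (↑-mod {x₀} {p} x₀-order j))))
    (Finₚ.any? (λ (i : Fin p) → Finₚ.any? (λ (j : Fin p) → g ≈? (y₀ ↑ toℕ i ∙ x₀ ↑ toℕ j))))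

  Ω-ε⁻ : ∀ {g} → g Q.≈ ε → Ω g
  Ω-ε⁻ {g} = subst Ω (solve 1 (λ g → g ⊕ (:ε ⁻) ⊜ g) refl g)

  Ω-ε⁺ : ∀ {g} → Ω g → g Q.≈ ε
  Ω-ε⁺ {g} = subst Ω (solve 1 (λ g → g ⊜ g ⊕ (:ε ⁻)) refl g)

  next : Layer f
  next = record
    { C = Ω-C
    ; _≈?_ = λ g h → Ω? (g ∙ h ⁻¹)
    ; fine = λ w → Ω⇒fix (Ω-ε⁻ w)
    ; x-order = Ω-ε⁺ Ω-x₀
    ; independent = λ i j w → lift i j (Ω-ε⁻ w) }
    where
    open ≈-Reasoning
    lift : ∀ i j → Ω (y ↑ i ∙ x ↑ j) → p ^ f ∣ i × p ^ f ∣ j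
    -- Moving the Ω-part to the left turns yⁱxʲ = y₀ˢx₀ᵗ into a trivial product with exponents i -
    -- pᶠs and j - pᶠt, which are therefore divisible by pᶠ⁺¹.
    lift i j (s , t , eq) = go (independent (p ^ f * s′ + i) (j + p ^ f * t′) (begin
        y ↑ (p ^ f * s′ + i) ∙ x ↑ (j + p ^ f * t′) ≡⟨ cong₂ _∙_ (trans (↑-+ y (p ^ f * s′) i) (cong (_∙ y ↑ i) (↑-* y (p ^ f) s′))) (trans (↑-+ x j (p ^ f * t′)) (cong (x ↑ j ∙_) (↑-* x (p ^ f) t′))) ⟩
        (y₀ ↑ s′ ∙ y ↑ i) ∙ (x ↑ j ∙ x₀ ↑ t′) ≡⟨ solve 4 (λ s u v t → (s ⊕ u) ⊕ (v ⊕ t) ⊜ s ⊕ ((u ⊕ v) ⊕ t)) refl (y₀ ↑ s′) (y ↑ i) (x ↑ j) (x₀ ↑ t′) ⟩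
        y₀ ↑ s′ ∙ ((y ↑ i ∙ x ↑ j) ∙ x₀ ↑ t′) ≈⟨ ∙-cong (≈-sym (↑⁻¹ p>0 y₀-order s)) (∙-cong eq (≈-sym (↑⁻¹ p>0 x₀-order t))) ⟩
        (y₀ ↑ s) ⁻¹ ∙ ((y₀ ↑ s ∙ x₀ ↑ t) ∙ (x₀ ↑ t) ⁻¹) ≡⟨ solve 2 (λ s t → s ⁻ ⊕ ((s ⊕ t) ⊕ t ⁻) ⊜ :ε) refl (y₀ ↑ s) (x₀ ↑ t) ⟩
        ε ∎))
      where
      s′ t′ : ℕ
      s′ = (p ∸ 1) * s
      t′ = (p ∸ 1) * t
      go : p ^ suc f ∣ p ^ f * s′ + i × p ^ suc f ∣ j + p ^ f * t′ → p ^ f ∣ i × p ^ f ∣ j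
      go (di , dj) = ∣m+n∣m⇒∣n (∣-trans (n∣m*n p) di) (m∣m*n s′) ,
        ∣m+n∣m⇒∣n (subst (p ^ f ∣_) (ℕₚ.+-comm j (p ^ f * t′)) (∣-trans (n∣m*n p) dj)) (m∣m*n t′)

-- Norms from an abelian normal subgroup.

geo-1mod : ∀ t p n → ∃ λ s → geo (1 + t * p) n ≡ n + s * p
geo-1mod t p zero = 0 , refl
geo-1mod t p (suc n) with power-1mod t p n | geo-1mod t p n
... | s , eq | r , eq′ = s + r , trans (cong₂ _+_ eq eq′) (arith s r n p)
  where
  arith : ∀ s r n p → (1 + s * p) + (n + r * p) ≡ suc n + (s + r) * p
  arith = solve-∀

module Norms {D : Set} (𝔾 : GroupOn D) (C : GroupTheory.Congruence 𝔾) where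

  open GroupTheory 𝔾
  open Modulo C

  -- norm g ω n = ω · gωg⁻¹ ⋯ gⁿ⁻¹ωg¹⁻ⁿ
  norm : D → D → ℕ → D
  norm g ω zero = ε
  norm g ω (suc n) = ω ∙ conj (g ⁻¹) (norm g ω n)

  -- The source of the norms: when the factors g are pulled to the right, each ω is conjugated by
  -- the power of g that has passed it.
  norm-↑ : ∀ g ω n → (ω ∙ g) ↑ n ≡ norm g ω n ∙ g ↑ n
  norm-↑ g ω zero = sym (identityˡ ε)
  norm-↑ g ω (suc n) = trans (cong ((ω ∙ g) ∙_) (norm-↑ g ω n))
    (solve 4 (λ w g n h → (w ⊕ g) ⊕ (n ⊕ h) ⊜ (w ⊕ ((g ⁻ ⁻) ⊕ (n ⊕ g ⁻))) ⊕ (g ⊕ h)) refl ω g (norm g ω n) (g ↑ n))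

  norm-conj : ∀ h g ω n → conj h (norm g ω n) ≡ norm (conj h g) (conj h ω) n
  norm-conj h g ω zero = conj-ε h
  norm-conj h g ω (suc n) = trans (conj-∙ h ω _) (cong (conj h ω ∙_)
    (trans (solve 3 (λ h g n → h ⁻ ⊕ (((g ⁻ ⁻) ⊕ (n ⊕ g ⁻)) ⊕ h) ⊜ (((h ⁻ ⊕ (g ⊕ h)) ⁻) ⁻) ⊕ ((h ⁻ ⊕ (n ⊕ h)) ⊕ ((h ⁻ ⊕ (g ⊕ h)) ⁻))) refl h g (norm g ω n))
      (cong (conj ((conj h g) ⁻¹)) (norm-conj h g ω n))))

  norm-cong : ∀ g {ω ω′} n → ω ≈ ω′ → norm g ω n ≈ norm g ω′ n
  norm-cong g zero eq = ≈-refl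
  norm-cong g (suc n) eq = ∙-cong eq (conj-cong (g ⁻¹) (norm-cong g n eq))

  norm-snoc : ∀ g ω n → norm g ω (suc n) ≡ norm g ω n ∙ conj ((g ⁻¹) ↑ n) ω
  norm-snoc g ω zero = solve 2 (λ g w → w ⊕ ((g ⁻ ⁻) ⊕ (:ε ⊕ g ⁻)) ⊜ :ε ⊕ ((:ε ⁻) ⊕ (w ⊕ :ε))) refl g ω
  norm-snoc g ω (suc n) = begin
    ω ∙ conj (g ⁻¹) (norm g ω (suc n)) ≡⟨ cong (λ z → ω ∙ conj (g ⁻¹) z) (norm-snoc g ω n) ⟩
    ω ∙ conj (g ⁻¹) (norm g ω n ∙ conj ((g ⁻¹) ↑ n) ω) ≡⟨ cong (ω ∙_) (conj-∙ (g ⁻¹) _ _) ⟩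
    ω ∙ (conj (g ⁻¹) (norm g ω n) ∙ conj (g ⁻¹) (conj ((g ⁻¹) ↑ n) ω)) ≡⟨ assoc ω _ _ ⟨
    norm g ω (suc n) ∙ conj (g ⁻¹) (conj ((g ⁻¹) ↑ n) ω) ≡⟨ cong (norm g ω (suc n) ∙_) (conj-conj ((g ⁻¹) ↑ n) (g ⁻¹) ω) ⟩
    norm g ω (suc n) ∙ conj ((g ⁻¹) ↑ n ∙ g ⁻¹) ω ≡⟨ cong (λ z → norm g ω (suc n) ∙ conj z ω) (sym (↑-suc (g ⁻¹) n)) ⟩
    norm g ω (suc n) ∙ conj ((g ⁻¹) ↑ suc n) ω ∎
    where open ≡-Reasoning

  module _ (A : D → Set) (A-ε : A ε) (A-∙ : ∀ {g h} → A g → A h → A (g ∙ h)) (A-conj : ∀ h {g} → A g → A (conj h g))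
           (A-commute : ∀ {g h} → A g → A h → Commute g h) where

    norm-∈ : ∀ g {ω} n → A ω → A (norm g ω n)
    norm-∈ g zero Aω = A-ε
    norm-∈ g (suc n) Aω = A-∙ Aω (A-conj (g ⁻¹) (norm-∈ g n Aω))

    norm-∙ : ∀ g {ω ω′} n → A ω → A ω′ → norm g (ω ∙ ω′) n ≈ norm g ω n ∙ norm g ω′ n
    norm-∙ g zero Aω Aω′ = ≡⇒≈ (sym (identityˡ ε))
    norm-∙ g {ω} {ω′} (suc n) Aω Aω′ = begin
      (ω ∙ ω′) ∙ conj (g ⁻¹) (norm g (ω ∙ ω′) n) ≈⟨ ∙-congˡ (conj-cong (g ⁻¹) (norm-∙ g n Aω Aω′)) ⟩
      (ω ∙ ω′) ∙ conj (g ⁻¹) (norm g ω n ∙ norm g ω′ n) ≡⟨ cong ((ω ∙ ω′) ∙_) (conj-∙ (g ⁻¹) _ _) ⟩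
      (ω ∙ ω′) ∙ (conj (g ⁻¹) (norm g ω n) ∙ conj (g ⁻¹) (norm g ω′ n)) ≡⟨ solve 4 (λ s t u v → (s ⊕ t) ⊕ (u ⊕ v) ⊜ s ⊕ ((t ⊕ u) ⊕ v)) refl ω ω′ (conj (g ⁻¹) (norm g ω n)) (conj (g ⁻¹) (norm g ω′ n)) ⟩
      ω ∙ ((ω′ ∙ conj (g ⁻¹) (norm g ω n)) ∙ conj (g ⁻¹) (norm g ω′ n)) ≈⟨ ∙-congˡ (∙-congʳ (A-commute Aω′ (A-conj (g ⁻¹) (norm-∈ g n Aω)))) ⟩
      ω ∙ ((conj (g ⁻¹) (norm g ω n) ∙ ω′) ∙ conj (g ⁻¹) (norm g ω′ n)) ≡⟨ solve 4 (λ s t u v → s ⊕ ((u ⊕ t) ⊕ v) ⊜ (s ⊕ u) ⊕ (t ⊕ v)) refl ω ω′ (conj (g ⁻¹) (norm g ω n)) (conj (g ⁻¹) (norm g ω′ n)) ⟩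
      (ω ∙ conj (g ⁻¹) (norm g ω n)) ∙ (ω′ ∙ conj (g ⁻¹) (norm g ω′ n)) ∎
      where open ≈-Reasoning

    norm-central : ∀ g {ω} n → A ω → (∀ {h} → A h → Commute h g) → norm g ω n ≈ ω ↑ n
    norm-central g zero Aω cg = ≈-refl
    norm-central g (suc n) Aω cg = ∙-congˡ (≈-trans (commute⇒conj (commute-⁻¹ (cg (norm-∈ g n Aω)))) (norm-central g n Aω cg))

    -- Conjugation by g shifts the factors cyclically, the last becoming gⁿωg⁻ⁿ = ω, and the factors
    -- commute.
    norm-fixed : ∀ g {ω} n → A ω → g ↑ n ≈ ε → Commute (norm g ω n) g
    norm-fixed g {ω} n Aω gn = fixed (cancelˡ ω (begin
      ω ∙ conj (g ⁻¹) (norm g ω n) ≡⟨ norm-snoc g ω n ⟩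
      norm g ω n ∙ conj ((g ⁻¹) ↑ n) ω ≈⟨ ∙-congˡ (≈-trans (conj-cong₂ g⁻ⁿ ≈-refl) (≡⇒≈ (conj-by-ε ω))) ⟩
      norm g ω n ∙ ω ≈⟨ A-commute (norm-∈ g n Aω) Aω ⟩
      ω ∙ norm g ω n ∎))
      where
      open ≈-Reasoning
      g⁻ⁿ : (g ⁻¹) ↑ n ≈ ε
      g⁻ⁿ = ≈-trans (≡⇒≈ (sym (⁻¹-↑ g n))) (≈-trans (⁻¹-cong gn) (≡⇒≈ ε⁻¹≈ε))
      fixed : conj (g ⁻¹) (norm g ω n) ≈ norm g ω n → Commute (norm g ω n) g
      fixed eq = commute-respʳ (≡⇒≈ (⁻¹-involutive g)) (commute-⁻¹ (conj⇒commute eq))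

    -- Both sides are the product of gⁱωg⁻ⁱ for i from 1 to n, taken in opposite orders.
    norm-reverse : ∀ g {ω} n → A ω → conj ((g ⁻¹) ↑ n) (norm (g ⁻¹) ω n) ≈ conj (g ⁻¹) (norm g ω n)
    norm-reverse g zero Aω = ≡⇒≈ (trans (conj-ε _) (sym (conj-ε _)))
    norm-reverse g {ω} (suc n) Aω = begin
      conj (u ∙ u ↑ n) (ω ∙ conj (u ⁻¹) (norm u ω n)) ≡⟨ conj-∙ (u ∙ u ↑ n) ω _ ⟩
      conj (u ∙ u ↑ n) ω ∙ conj (u ∙ u ↑ n) (conj (u ⁻¹) (norm u ω n)) ≡⟨ cong (conj (u ∙ u ↑ n) ω ∙_) (solve 3 (λ u v m → ((u ⊕ v) ⁻) ⊕ (((u ⁻ ⁻) ⊕ (m ⊕ u ⁻)) ⊕ (u ⊕ v)) ⊜ v ⁻ ⊕ (m ⊕ v)) refl u (u ↑ n) (norm u ω n)) ⟩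
      conj (u ∙ u ↑ n) ω ∙ conj (u ↑ n) (norm u ω n) ≈⟨ ∙-congˡ (norm-reverse g n Aω) ⟩
      conj (u ∙ u ↑ n) ω ∙ conj u (norm g ω n) ≈⟨ A-commute (A-conj _ Aω) (A-conj u (norm-∈ g n Aω)) ⟩
      conj u (norm g ω n) ∙ conj (u ∙ u ↑ n) ω ≡⟨ cong (λ z → conj u (norm g ω n) ∙ conj z ω) (↑-suc u n) ⟩
      conj u (norm g ω n) ∙ conj (u ↑ n ∙ u) ω ≡⟨ cong (conj u (norm g ω n) ∙_) (conj-conj (u ↑ n) u ω) ⟨
      conj u (norm g ω n) ∙ conj u (conj (u ↑ n) ω) ≡⟨ conj-∙ u (norm g ω n) (conj (u ↑ n) ω) ⟨
      conj u (norm g ω n ∙ conj (u ↑ n) ω) ≡⟨ cong (conj u) (norm-snoc g ω n) ⟨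
      conj u (norm g ω (suc n)) ∎
      where
      open ≈-Reasoning
      u : D
      u = g ⁻¹

-- Induction on the layers.

module Descent {D : Set} {𝔾 : GroupOn D} {d e : ℕ} (Γ : Geometry 𝔾 d e) (π : OddPrime d) where

  open OddPrime π
  open GroupTheory 𝔾
  open Geometry Γ
  open Blocks Γ π
  open Translation Γ π
  open Layers Γ π

  -- The kernel times ⟨c⟩; by `p-element` it contains every element of p-power order.
  InP : D → Set
  InP g = ∃ λ i → g K.≈ c ↑ i

  -- The statement proved by induction: modulo the layer, a normalises ⟨c⟩ and c has order exactly
  -- pᶠ⁺¹.
  record CyclicMod {f : ℕ} (L : Layer f) : Set where
    open Layer L using (C)
    open Congruence C
    field
      k : ℕ
      action : conj a c ≈ c ↑ k
      exponent : c ↑ (p ^ suc f) ≈ ε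
      exact : ¬ (c ↑ (p ^ f) ≈ ε)

  conj-τ-c : conj τ c ≡ c ⁻¹
  conj-τ-c = trans (solve 2 (λ t b → t ⁻ ⊕ ((t ⊕ b) ⊕ t) ⊜ b ⊕ t) refl τ b)
    (trans (cong₂ _∙_ (sym b⁻¹) (sym τ⁻¹)) (sym (⁻¹-anti-homo-∙ τ b)))

  b≡τc : b ≡ τ ∙ c
  b≡τc = trans (sym (identityˡ b)) (trans (cong (_∙ b) (sym ττ)) (assoc τ τ b))

  module Factorisation (C : Congruence) (k : ℕ) (act : Congruence._≈_ C (conj a c) (c ↑ k)) where

    open Modulo C
    module F = Metacyclic 𝔾 C

    Factored : D → Set
    Factored g = ∃₂ λ j i → g ≈ a ↑ j ∙ c ↑ i

    factored-a : ∀ s {g} → Factored g → Factored (a ↑ s ∙ g)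
    factored-a s {g} (j , i , eq) = s + j , i , ≈-trans (∙-congˡ eq)
      (≡⇒≈ (trans (sym (assoc (a ↑ s) (a ↑ j) (c ↑ i))) (cong (_∙ c ↑ i) (sym (↑-+ a s j)))))

    factored-c : ∀ {g} → Factored g → Factored (c ∙ g)
    factored-c {g} (j , i , eq) = j , k ^ j * 1 + i , (begin
      c ∙ g ≈⟨ ∙-congˡ eq ⟩
      c ∙ (a ↑ j ∙ c ↑ i) ≡⟨ assoc c (a ↑ j) (c ↑ i) ⟨
      (c ∙ a ↑ j) ∙ c ↑ i ≡⟨ cong (λ h → (h ∙ a ↑ j) ∙ c ↑ i) (identityʳ c) ⟨
      (c ↑ 1 ∙ a ↑ j) ∙ c ↑ i ≈⟨ ∙-congʳ (F.push k act 1 j) ⟩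
      (a ↑ j ∙ c ↑ (k ^ j * 1)) ∙ c ↑ i ≡⟨ assoc (a ↑ j) (c ↑ (k ^ j * 1)) (c ↑ i) ⟩
      a ↑ j ∙ (c ↑ (k ^ j * 1) ∙ c ↑ i) ≡⟨ cong (a ↑ j ∙_) (↑-+ c (k ^ j * 1) i) ⟨
      a ↑ j ∙ c ↑ (k ^ j * 1 + i) ∎)
      where open ≈-Reasoning

    factored-b : ∀ {g} → Factored g → Factored (b ∙ g)
    factored-b {g} fg = subst Factored (trans (sym (assoc τ c g)) (cong (_∙ g) (sym b≡τc))) (factored-a (p ^ e * half) (factored-c fg))

    factored-far : ∀ g → β g ≢ β ε → Factored g
    factored-far g g≁ε = go (cell g g≁ε)
      where
      go : (∃₂ λ i j → g ≡ a ↑ i ∙ (b ∙ a ↑ j)) → Factored g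
      go (i , j , eq) = subst Factored (sym eq) (factored-a i (factored-b (j , 0 , ≡⇒≈ (sym (identityʳ _)))))

    -- The products aʲcⁱ are stable under left multiplication by a and by b = τc, and one of g and
    -- bg has the form aⁱbaʲ.
    factored : ∀ g → Factored g
    factored g with β g Finₚ.≟ β ε
    ... | no g≁ε = factored-far g g≁ε
    ... | yes g∼ε = subst Factored (bb g) (factored-b (factored-far (b ∙ g) (λ bg∼ε → β-b g (trans bg∼ε (sym g∼ε)))))

  -- Otherwise a⁻¹ca would lie in the kernel, but it is conjugate to c, which fixes no part.
  ¬p∣k : ∀ {ω} k → Fix ω → conj a c ≡ ω ∙ c ↑ k → ¬ (p ∣ k)
  ¬p∣k k fω eq p∣k = conj-c-free ε (subst Fix (sym eq) (fix-∙ fω (fix-c↑ k p∣k)) ε)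

  -- In layer 0 the elements x and y, and with them the kernel, are trivial, so the claim is the one
  -- for the action on the parts.
  base : (L : Layer 0) → CyclicMod L
  base L = go conj-c
    where
    open Layer L
    open Modulo C
    x≈ε : x ≈ ε
    x≈ε = ≈-trans (≡⇒≈ (sym (identityʳ x))) x-order
    y≈ε : y ≈ ε
    y≈ε = ≈-trans (≡⇒≈ y≡conj) (≈-trans (conj-cong b x≈ε) (≡⇒≈ (conj-ε b)))
    fix⇒ε : ∀ {k} → Fix k → k ≈ ε
    fix⇒ε {k} fk = trivial (fix⇒yx k fk)
      where
      trivial : (∃₂ λ i j → k ≡ y ↑ i ∙ x ↑ j) → k ≈ ε
      trivial (i , j , eq) = ≈-trans (≡⇒≈ eq) (≈-trans (∙-cong (↑-cong i y≈ε) (↑-cong j x≈ε))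
        (≡⇒≈ (trans (cong₂ _∙_ (ε↑ i) (ε↑ j)) (identityʳ ε))))
    go : (∃ λ k → conj a c K.≈ c ↑ k) → CyclicMod L
    go (k , act) = record
      { k = k
      ; action = cancelʳ ((c ↑ k) ⁻¹) (≈-trans (fix⇒ε act) (≡⇒≈ (sym (inverseʳ (c ↑ k)))))
      ; exponent = fix⇒ε (fix-c↑ (p ^ 1) (m∣m*n 1))
      ; exact = λ c≈ε → c-free ε (fine (≈-trans (≡⇒≈ (sym (identityʳ c))) c≈ε) ε) }

  module Step {f : ℕ} (L : Layer (suc f)) where

    open NextLayer Γ π L
    open Layer L
    open Modulo C

    conj-τ-x₀ : conj τ x₀ ≡ x₀
    conj-τ-x₀ = trans (cong (τ ⁻¹ ∙_) (x↑-a (p ^ f) (p ^ e * half))) (solve 2 (λ t x → t ⁻ ⊕ (t ⊕ x) ⊜ x) refl τ x₀)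

    conj-c-x₀ : conj c x₀ ≡ y₀
    conj-c-x₀ = trans (sym (conj-conj τ b x₀)) (trans (cong (conj b) conj-τ-x₀) conj-x₀)

    -- cᵖ lies in the kernel, which centralises Ω, so only i modulo p matters, and there i can be
    -- inverted.
    commute-descends : ∀ {g} i → ¬ (p ∣ i) → Ω g → Commute g (c ↑ i) → Commute g c
    commute-descends {g} i p∤i Ωg comm = go (inverse-mod (Coprimality.sym (prime-coprime prime p∤i)) p∤1)
      where
      go : (∃₂ λ u t → i * u ≡ 1 + t * p) → Commute g c
      go (u , t , eq) = commute-respʳ (≡⇒≈ (solve 2 (λ c z → (c ⊕ z) ⊕ z ⁻ ⊜ c) refl c (c ↑ (t * p))))
        (commute-∙ (commute-respʳ (≡⇒≈ (trans (sym (↑-* c i u)) (cong (c ↑_) eq))) (commute-↑ u comm))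
          (commute-⁻¹ (Ω-commute Ωg (fix-c↑ (t * p) (n∣m*n t)))))

    -- c conjugates x₀ to y₀, so commuting with c would identify x₀ˡ with y₀ˡ.
    x₀-not-central : ∀ {l} → Commute (x₀ ↑ l) c → p ∣ l
    x₀-not-central {l} comm = proj₁ (y₀x₀-independent l ((p ∸ 1) * l) (begin
      y₀ ↑ l ∙ x₀ ↑ ((p ∸ 1) * l) ≈⟨ ∙-congˡ (↑⁻¹ p>0 x₀-order l) ⟨
      y₀ ↑ l ∙ (x₀ ↑ l) ⁻¹ ≡⟨ cong (λ z → z ↑ l ∙ (x₀ ↑ l) ⁻¹) conj-c-x₀ ⟨
      conj c x₀ ↑ l ∙ (x₀ ↑ l) ⁻¹ ≡⟨ cong (_∙ (x₀ ↑ l) ⁻¹) (conj-↑ c x₀ l) ⟨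
      conj c (x₀ ↑ l) ∙ (x₀ ↑ l) ⁻¹ ≈⟨ ∙-congʳ (commute⇒conj comm) ⟩
      x₀ ↑ l ∙ (x₀ ↑ l) ⁻¹ ≡⟨ inverseʳ (x₀ ↑ l) ⟩
      ε ∎))
      where open ≈-Reasoning

    -- Being inverted twice, g commutes with c²ⁱ, and p is odd.
    x₀-flip : ∀ {g} i → ¬ (p ∣ i) → Ω g → conj (c ↑ i) g ≈ g ⁻¹ → Commute g c
    x₀-flip {g} i p∤i Ωg flip = commute-descends (2 * i) p∤2i Ωg (conj⇒commute (begin
      conj (c ↑ (2 * i)) g ≡⟨ cong (λ z → conj z g) (trans (cong (c ↑_) (cong (i +_) (ℕₚ.+-identityʳ i))) (↑-+ c i i)) ⟩
      conj (c ↑ i ∙ c ↑ i) g ≡⟨ conj-conj (c ↑ i) (c ↑ i) g ⟨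
      conj (c ↑ i) (conj (c ↑ i) g) ≈⟨ conj-cong (c ↑ i) flip ⟩
      conj (c ↑ i) (g ⁻¹) ≡⟨ conj-⁻¹ (c ↑ i) g ⟩
      (conj (c ↑ i) g) ⁻¹ ≈⟨ ⁻¹-cong flip ⟩
      (g ⁻¹) ⁻¹ ≡⟨ ⁻¹-involutive g ⟩
      g ∎))
      where
      open ≈-Reasoning
      p∤2i : ¬ (p ∣ 2 * i)
      p∤2i div with euclidsLemma 2 i prime div
      ... | inj₁ p∣2 = p∤2 p∣2
      ... | inj₂ p∣i = p∤i p∣i

    x₀-↑ε : ∀ {l} → p ∣ l → x₀ ↑ l ≈ ε
    x₀-↑ε {l} = ↑-∣ {x₀} {p} {l} x₀-order

    y₀-↑ε : ∀ {l} → p ∣ l → y₀ ↑ l ≈ ε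
    y₀-↑ε {l} = ↑-∣ {y₀} {p} {l} y₀-order

    Ω-abelian : ∀ {g h} → Ω g → Ω h → Commute g h
    Ω-abelian Ωg Ωh = Ω-commute Ωg (Ω⇒fix Ωh)

    module NonSplit (c≉ : ¬ (c ↑ m ≈ ε)) (Ωc : Ω (c ↑ m)) where

      z : D
      z = c ↑ m

      z-c : Commute z c
      z-c = ≡⇒≈ (sym (↑-suc c m))

      conj-τ-z : conj τ z ≡ z ⁻¹
      conj-τ-z = trans (conj-↑ τ c m) (trans (cong (_↑ m) conj-τ-c) (sym (⁻¹-↑ c m)))

      -- z is nontrivial and commutes with c, while no nontrivial power of x₀ does; so z ∉ ⟨x₀⟩, and
      -- z and x₀ together generate Ω.
      Ω-basis : ∀ {ω} → Ω ω → ∃₂ λ s l → ω ≈ z ↑ s ∙ x₀ ↑ l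
      Ω-basis {ω} (i , j , ω≈) = go Ωc
        where
        open ≈-Reasoning
        go : Ω z → ∃₂ λ s l → ω ≈ z ↑ s ∙ x₀ ↑ l
        go (u , v , z≈) with p ∣? u
        ... | yes p∣u = contradiction (≈-trans z≈x (x₀-↑ε (x₀-not-central {v} (≈-trans (∙-congʳ (≈-sym z≈x)) (≈-trans z-c (∙-congˡ z≈x)))))) c≉
          where
          z≈x : z ≈ x₀ ↑ v
          z≈x = ≈-trans z≈ (≈-trans (∙-congʳ (y₀-↑ε p∣u)) (≡⇒≈ (identityˡ _)))
        ... | no p∤u = solved (inverse-mod (Coprimality.sym (prime-coprime prime p∤u)) p∤1)
          where
          solved : (∃₂ λ u′ t → u * u′ ≡ 1 + t * p) → ∃₂ λ s l → ω ≈ z ↑ s ∙ x₀ ↑ l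
          solved (u′ , t , uu′) = u′ * i , r * i + j , (begin
            ω ≈⟨ ω≈ ⟩
            y₀ ↑ i ∙ x₀ ↑ j ≈⟨ ∙-congʳ (↑-cong i y₀≈) ⟩
            (z ↑ u′ ∙ x₀ ↑ r) ↑ i ∙ x₀ ↑ j ≈⟨ ∙-congʳ (∙-↑ i (Ω-abelian (Ω-↑ u′ Ωc) (Ω-↑ r Ω-x₀))) ⟩
            (z ↑ u′ ↑ i ∙ x₀ ↑ r ↑ i) ∙ x₀ ↑ j ≡⟨ assoc _ _ _ ⟩
            z ↑ u′ ↑ i ∙ (x₀ ↑ r ↑ i ∙ x₀ ↑ j) ≡⟨ cong₂ _∙_ (↑-* z u′ i) (trans (↑-+ x₀ (r * i) j) (cong (_∙ x₀ ↑ j) (↑-* x₀ r i))) ⟨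
            z ↑ (u′ * i) ∙ x₀ ↑ (r * i + j) ∎)
            where
            r : ℕ
            r = (p ∸ 1) * (v * u′)
            y₀≈ : y₀ ≈ z ↑ u′ ∙ x₀ ↑ r
            y₀≈ = begin
              y₀ ≡⟨ trans (cong (_∙ ε) (identityʳ y₀)) (identityʳ y₀) ⟨
              y₀ ↑ 1 ∙ ε ≈⟨ ∙-congˡ (y₀-↑ε (n∣m*n t)) ⟨
              y₀ ↑ 1 ∙ y₀ ↑ (t * p) ≡⟨ ↑-+ y₀ 1 (t * p) ⟨
              y₀ ↑ (1 + t * p) ≡⟨ trans (cong (y₀ ↑_) (sym uu′)) (↑-* y₀ u u′) ⟩
              y₀ ↑ u ↑ u′ ≡⟨ solve 2 (λ a b → a ⊜ (a ⊕ b) ⊕ b ⁻) refl (y₀ ↑ u ↑ u′) (x₀ ↑ v ↑ u′) ⟩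
              (y₀ ↑ u ↑ u′ ∙ x₀ ↑ v ↑ u′) ∙ (x₀ ↑ v ↑ u′) ⁻¹ ≈⟨ ∙-congʳ (∙-↑ u′ (Ω-abelian (Ω-↑ u Ω-y₀) (Ω-↑ v Ω-x₀))) ⟨
              (y₀ ↑ u ∙ x₀ ↑ v) ↑ u′ ∙ (x₀ ↑ v ↑ u′) ⁻¹ ≈⟨ ∙-cong (↑-cong u′ (≈-sym z≈)) (≡⇒≈ (cong _⁻¹ (sym (↑-* x₀ v u′)))) ⟩
              z ↑ u′ ∙ (x₀ ↑ (v * u′)) ⁻¹ ≈⟨ ∙-congˡ (↑⁻¹ p>0 x₀-order (v * u′)) ⟩
              z ↑ u′ ∙ x₀ ↑ r ∎

      -- a commutes with τ and τ inverts c, so the x₀-component of ω is inverted by cᵏ, hence trivial.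
      rigid : ∀ {ω} k → Ω ω → conj a c ≡ ω ∙ c ↑ k → ∃ λ k′ → conj a c ≈ c ↑ k′
      rigid {ω} k Ωω eq = go (Ω-basis Ωω)
        where
        open ≈-Reasoning
        inverted : conj τ (conj a c) ≡ (conj a c) ⁻¹
        inverted = trans (conj-conj a τ c) (trans (cong (λ g → conj g c) (↑-suc a (p ^ e * half)))
          (trans (sym (conj-conj τ a c)) (trans (cong (conj a) conj-τ-c) (conj-⁻¹ a c))))
        go : (∃₂ λ s l → ω ≈ z ↑ s ∙ x₀ ↑ l) → ∃ λ k′ → conj a c ≈ c ↑ k′
        go (s , l , ω≈) = m * s + k , (begin
          conj a c ≡⟨ eq ⟩
          ω ∙ c ↑ k ≈⟨ ∙-congʳ ω≈ ⟩
          (z ↑ s ∙ x₀ ↑ l) ∙ c ↑ k ≈⟨ ∙-congʳ (∙-congˡ (x₀-↑ε (x₀-not-central {l} (x₀-flip k (¬p∣k k (Ω⇒fix Ωω) eq) (Ω-↑ l Ω-x₀) flip)))) ⟩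
          (z ↑ s ∙ ε) ∙ c ↑ k ≡⟨ cong (_∙ c ↑ k) (trans (identityʳ _) (sym (↑-* c m s))) ⟩
          c ↑ (m * s) ∙ c ↑ k ≡⟨ ↑-+ c (m * s) k ⟨
          c ↑ (m * s + k) ∎)
          where
          X Z C′ : D
          X = x₀ ↑ l
          Z = z ↑ s
          C′ = c ↑ k
          Z-C′ : Commute C′ Z
          Z-C′ = ≈-sym (≈-trans (∙-congʳ (≡⇒≈ (sym (↑-* c m s)))) (≈-trans (≡⇒≈ (↑-comm c (m * s) k)) (∙-congˡ (≡⇒≈ (↑-* c m s)))))
          Z-X : Commute Z X
          Z-X = Ω-abelian (Ω-↑ s Ωc) (Ω-↑ l Ω-x₀)
          conj-τ-Z : conj τ Z ≡ Z ⁻¹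
          conj-τ-Z = trans (conj-↑ τ z s) (trans (cong (_↑ s) conj-τ-z) (sym (⁻¹-↑ z s)))
          conj-τ-X : conj τ X ≡ X
          conj-τ-X = trans (conj-↑ τ x₀ l) (cong (_↑ l) conj-τ-x₀)
          conj-τ-C′ : conj τ C′ ≡ C′ ⁻¹
          conj-τ-C′ = trans (conj-↑ τ c k) (trans (cong (_↑ k) conj-τ-c) (sym (⁻¹-↑ c k)))
          both : (Z ⁻¹ ∙ X) ∙ C′ ⁻¹ ≈ C′ ⁻¹ ∙ (X ⁻¹ ∙ Z ⁻¹)
          both = begin
            (Z ⁻¹ ∙ X) ∙ C′ ⁻¹ ≡⟨ cong₂ _∙_ (cong₂ _∙_ conj-τ-Z conj-τ-X) conj-τ-C′ ⟨
            (conj τ Z ∙ conj τ X) ∙ conj τ C′ ≡⟨ cong (_∙ conj τ C′) (conj-∙ τ Z X) ⟨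
            conj τ (Z ∙ X) ∙ conj τ C′ ≡⟨ conj-∙ τ (Z ∙ X) C′ ⟨
            conj τ ((Z ∙ X) ∙ C′) ≈⟨ conj-cong τ (≈-trans (∙-congʳ (≈-sym ω≈)) (≡⇒≈ (sym eq))) ⟩
            conj τ (conj a c) ≡⟨ inverted ⟩
            (conj a c) ⁻¹ ≈⟨ ⁻¹-cong (≈-trans (≡⇒≈ eq) (∙-congʳ ω≈)) ⟩
            ((Z ∙ X) ∙ C′) ⁻¹ ≡⟨ solve 3 (λ z x c → ((z ⊕ x) ⊕ c) ⁻ ⊜ c ⁻ ⊕ (x ⁻ ⊕ z ⁻)) refl Z X C′ ⟩
            C′ ⁻¹ ∙ (X ⁻¹ ∙ Z ⁻¹) ∎
          -- Z commutes with X and with C′, so it cancels from `both` and leaves a relation for the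
          -- x₀-part alone.
          swap : X ∙ C′ ⁻¹ ≈ C′ ⁻¹ ∙ X ⁻¹
          swap = cancelʳ (Z ⁻¹) (begin
            (X ∙ C′ ⁻¹) ∙ Z ⁻¹ ≈⟨ commute-⁻¹ (≈-sym (commute-∙ Z-X (commute-⁻¹ (≈-sym Z-C′)))) ⟩
            Z ⁻¹ ∙ (X ∙ C′ ⁻¹) ≡⟨ assoc (Z ⁻¹) X (C′ ⁻¹) ⟨
            (Z ⁻¹ ∙ X) ∙ C′ ⁻¹ ≈⟨ both ⟩
            C′ ⁻¹ ∙ (X ⁻¹ ∙ Z ⁻¹) ≡⟨ assoc (C′ ⁻¹) (X ⁻¹) (Z ⁻¹) ⟨
            (C′ ⁻¹ ∙ X ⁻¹) ∙ Z ⁻¹ ∎)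
          flip : conj C′ X ≈ X ⁻¹
          flip = cancelˡ C′ (begin
            C′ ∙ conj C′ X ≡⟨ solve 2 (λ x c → c ⊕ (c ⁻ ⊕ (x ⊕ c)) ⊜ (c ⁻ ⊕ x ⁻) ⁻) refl X C′ ⟩
            (C′ ⁻¹ ∙ X ⁻¹) ⁻¹ ≈⟨ ⁻¹-cong swap ⟨
            (X ∙ C′ ⁻¹) ⁻¹ ≡⟨ solve 2 (λ x c → (x ⊕ c ⁻) ⁻ ⊜ c ⊕ x ⁻) refl X C′ ⟩
            C′ ∙ X ⁻¹ ∎)

module Induction {D : Set} {𝔾 : GroupOn D} {d e : ℕ} (Γ : Geometry 𝔾 d e) (π : OddPrime d) where

  open OddPrime π
  open GroupTheory 𝔾
  open Geometry Γ
  open Blocks Γ π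
  open Translation Γ π
  open Layers Γ π
  open Descent Γ π

  module Split {f : ℕ} (L : Layer (suc f)) where

    open NextLayer Γ π L
    open Step L
    open Layer L
    open Modulo C
    open Norms 𝔾 C
    module QM = Metacyclic 𝔾 Ω-C

    Ω-norm-∙ : ∀ g {ω ω′} n → Ω ω → Ω ω′ → norm g (ω ∙ ω′) n ≈ norm g ω n ∙ norm g ω′ n
    Ω-norm-∙ = norm-∙ Ω Ω-ε Ω-∙ Ω-conj Ω-abelian

    -- The norm of x₀ under cᵘ is fixed by c and by τ, hence by b = τc; but b swaps x₀ and y₀ = x₀ᶜ.
    norm-x₀ : ∀ u → ¬ (p ∣ u) → c ↑ u ↑ p ≈ ε → norm (c ↑ u) x₀ p ≈ ε
    norm-x₀ u p∤u order = go ΩN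
      where
      open ≈-Reasoning
      g N : D
      g = c ↑ u
      N = norm g x₀ p
      ΩN : Ω N
      ΩN = norm-∈ Ω Ω-ε Ω-∙ Ω-conj Ω-abelian g p Ω-x₀
      N-g : Commute N g
      N-g = norm-fixed Ω Ω-ε Ω-∙ Ω-conj Ω-abelian g p Ω-x₀ order
      N-c : Commute N c
      N-c = commute-descends u p∤u ΩN N-g
      g⁻ᵖ : (g ⁻¹) ↑ p ≈ ε
      g⁻ᵖ = ≈-trans (≡⇒≈ (sym (⁻¹-↑ g p))) (≈-trans (⁻¹-cong order) (≡⇒≈ ε⁻¹≈ε))
      -- τ inverts g and fixes x₀, so it turns N into the norm under g⁻¹, which has the same factors
      -- because gᵖ = 1.
      N-τ : conj τ N ≈ N
      N-τ = begin
        conj τ N ≡⟨ norm-conj τ g x₀ p ⟩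
        norm (conj τ g) (conj τ x₀) p ≡⟨ cong₂ (λ h w → norm h w p) (trans (conj-↑ τ c u) (trans (cong (_↑ u) conj-τ-c) (sym (⁻¹-↑ c u)))) conj-τ-x₀ ⟩
        norm (g ⁻¹) x₀ p ≡⟨ conj-by-ε _ ⟨
        conj ε (norm (g ⁻¹) x₀ p) ≈⟨ conj-cong₂ g⁻ᵖ ≈-refl ⟨
        conj ((g ⁻¹) ↑ p) (norm (g ⁻¹) x₀ p) ≈⟨ norm-reverse Ω Ω-ε Ω-∙ Ω-conj Ω-abelian g p Ω-x₀ ⟩
        conj (g ⁻¹) N ≈⟨ commute⇒conj (commute-⁻¹ N-g) ⟩
        N ∎
      N-b : conj b N ≈ N
      N-b = begin
        conj b N ≡⟨ cong (λ h → conj h N) b≡τc ⟩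
        conj (τ ∙ c) N ≡⟨ conj-conj τ c N ⟨
        conj c (conj τ N) ≈⟨ conj-cong c N-τ ⟩
        conj c N ≈⟨ commute⇒conj N-c ⟩
        N ∎
      go : Ω N → N ≈ ε
      go (i , j , N≈) = begin
        N ≈⟨ diagonal ⟩
        y₀ ↑ j ∙ x₀ ↑ j ≈⟨ ∙-cong (y₀-↑ε p∣j) (x₀-↑ε p∣j) ⟩
        ε ∙ ε ≡⟨ identityʳ ε ⟩
        ε ∎
        where
        swapped : y₀ ↑ i ∙ x₀ ↑ j ≈ y₀ ↑ j ∙ x₀ ↑ i
        swapped = begin
          y₀ ↑ i ∙ x₀ ↑ j ≈⟨ N≈ ⟨
          N ≈⟨ N-b ⟨
          conj b N ≈⟨ conj-cong b N≈ ⟩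
          conj b (y₀ ↑ i ∙ x₀ ↑ j) ≡⟨ conj-∙ b _ _ ⟩
          conj b (y₀ ↑ i) ∙ conj b (x₀ ↑ j) ≡⟨ cong₂ _∙_ (conj-↑ b y₀ i) (conj-↑ b x₀ j) ⟩
          conj b y₀ ↑ i ∙ conj b x₀ ↑ j ≡⟨ cong₂ (λ v w → v ↑ i ∙ w ↑ j) conj-y₀ conj-x₀ ⟩
          x₀ ↑ i ∙ y₀ ↑ j ≈⟨ Ω-abelian (Ω-↑ i Ω-x₀) (Ω-↑ j Ω-y₀) ⟩
          y₀ ↑ j ∙ x₀ ↑ i ∎
        p∣ : p ∣ (p ∸ 1) * j + i
        p∣ = proj₁ (y₀x₀-independent ((p ∸ 1) * j + i) (j + (p ∸ 1) * i) (begin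
          y₀ ↑ ((p ∸ 1) * j + i) ∙ x₀ ↑ (j + (p ∸ 1) * i) ≡⟨ cong₂ _∙_ (↑-+ y₀ ((p ∸ 1) * j) i) (↑-+ x₀ j ((p ∸ 1) * i)) ⟩
          (y₀ ↑ ((p ∸ 1) * j) ∙ y₀ ↑ i) ∙ (x₀ ↑ j ∙ x₀ ↑ ((p ∸ 1) * i)) ≈⟨ ∙-cong (∙-congʳ (≈-sym (↑⁻¹ p>0 y₀-order j))) (∙-congˡ (≈-sym (↑⁻¹ p>0 x₀-order i))) ⟩
          ((y₀ ↑ j) ⁻¹ ∙ y₀ ↑ i) ∙ (x₀ ↑ j ∙ (x₀ ↑ i) ⁻¹) ≡⟨ solve 4 (λ r s t v → (r ⁻ ⊕ s) ⊕ (t ⊕ v ⁻) ⊜ r ⁻ ⊕ ((s ⊕ t) ⊕ v ⁻)) refl (y₀ ↑ j) (y₀ ↑ i) (x₀ ↑ j) (x₀ ↑ i) ⟩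
          (y₀ ↑ j) ⁻¹ ∙ ((y₀ ↑ i ∙ x₀ ↑ j) ∙ (x₀ ↑ i) ⁻¹) ≈⟨ ∙-congˡ (∙-congʳ swapped) ⟩
          (y₀ ↑ j) ⁻¹ ∙ ((y₀ ↑ j ∙ x₀ ↑ i) ∙ (x₀ ↑ i) ⁻¹) ≡⟨ solve 2 (λ r v → r ⁻ ⊕ ((r ⊕ v) ⊕ v ⁻) ⊜ :ε) refl (y₀ ↑ j) (x₀ ↑ i) ⟩
          ε ∎))
        y-ij : y₀ ↑ i ≈ y₀ ↑ j
        y-ij = begin
          y₀ ↑ i ≡⟨ solve 2 (λ r s → s ⊜ r ⊕ (r ⁻ ⊕ s)) refl (y₀ ↑ j) (y₀ ↑ i) ⟩
          y₀ ↑ j ∙ ((y₀ ↑ j) ⁻¹ ∙ y₀ ↑ i) ≈⟨ ∙-congˡ (∙-congʳ (↑⁻¹ p>0 y₀-order j)) ⟩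
          y₀ ↑ j ∙ (y₀ ↑ ((p ∸ 1) * j) ∙ y₀ ↑ i) ≡⟨ cong (y₀ ↑ j ∙_) (↑-+ y₀ ((p ∸ 1) * j) i) ⟨
          y₀ ↑ j ∙ y₀ ↑ ((p ∸ 1) * j + i) ≈⟨ ∙-congˡ (y₀-↑ε p∣) ⟩
          y₀ ↑ j ∙ ε ≡⟨ identityʳ _ ⟩
          y₀ ↑ j ∎
        diagonal : N ≈ y₀ ↑ j ∙ x₀ ↑ j
        diagonal = ≈-trans N≈ (∙-congʳ y-ij)
        conj-c-y : conj c (y₀ ↑ j) ≈ x₀ ↑ j
        conj-c-y = cancelʳ (y₀ ↑ j) (begin
          conj c (y₀ ↑ j) ∙ y₀ ↑ j ≡⟨ cong (λ w → conj c (y₀ ↑ j) ∙ w ↑ j) conj-c-x₀ ⟨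
          conj c (y₀ ↑ j) ∙ conj c x₀ ↑ j ≡⟨ cong (conj c (y₀ ↑ j) ∙_) (conj-↑ c x₀ j) ⟨
          conj c (y₀ ↑ j) ∙ conj c (x₀ ↑ j) ≡⟨ conj-∙ c _ _ ⟨
          conj c (y₀ ↑ j ∙ x₀ ↑ j) ≈⟨ conj-cong c diagonal ⟨
          conj c N ≈⟨ commute⇒conj N-c ⟩
          N ≈⟨ diagonal ⟩
          y₀ ↑ j ∙ x₀ ↑ j ≈⟨ Ω-abelian (Ω-↑ j Ω-y₀) (Ω-↑ j Ω-x₀) ⟩
          x₀ ↑ j ∙ y₀ ↑ j ∎)
        -- c fixes N = y₀ʲx₀ʲ and sends x₀ʲ to y₀ʲ, so it sends y₀ʲ back to x₀ʲ. Thus c² fixes x₀ʲ,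
        -- and 2 is prime to p.
        p∣j : p ∣ j
        p∣j = x₀-not-central {j} (commute-descends 2 p∤2 (Ω-↑ j Ω-x₀) (conj⇒commute (begin
          conj (c ↑ 2) (x₀ ↑ j) ≡⟨ cong (λ h → conj (c ∙ h) (x₀ ↑ j)) (identityʳ c) ⟩
          conj (c ∙ c) (x₀ ↑ j) ≡⟨ conj-conj c c (x₀ ↑ j) ⟨
          conj c (conj c (x₀ ↑ j)) ≡⟨ cong (conj c) (trans (conj-↑ c x₀ j) (cong (_↑ j) conj-c-x₀)) ⟩
          conj c (y₀ ↑ j) ≈⟨ conj-c-y ⟩
          x₀ ↑ j ∎)))

    -- The norm is multiplicative on Ω, and since c commutes with cᵘ the norm of y₀ = x₀ᶜ is the
    -- c-conjugate of the norm of x₀.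
    norm-trivial : ∀ u → ¬ (p ∣ u) → c ↑ u ↑ p ≈ ε → ∀ {ω} → Ω ω → norm (c ↑ u) ω p ≈ ε
    norm-trivial u p∤u order {ω} (i , j , ω≈) = begin
      norm g ω p ≈⟨ norm-cong g p ω≈ ⟩
      norm g (y₀ ↑ i ∙ x₀ ↑ j) p ≈⟨ Ω-norm-∙ g p (Ω-↑ i Ω-y₀) (Ω-↑ j Ω-x₀) ⟩
      norm g (y₀ ↑ i) p ∙ norm g (x₀ ↑ j) p ≈⟨ ∙-cong (power i Ω-y₀ norm-y₀) (power j Ω-x₀ (norm-x₀ u p∤u order)) ⟩
      ε ∙ ε ≡⟨ identityʳ ε ⟩
      ε ∎
      where
      open ≈-Reasoning
      g : D
      g = c ↑ u
      conj-c-g : conj c g ≡ g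
      conj-c-g = trans (conj-↑ c c u) (cong (_↑ u) (solve 1 (λ c → c ⁻ ⊕ (c ⊕ c) ⊜ c) refl c))
      norm-y₀ : norm g y₀ p ≈ ε
      norm-y₀ = begin
        norm g y₀ p ≡⟨ cong₂ (λ h w → norm h w p) conj-c-g conj-c-x₀ ⟨
        norm (conj c g) (conj c x₀) p ≡⟨ norm-conj c g x₀ p ⟨
        conj c (norm g x₀ p) ≈⟨ conj-cong c (norm-x₀ u p∤u order) ⟩
        conj c ε ≡⟨ conj-ε c ⟩
        ε ∎
      norm-ε : ∀ n → norm g ε n ≈ ε
      norm-ε zero = ≈-refl
      norm-ε (suc n) = ≈-trans (≡⇒≈ (identityˡ _)) (≈-trans (conj-cong (g ⁻¹) (norm-ε n)) (≡⇒≈ (conj-ε _)))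
      power : ∀ {w} i → Ω w → norm g w p ≈ ε → norm g (w ↑ i) p ≈ ε
      power zero Ωw eq = norm-ε p
      power (suc i) Ωw eq = ≈-trans (Ω-norm-∙ g p Ωw (Ω-↑ i Ωw)) (≈-trans (∙-cong eq (power i Ωw eq)) (≡⇒≈ (identityʳ ε)))

    -- The norm vanishes by `norm-trivial` if p does not divide u; otherwise cᵘ centralises Ω and
    -- the norm is ωᵖ.
    Ωc-exponent : ∀ {ω} u → Ω ω → c ↑ u ↑ p ≈ ε → (ω ∙ c ↑ u) ↑ p ≈ ε
    Ωc-exponent {ω} u Ωω order = ≈-trans (≡⇒≈ (norm-↑ (c ↑ u) ω p)) (≈-trans (∙-cong trivial order) (≡⇒≈ (identityʳ ε)))
      where
      trivial : norm (c ↑ u) ω p ≈ ε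
      trivial with p ∣? u
      ... | no p∤u = norm-trivial u p∤u order Ωω
      ... | yes p∣u = ≈-trans (norm-central Ω Ω-ε Ω-∙ Ω-conj Ω-abelian (c ↑ u) p Ωω (λ Ωh → Ω-commute Ωh (fix-c↑ u p∣u))) (Ω-exponent Ωω)

    module _ (k : ℕ) (act : conj a c Q.≈ c ↑ k) where

      open Factorisation Ω-C k act

      -- In g = aʲcⁱ the factor aʲ lies in the kernel, because modulo the kernel g is a power of c;
      -- so aʲ is a power of x.
      P-factored : ∀ {g} → InP g → ∃₂ λ j i → g Q.≈ x ↑ j ∙ c ↑ i
      P-factored {g} (i′ , g≈K) = go (factored g)
        where
        go : Factored g → ∃₂ λ j i → g Q.≈ x ↑ j ∙ c ↑ i
        go (j , i , eq) = rewrite-a (a-order′ (proj₁ (split-fix j (i + (p ∸ 1) * i′) (K-ε (begin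
            a ↑ j ∙ c ↑ (i + (p ∸ 1) * i′) ≡⟨ trans (cong (a ↑ j ∙_) (↑-+ c i ((p ∸ 1) * i′))) (sym (assoc (a ↑ j) (c ↑ i) _)) ⟩
            (a ↑ j ∙ c ↑ i) ∙ c ↑ ((p ∸ 1) * i′) ≈⟨ K.∙-cong (K.≈-trans (K.≈-sym (Ω⇒fix eq)) g≈K) (K.≈-sym (K.↑⁻¹ p>0 c-order i′)) ⟩
            c ↑ i′ ∙ (c ↑ i′) ⁻¹ ≡⟨ inverseʳ (c ↑ i′) ⟩
            ε ∎)))))
          where
          open K.≈-Reasoning
          c-order : c ↑ p K.≈ ε
          c-order = subst Fix (solve 1 (λ k → k ⊜ k ⊕ (:ε ⁻)) refl (c ↑ p)) (fix-c↑ p ∣-refl)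
          rewrite-a : (∃ λ j′ → a ↑ j ≡ x ↑ j′) → ∃₂ λ j i → g Q.≈ x ↑ j ∙ c ↑ i
          rewrite-a (j′ , aj) = j′ , i , Q.≈-trans eq (Q.≡⇒≈ (cong (_∙ c ↑ i) aj))

      -- x = aᵈ raises c to the power kᵈ, but it lies in the kernel and so centralises c modulo the
      -- kernel. To avoid subtraction the congruence is read off from kᵈ + d ≡ 0, as d ≡ -1 modulo
      -- p.
      k^d≡1 : ∃ λ t → k ^ d ≡ 1 + t * p
      k^d≡1 = go (c-period (k ^ d + d) (fix⇒∼ε (K-ε (begin
          c ↑ (k ^ d + d) ≡⟨ ↑-+ c (k ^ d) d ⟩
          c ↑ (k ^ d) ∙ c ↑ d ≈⟨ K.∙-congʳ (K.≈-sym (Ω⇒fix (QM.iterated-act k act d))) ⟩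
          conj x c ∙ c ↑ d ≈⟨ K.∙-congʳ conj-x-c ⟩
          c ∙ c ↑ d ≈⟨ c-order ⟩
          ε ∎))))
        where
        open K.≈-Reasoning
        c-order : c ↑ p K.≈ ε
        c-order = subst Fix (solve 1 (λ k → k ⊜ k ⊕ (:ε ⁻)) refl (c ↑ p)) (fix-c↑ p ∣-refl)
        conj-x-c : conj x c K.≈ c
        conj-x-c = subst Fix (solve 2 (λ x c → x ⁻ ⊕ ((c ⁻ ⁻) ⊕ (x ⊕ c ⁻)) ⊜ (x ⁻ ⊕ (c ⊕ x)) ⊕ c ⁻) refl x c)
          (fix-∙ (fix-⁻¹ fix-x) (fix-conj (c ⁻¹) fix-x))
        go : p ∣ k ^ d + d → ∃ λ t → k ^ d ≡ 1 + t * p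
        go (divides zero eq) = contradiction (ℕₚ.m+n≡0⇒n≡0 (k ^ d) eq) (ℕₚ.>⇒≢ d>0)
        go (divides (suc t) eq) = t , ℕₚ.+-cancelʳ-≡ d (k ^ d) (1 + t * p) (trans eq (arith t d))
          where
          arith : ∀ t d → suc t * suc d ≡ (1 + t * suc d) + d
          arith = solve-∀

      -- Powers of x raise c to exponents ≡ 1 modulo p. The geometric sum created by a p-th power
      -- thus has p terms ≡ 1 and is divisible by p, so each step adds a factor p to the exponent of
      -- c.
      powers : ∀ j i s → ∃ λ i′ → (x ↑ j ∙ c ↑ i) ↑ (p ^ s) Q.≈ x ↑ (j * p ^ s) ∙ c ↑ (p ^ s * i′)
      powers j i zero = i , Q.≡⇒≈ (trans (identityʳ _) (cong₂ (λ s t → x ↑ s ∙ c ↑ t) (sym (ℕₚ.*-identityʳ j)) (sym (ℕₚ.*-identityˡ i))))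
      powers j i (suc s) = go (powers j i s) k^d≡1
        where
        open Q.≈-Reasoning
        go : (∃ λ i′ → (x ↑ j ∙ c ↑ i) ↑ (p ^ s) Q.≈ x ↑ (j * p ^ s) ∙ c ↑ (p ^ s * i′)) → (∃ λ t → k ^ d ≡ 1 + t * p) →
             ∃ λ i′ → (x ↑ j ∙ c ↑ i) ↑ (p ^ suc s) Q.≈ x ↑ (j * p ^ suc s) ∙ c ↑ (p ^ suc s * i′)
        go (i′ , eq) (t , kd) = finish (power-1mod t p (j * p ^ s))
          where
          l : ℕ
          l = j * p ^ s
          finish : (∃ λ s → (1 + t * p) ^ l ≡ 1 + s * p) → ∃ λ i′ → (x ↑ j ∙ c ↑ i) ↑ (p ^ suc s) Q.≈ x ↑ (j * p ^ suc s) ∙ c ↑ (p ^ suc s * i′)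
          finish (v , kJ) = conclude (geo-1mod v p p)
            where
            act-l : conj (x ↑ l) c Q.≈ c ↑ (1 + v * p)
            act-l = Q.≈-trans (QM.iterated-act (k ^ d) (QM.iterated-act k act d) l) (Q.≡⇒≈ (cong (c ↑_) (trans (cong (_^ l) kd) kJ)))
            conclude : (∃ λ w → geo (1 + v * p) p ≡ p + w * p) → ∃ λ i′ → (x ↑ j ∙ c ↑ i) ↑ (p ^ suc s) Q.≈ x ↑ (j * p ^ suc s) ∙ c ↑ (p ^ suc s * i′)
            conclude (w , geo≡) = i′ * suc w , (begin
              (x ↑ j ∙ c ↑ i) ↑ (p ^ suc s) ≡⟨ trans (cong ((x ↑ j ∙ c ↑ i) ↑_) (ℕₚ.*-comm p (p ^ s))) (↑-* _ (p ^ s) p) ⟩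
              (x ↑ j ∙ c ↑ i) ↑ (p ^ s) ↑ p ≈⟨ Q.↑-cong p eq ⟩
              (x ↑ l ∙ c ↑ (p ^ s * i′)) ↑ p ≈⟨ QM.collect (1 + v * p) act-l (p ^ s * i′) p ⟩
              x ↑ l ↑ p ∙ c ↑ (p ^ s * i′ * geo (1 + v * p) p) ≡⟨ cong₂ _∙_ (trans (sym (↑-* x l p)) (cong (x ↑_) (arith₁ j (p ^ s) p)))
                                                                                  (cong (c ↑_) (trans (cong (p ^ s * i′ *_) geo≡) (arith₂ (p ^ s) i′ p w))) ⟩
              x ↑ (j * p ^ suc s) ∙ c ↑ (p ^ suc s * (i′ * suc w)) ∎)
              where
              arith₁ : ∀ j r p → j * r * p ≡ j * (p * r)
              arith₁ = solve-∀
              arith₂ : ∀ r i p w → r * i * (p + w * p) ≡ p * r * (i * suc w)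
              arith₂ = solve-∀

      -- Modulo Ω the x-part of g^(pᶠ) vanishes and the rest is a power of c^(pᶠ); `Ωc-exponent`
      -- then handles the last p-th power.
      P-exponent : c ↑ m ≈ ε → ∀ g → InP g → g ↑ m ≈ ε
      P-exponent cm g gP = go (P-factored gP)
        where
        go : (∃₂ λ j i → g Q.≈ x ↑ j ∙ c ↑ i) → g ↑ m ≈ ε
        go (j , i , eq) = finish (powers j i f)
          where
          finish : (∃ λ i′ → (x ↑ j ∙ c ↑ i) ↑ (p ^ f) Q.≈ x ↑ (j * p ^ f) ∙ c ↑ (p ^ f * i′)) → g ↑ m ≈ ε
          finish (i′ , eq′) = conclude (≈Ω⇒ {g ↑ (p ^ f)} {c ↑ (p ^ f * i′)} (begin
              g ↑ (p ^ f) ≈⟨ Q.↑-cong (p ^ f) eq ⟩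
              (x ↑ j ∙ c ↑ i) ↑ (p ^ f) ≈⟨ eq′ ⟩
              x ↑ (j * p ^ f) ∙ c ↑ (p ^ f * i′) ≈⟨ Q.∙-congʳ (Q.↑-∣ {x} {p ^ f} {j * p ^ f} (Ω-ε⁺ Ω-x₀) (n∣m*n j)) ⟩
              ε ∙ c ↑ (p ^ f * i′) ≡⟨ identityˡ _ ⟩
              c ↑ (p ^ f * i′) ∎))
            where
            open Q.≈-Reasoning
            conclude : (∃ λ ω → Ω ω × g ↑ (p ^ f) ≡ ω ∙ c ↑ (p ^ f * i′)) → g ↑ m ≈ ε
            conclude (ω , Ωω , g≡) = ≈-trans (≡⇒≈ (trans (cong (g ↑_) (ℕₚ.*-comm p (p ^ f))) (trans (↑-* g (p ^ f) p) (cong (_↑ p) g≡))))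
              (Ωc-exponent (p ^ f * i′) Ωω (≈-trans (≡⇒≈ (sym (↑-* c (p ^ f * i′) p)))
                (↑-∣ {c} {m} {p ^ f * i′ * p} cm (divides i′ (arith (p ^ f) i′ p)))))
              where
              arith : ∀ r i p → r * i * p ≡ i * (p * r)
              arith = solve-∀

  -- The form of the exponent hypothesis that passes to the next layer: if pᶠ killed `InP` modulo Ω,
  -- then pᶠ⁺¹ would kill it outright, Ω having exponent p.
  Exceeds : ∀ {f} → Layer f → Set
  Exceeds {f} L = ¬ (∀ g → InP g → g ↑ (p ^ f) ≈ ε)
    where open Congruence (Layer.C L)

  cyclic : ∀ {f} (L : Layer f) → Exceeds L → CyclicMod L
  cyclic {zero} L _ = base L
  cyclic {suc f} L exceeds = extend (cyclic next λ all → exceeds λ g gP →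
      ≈-trans (≡⇒≈ (trans (cong (g ↑_) (ℕₚ.*-comm p (p ^ f))) (↑-* g (p ^ f) p))) (Ω-exponent (Ω-ε⁻ (all g gP))))
    where
    open NextLayer Γ π L
    open Step L
    open Split L
    open Layer L
    open Modulo C
    extend : CyclicMod next → CyclicMod L
    extend R with (c ↑ m) ≈? ε
    ... | yes cm = contradiction (P-exponent (CyclicMod.k R) (CyclicMod.action R) cm) exceeds
    ... | no c≉ = lift (≈Ω⇒ {conj a c} {c ↑ CyclicMod.k R} (CyclicMod.action R))
      where
      Ωcm : Ω (c ↑ m)
      Ωcm = Ω-ε⁻ (CyclicMod.exponent R)
      open NonSplit c≉ Ωcm
      lift : (∃ λ ω → Ω ω × conj a c ≡ ω ∙ c ↑ CyclicMod.k R) → CyclicMod L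
      lift (ω , Ωω , eq) = build (rigid (CyclicMod.k R) Ωω eq)
        where
        build : (∃ λ k′ → conj a c ≈ c ↑ k′) → CyclicMod L
        build (k′ , act) = record
          { k = k′
          ; action = act
          ; exponent = ≈-trans (≡⇒≈ (trans (cong (c ↑_) (ℕₚ.*-comm p m)) (↑-* c m p))) (Ω-exponent Ωcm)
          ; exact = c≉ }

bijection-size : ∀ {m n} (f : Fin m → Fin n) → (∀ {i j} → f i ≡ f j → i ≡ j) → (∀ y → ∃ λ x → f x ≡ y) → m ≡ n
bijection-size f inj onto = ℕₚ.≤-antisym (Finₚ.injective⇒≤ inj)
  (Finₚ.injective⇒≤ {f = λ y → proj₁ (onto y)} (λ {y} {y′} eq → trans (sym (proj₂ (onto y))) (trans (cong f eq) (proj₂ (onto y′)))))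

-- From maps to groups

-- Recovers the iteration hidden inside SameVertex.
module _ {D : Set} (M : MapData D) where

  R^ : ℕ → D → D
  R^ zero g = g
  R^ (suc k) g = R M (R^ k g)

  iterates-agree : ∀ {g} (f : ℕ → D) → f 0 ≡ g → (∀ k → f (suc k) ≡ R M (f k)) → ∀ k → f k ≡ R^ k g
  iterates-agree f base step zero = base
  iterates-agree f base step (suc k) = trans (step k) (cong (R M) (iterates-agree f base step k))

  from-iterates : ∀ {g h} (f : ℕ → D) → f 0 ≡ g → (∀ k → f (suc k) ≡ R M (f k)) → (∃ λ k → f k ≡ h) → ∃ λ k → R^ k g ≡ h
  from-iterates f base step (k , eq) = k , trans (sym (iterates-agree f base step k)) eq

  to-iterates : ∀ {g h} (f : ℕ → D) → f 0 ≡ g → (∀ k → f (suc k) ≡ R M (f k)) → (∃ λ k → R^ k g ≡ h) → ∃ λ k → f k ≡ h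
  to-iterates f base step (k , eq) = k , trans (iterates-agree f base step k) eq

  sameVertex⇒ : ∀ g h → SameVertex M g h → ∃ λ k → R^ k g ≡ h
  sameVertex⇒ g h s = from-iterates _ refl (λ k → refl) s

  ⇒sameVertex : ∀ g h → (∃ λ k → R^ k g ≡ h) → SameVertex M g h
  ⇒sameVertex g h s = to-iterates _ refl (λ k → refl) s

-- Sending an automorphism f to the dart f d₀ makes the darts a group in which R and L are
-- left multiplications.
module DartGroup {N : ℕ} (M : MapData (Fin N)) (orientable : IsOrientableMap M)
                 (transitive : ∀ g h → Σ (Aut M) λ f → fun f g ≡ h)
                 (rigid : ∀ (f : Aut M) g → fun f g ≡ g → f ≈ᴬ idᴬ)
                 (d₀ : Fin N) where

  open IsOrientableMap orientable

  D : Set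
  D = Fin N

  α : D → Aut M
  α g = proj₁ (transitive d₀ g)

  α-d₀ : ∀ g → fun (α g) d₀ ≡ g
  α-d₀ g = proj₂ (transitive d₀ g)

  aut-unique : ∀ (f f′ : Aut M) → fun f d₀ ≡ fun f′ d₀ → f ≈ᴬ f′
  aut-unique f f′ eq g = trans (sym (fun-inv f′ (fun f g)))
    (cong (fun f′) (rigid ((f′ ⁻¹ᴬ) ∘ᴬ f) d₀ (trans (cong (inv f′) eq) (inv-fun f′ d₀)) g))

  -- With this order of factors every automorphism becomes a right multiplication, as `aut-left`
  -- records.
  𝔾 : GroupOn D
  𝔾 = record
    { _∙_ = λ g h → fun (α h) g
    ; ε = d₀
    ; _⁻¹ = λ g → inv (α g) d₀
    ; isGroup = record
      { isMonoid = record
        { isSemigroup = record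
          { isMagma = record { isEquivalence = isEquivalence ; ∙-cong = cong₂ (λ g h → fun (α h) g) }
          ; assoc = λ g h k → aut-unique (α k ∘ᴬ α h) (α (fun (α k) h))
              (trans (cong (fun (α k)) (α-d₀ h)) (sym (α-d₀ _))) g }
        ; identity = α-d₀ , λ g → rigid (α d₀) d₀ (α-d₀ d₀) g }
      ; inverse = (λ g → fun-inv (α g) d₀) , λ g →
          trans (aut-unique (α (inv (α g) d₀)) (α g ⁻¹ᴬ) (α-d₀ _) g)
            (trans (cong (inv (α g)) (sym (α-d₀ g))) (inv-fun (α g) d₀))
      ; ⁻¹-cong = cong (λ g → inv (α g) d₀) } }

  open GroupTheory 𝔾

  a b : D
  a = R M d₀
  b = L M d₀

  R-left : ∀ g → R M g ≡ a ∙ g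
  R-left g = trans (cong (R M) (sym (α-d₀ g))) (sym (fun-R (α g) d₀))

  L-left : ∀ g → L M g ≡ b ∙ g
  L-left g = trans (cong (L M) (sym (α-d₀ g))) (sym (fun-L (α g) d₀))

  b∙b : b ∙ b ≡ ε
  b∙b = trans (sym (L-left b)) (L-invol d₀)

  R^-left : ∀ k g → R^ M k g ≡ a ↑ k ∙ g
  R^-left zero g = sym (identityˡ g)
  R^-left (suc k) g = trans (R-left _) (trans (cong (a ∙_) (R^-left k g)) (sym (assoc a (a ↑ k) g)))

  aut-left : ∀ (f : Aut M) g → fun f g ≡ g ∙ fun f d₀
  aut-left f = aut-unique f (α (fun f d₀)) (sym (α-d₀ _))

  aut-power : ∀ (f : Aut M) k → fun (f ^ᴬ k) d₀ ≡ fun f d₀ ↑ k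
  aut-power f zero = refl
  aut-power f (suc k) = trans (cong (fun f) (aut-power f k)) (trans (aut-left f _) (sym (↑-suc (fun f d₀) k)))

  aut-power-trivial : ∀ (f : Aut M) k → (f ^ᴬ k) ≈ᴬ idᴬ → fun f d₀ ↑ k ≡ ε
  aut-power-trivial f k eq = trans (sym (aut-power f k)) (eq d₀)

  trivial-aut-power : ∀ (f : Aut M) k → fun f d₀ ↑ k ≡ ε → (f ^ᴬ k) ≈ᴬ idᴬ
  trivial-aut-power f k eq = rigid (f ^ᴬ k) d₀ (trans (aut-power f k) eq)

module MultipartiteMap {N : ℕ} (M : MapData (Fin N)) (orientable : IsOrientableMap M)
  (transitive : ∀ g h → Σ (Aut M) λ f → fun f g ≡ h)
  (rigid : ∀ (f : Aut M) g → fun f g ≡ g → f ≈ᴬ idᴬ)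
  (d₀ : Fin N) (d e : ℕ)
  (φ : Fin N → Fin (suc d) × Fin (suc d ^ e))
  (φ-same : ∀ g h → φ g ≡ φ h → SameVertex M g h)
  (same-φ : ∀ g h → SameVertex M g h → φ g ≡ φ h)
  (φ-onto : ∀ v → ∃ λ g → φ g ≡ v)
  (φ-L : ∀ g → ¬ (proj₁ (φ g) ≡ proj₁ (φ (L M g))))
  (adjacent : ∀ v w → ¬ (proj₁ v ≡ proj₁ w) → ∃ λ g → (φ g ≡ v) × (φ (L M g) ≡ w))
  (simple : ∀ g h → φ g ≡ φ h → φ (L M g) ≡ φ (L M h) → g ≡ h) where

  open DartGroup M orientable transitive rigid d₀
  open GroupTheory 𝔾
  open Modulo ≡-congruence using (cancelʳ; ↑-mod; ↑-diff)

  p : ℕ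
  p = suc d

  β : D → Fin p
  β g = proj₁ (φ g)

  same-vertex : ∀ g h → φ g ≡ φ h → ∃ λ k → a ↑ k ∙ g ≡ h
  same-vertex g h eq = go (sameVertex⇒ M g h (φ-same g h eq))
    where
    go : (∃ λ k → R^ M k g ≡ h) → ∃ λ k → a ↑ k ∙ g ≡ h
    go (k , eq) = k , trans (sym (R^-left k g)) eq

  φ-a↑ : ∀ k g → φ (a ↑ k ∙ g) ≡ φ g
  φ-a↑ k g = sym (same-φ g (a ↑ k ∙ g) (⇒sameVertex M g (a ↑ k ∙ g) (k , R^-left k g)))

  φ-a : ∀ g → φ (a ∙ g) ≡ φ g
  φ-a g = trans (cong (λ h → φ (h ∙ g)) (sym (identityʳ a))) (φ-a↑ 1 g)

  β-b : ∀ g → β (b ∙ g) ≢ β g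
  β-b g eq = φ-L g (trans (sym eq) (cong β (sym (L-left g))))

  adjacent-b : ∀ g h → β g ≢ β h → ∃₂ λ i j → h ≡ a ↑ i ∙ (b ∙ (a ↑ j ∙ g))
  adjacent-b g h g≁h = go (adjacent (φ g) (φ h) g≁h)
    where
    go : (∃ λ k → (φ k ≡ φ g) × (φ (L M k) ≡ φ h)) → ∃₂ λ i j → h ≡ a ↑ i ∙ (b ∙ (a ↑ j ∙ g))
    go (k , eq , eq′) = finish (same-vertex g k (sym eq)) (same-vertex (b ∙ k) h (trans (cong φ (sym (L-left k))) eq′))
      where
      finish : (∃ λ j → a ↑ j ∙ g ≡ k) → (∃ λ i → a ↑ i ∙ (b ∙ k) ≡ h) → ∃₂ λ i j → h ≡ a ↑ i ∙ (b ∙ (a ↑ j ∙ g))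
      finish (j , eq) (i , eq′) = i , j , trans (sym eq′) (cong (λ k → a ↑ i ∙ (b ∙ k)) (sym eq))

  -- Vertices in different parts are joined by an edge, and automorphisms preserve edges: cancelling
  -- k from an edge joining gk and hk gives one joining g and h.
  β-right : ∀ {g h} k → β g ≡ β h → β (g ∙ k) ≡ β (h ∙ k)
  β-right {g} {h} k g∼h with β (g ∙ k) Finₚ.≟ β (h ∙ k)
  ... | yes eq = eq
  ... | no neq = ⊥-elim (go (adjacent-b (g ∙ k) (h ∙ k) neq))
    where
    go : (∃₂ λ i j → h ∙ k ≡ a ↑ i ∙ (b ∙ (a ↑ j ∙ (g ∙ k)))) → ⊥
    go (i , j , eq) = β-b (a ↑ j ∙ g) (trans (sym (cong proj₁ (φ-a↑ i _)))
      (trans (cong β (sym h≡)) (trans (sym g∼h) (sym (cong proj₁ (φ-a↑ j g))))))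
      where
      h≡ : h ≡ a ↑ i ∙ (b ∙ (a ↑ j ∙ g))
      h≡ = cancelʳ k (trans eq (solve 5 (λ u b v g k → u ⊕ (b ⊕ (v ⊕ (g ⊕ k))) ⊜ (u ⊕ (b ⊕ (v ⊕ g))) ⊕ k) refl (a ↑ i) b (a ↑ j) g k))

  cell : ∀ g → β g ≢ β ε → ∃₂ λ i j → g ≡ a ↑ i ∙ (b ∙ a ↑ j)
  cell g g≁ε = go (adjacent-b ε g (λ eq → g≁ε (sym eq)))
    where
    go : (∃₂ λ i j → g ≡ a ↑ i ∙ (b ∙ (a ↑ j ∙ ε))) → ∃₂ λ i j → g ≡ a ↑ i ∙ (b ∙ a ↑ j)
    go (i , j , eq) = i , j , trans eq (cong (λ u → a ↑ i ∙ (b ∙ u)) (identityʳ _))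

  φ-ε : ∀ j → φ (a ↑ j) ≡ φ ε
  φ-ε j = trans (cong φ (sym (identityʳ _))) (φ-a↑ j ε)

  -- The darts aⁱ and aʲ leave the same vertex, and the graph has no multiple edges.
  edge-unique : ∀ i j → φ (b ∙ a ↑ i) ≡ φ (b ∙ a ↑ j) → a ↑ i ≡ a ↑ j
  edge-unique i j eq = simple (a ↑ i) (a ↑ j) (trans (φ-ε i) (sym (φ-ε j)))
    (trans (cong φ (L-left _)) (trans eq (cong φ (sym (L-left _)))))

  cell-unique : ∀ i j → a ↑ i ∙ (b ∙ a ↑ j) ≡ b → a ↑ i ≡ ε × a ↑ j ≡ ε
  cell-unique i j eq = cancelʳ b (trans (cong (λ u → a ↑ i ∙ u) (sym (trans (cong (b ∙_) aj) (identityʳ b)))) (trans eq (sym (identityˡ b)))) , aj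
    where
    aj : a ↑ j ≡ ε
    aj = edge-unique j 0 (trans (sym (φ-a↑ i _)) (cong φ (trans eq (sym (identityʳ b)))))

  a-returns : ∃ λ T → 0 < T × a ↑ T ≡ ε
  a-returns = go (Finₚ.pigeonhole (ℕₚ.n<1+n N) (λ (i : Fin (suc N)) → a ↑ toℕ i))
    where
    go : (∃₂ λ (i j : Fin (suc N)) → toℕ i < toℕ j × a ↑ toℕ i ≡ a ↑ toℕ j) → ∃ λ T → 0 < T × a ↑ T ≡ ε
    go (i , j , i<j , eq) = toℕ j ∸ toℕ i , ℕₚ.m<n⇒0<n∸m i<j , ↑-diff (ℕₚ.<⇒≤ i<j) (sym eq)

  a-period : ∃ (IsPeriod (λ i → a ↑ i ≡ ε))
  a-period = go a-returns
    where
    go : (∃ λ T → 0 < T × a ↑ T ≡ ε) → ∃ (IsPeriod (λ i → a ↑ i ≡ ε))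
    go (T , T>0 , aT) = period (λ i → a ↑ i Finₚ.≟ ε)
      (λ m n Sm Sn → trans (↑-+ a m n) (trans (cong₂ _∙_ Sm Sn) (identityʳ ε)))
      (λ m n Smn Sm → trans (sym (identityˡ _)) (trans (cong (_∙ a ↑ n) (sym Sm)) (trans (sym (↑-+ a m n)) Smn))) T T>0 aT

  b-a↑≁ε : ∀ i → β ε ≢ β (b ∙ a ↑ i)
  b-a↑≁ε i eq = β-b (a ↑ i) (trans (sym eq) (sym (cong proj₁ (φ-ε i))))

  distinct-residues : ∀ {s} {i j : Fin s} → toℕ i < toℕ j → ¬ (s ∣ toℕ j ∸ toℕ i)
  distinct-residues {s} {i} {j} i<j s∣ = ℕₚ.<⇒≱ (ℕₚ.≤-<-trans (ℕₚ.m∸n≤m (toℕ j) (toℕ i)) (Finₚ.toℕ<n j))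
    (∣⇒≤ {{>-nonZero (ℕₚ.m<n⇒0<n∸m i<j)}} s∣)

  -- The darts aⁱ leaving the vertex of ε end at the vertices of baⁱ, which run once through the
  -- d·pᵉ vertices outside its part; `punchOut` drops that part from the index.
  order-a : ∀ o → IsPeriod (λ i → a ↑ i ≡ ε) o → o ≡ d * p ^ e
  order-a o (o>0 , o∣ , ∣o) = bijection-size index inj onto
    where
    instance
      o≢0 : NonZero o
      o≢0 = >-nonZero o>0
    index : Fin o → Fin (d * p ^ e)
    index i = combine (punchOut (b-a↑≁ε (toℕ i))) (proj₂ (φ (b ∙ a ↑ toℕ i)))
    coordinates : ∀ {i j} → index i ≡ index j → punchOut (b-a↑≁ε (toℕ i)) ≡ punchOut (b-a↑≁ε (toℕ j)) × proj₂ (φ (b ∙ a ↑ toℕ i)) ≡ proj₂ (φ (b ∙ a ↑ toℕ j))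
    coordinates {i} {j} = Finₚ.combine-injective (punchOut (b-a↑≁ε (toℕ i))) (proj₂ (φ (b ∙ a ↑ toℕ i))) (punchOut (b-a↑≁ε (toℕ j))) (proj₂ (φ (b ∙ a ↑ toℕ j)))
    vertex : ∀ {i j} → index i ≡ index j → a ↑ toℕ i ≡ a ↑ toℕ j
    vertex {i} {j} eq = edge-unique (toℕ i) (toℕ j) (cong₂ _,_
      (Finₚ.punchOut-injective (b-a↑≁ε (toℕ i)) (b-a↑≁ε (toℕ j)) (proj₁ (coordinates {i} {j} eq)))
      (proj₂ (coordinates {i} {j} eq)))
    inj : ∀ {i j} → index i ≡ index j → i ≡ j
    inj {i} {j} eq with ℕₚ.<-cmp (toℕ i) (toℕ j)
    ... | tri< i<j _ _ = contradiction (o∣ _ (↑-diff (ℕₚ.<⇒≤ i<j) (sym (vertex {i} {j} eq)))) (distinct-residues {o} {i} {j} i<j)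
    ... | tri≈ _ i≡j _ = Finₚ.toℕ-injective i≡j
    ... | tri> _ _ j<i = contradiction (o∣ _ (↑-diff (ℕₚ.<⇒≤ j<i) (vertex {i} {j} eq))) (distinct-residues {o} {j} {i} j<i)
    a-% : ∀ j → a ↑ toℕ (j mod o) ≡ a ↑ j
    a-% = ↑-mod {a} {o} (∣o o ∣-refl)
    onto : ∀ v → ∃ λ i → index i ≡ v
    onto v = hit (φ-onto (punchIn (β ε) s , t))
      where
      s : Fin d
      s = proj₁ (remQuot {d} (p ^ e) v)
      t : Fin (p ^ e)
      t = proj₂ (remQuot {d} (p ^ e) v)
      hit : (∃ λ g → φ g ≡ (punchIn (β ε) s , t)) → ∃ λ i → index i ≡ v
      hit (g , φg) = find (cell g (λ eq → Finₚ.punchInᵢ≢i (β ε) s (trans (sym (cong proj₁ φg)) eq)))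
        where
        find : (∃₂ λ i j → g ≡ a ↑ i ∙ (b ∙ a ↑ j)) → ∃ λ i → index i ≡ v
        find (i , j , g≡) = j mod o , trans (cong₂ combine
            (trans (Finₚ.punchOut-cong (β ε) {i≢k = λ eq → Finₚ.punchInᵢ≢i (β ε) s (sym eq)} (cong proj₁ φ≡)) (Finₚ.punchOut-punchIn (β ε)))
            (cong proj₂ φ≡))
          (Finₚ.combine-remQuot {d} (p ^ e) v)
          where
          φ≡ : φ (b ∙ a ↑ toℕ (j mod o)) ≡ (punchIn (β ε) s , t)
          φ≡ = trans (cong (λ u → φ (b ∙ u)) (a-% j)) (trans (sym (φ-a↑ i _)) (trans (cong φ (sym g≡)) φg))

  block-period : ∃ (IsPeriod (λ i → β (b ∙ a ↑ i) ≡ β b))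
  block-period = go a-returns
    where
    go : (∃ λ T → 0 < T × a ↑ T ≡ ε) → ∃ (IsPeriod (λ i → β (b ∙ a ↑ i) ≡ β b))
    go (T , T>0 , aT) = period (λ i → β (b ∙ a ↑ i) Finₚ.≟ β b)
      (λ m n Sm Sn → trans (cong β (split m n)) (trans (β-right (a ↑ n) Sm) Sn))
      (λ m n Smn Sm → trans (sym (trans (cong β (split m n)) (β-right (a ↑ n) Sm))) Smn) T T>0
      (cong β (trans (cong (b ∙_) aT) (identityʳ b)))
      where
      split : ∀ m n → b ∙ a ↑ (m + n) ≡ (b ∙ a ↑ m) ∙ a ↑ n
      split m n = trans (cong (b ∙_) (↑-+ a m n)) (sym (assoc b (a ↑ m) (a ↑ n)))

  -- The neighbours baⁱ of the vertex of ε meet each of the d other parts, and the part met depends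
  -- only on i modulo s.
  order-blocks : ∀ s → IsPeriod (λ i → β (b ∙ a ↑ i) ≡ β b) s → s ≡ d
  order-blocks s (s>0 , s∣ , ∣s) = bijection-size index inj onto
    where
    instance
      s≢0 : NonZero s
      s≢0 = >-nonZero s>0
    index : Fin s → Fin d
    index i = punchOut (b-a↑≁ε (toℕ i))
    shift : ∀ {i j} → i ≤ j → β (b ∙ a ↑ i) ≡ β (b ∙ a ↑ j) → β (b ∙ a ↑ (j ∸ i)) ≡ β b
    shift {i} {j} i≤j eq = trans (strip (b ∙ a ↑ (j ∸ i))) (trans (β-right (a ↑ i ⁻¹) (trans (cong β (trans (assoc b _ _)
        (cong (b ∙_) (trans (sym (↑-+ a (j ∸ i) i)) (cong (a ↑_) (ℕₚ.m∸n+n≡m i≤j)))))) (sym eq))) (sym (strip b)))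
      where
      strip : ∀ g → β g ≡ β ((g ∙ a ↑ i) ∙ a ↑ i ⁻¹)
      strip g = cong β (solve 2 (λ g k → g ⊜ (g ⊕ k) ⊕ k ⁻) refl g (a ↑ i))
    block : ∀ {i j} → index i ≡ index j → β (b ∙ a ↑ toℕ i) ≡ β (b ∙ a ↑ toℕ j)
    block {i} {j} = Finₚ.punchOut-injective (b-a↑≁ε (toℕ i)) (b-a↑≁ε (toℕ j))
    inj : ∀ {i j} → index i ≡ index j → i ≡ j
    inj {i} {j} eq with ℕₚ.<-cmp (toℕ i) (toℕ j)
    ... | tri< i<j _ _ = contradiction (s∣ _ (shift (ℕₚ.<⇒≤ i<j) (block {i} {j} eq))) (distinct-residues {s} {i} {j} i<j)
    ... | tri≈ _ i≡j _ = Finₚ.toℕ-injective i≡j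
    ... | tri> _ _ j<i = contradiction (s∣ _ (shift (ℕₚ.<⇒≤ j<i) (sym (block {i} {j} eq)))) (distinct-residues {s} {j} {i} j<i)
    b-% : ∀ j → β (b ∙ a ↑ toℕ (j mod s)) ≡ β (b ∙ a ↑ j)
    b-% j = trans (cong (λ t → β (b ∙ a ↑ t)) (Finₚ.toℕ-fromℕ< (m%n<n j s)))
      (trans (sym (trans (cong β (sym (assoc b _ _))) (β-right (a ↑ (j % s)) (∣s (j / s * s) (n∣m*n (j / s))))))
        (cong (λ u → β (b ∙ u)) (trans (sym (↑-+ a (j / s * s) (j % s))) (cong (a ↑_) (trans (ℕₚ.+-comm _ (j % s)) (sym (m≡m%n+[m/n]*n j s)))))))
    onto : ∀ t → ∃ λ i → index i ≡ t
    onto t = hit (φ-onto (punchIn (β ε) t , proj₂ (φ ε)))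
      where
      hit : (∃ λ g → φ g ≡ (punchIn (β ε) t , proj₂ (φ ε))) → ∃ λ i → index i ≡ t
      hit (g , φg) = find (cell g (λ eq → Finₚ.punchInᵢ≢i (β ε) t (trans (sym (cong proj₁ φg)) eq)))
        where
        find : (∃₂ λ i j → g ≡ a ↑ i ∙ (b ∙ a ↑ j)) → ∃ λ i → index i ≡ t
        find (i , j , g≡) = j mod s , trans (Finₚ.punchOut-cong (β ε) {i≢k = λ eq → Finₚ.punchInᵢ≢i (β ε) t (sym eq)}
            (trans (b-% j) (trans (sym (cong proj₁ (φ-a↑ i _))) (trans (cong β (sym g≡)) (cong proj₁ φg)))))
          (Finₚ.punchOut-punchIn (β ε))

  geometry : Geometry 𝔾 d e
  geometry = build a-period block-period
    where
    build : ∃ (IsPeriod (λ i → a ↑ i ≡ ε)) → ∃ (IsPeriod (λ i → β (b ∙ a ↑ i) ≡ β b)) → Geometry 𝔾 d e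
    build (o , o-period) (s , s-period) = record
      { _≟_ = Finₚ._≟_
      ; a = a
      ; b = b
      ; b∙b = b∙b
      ; β = β
      ; β-right = β-right
      ; β-a = λ g → cong proj₁ (φ-a g)
      ; β-b = β-b
      ; β-onto = λ i → proj₁ (φ-onto (i , proj₂ (φ ε))) , cong proj₁ (proj₂ (φ-onto (i , proj₂ (φ ε))))
      ; cell = cell
      ; cell-unique = cell-unique
      ; a-order = λ i eq → subst (_∣ i) o≡ (proj₁ (proj₂ o-period) i eq)
      ; a-finite = proj₂ (proj₂ o-period) _ (∣-reflexive o≡)
      ; blocks = λ i eq → subst (_∣ i) s≡ (proj₁ (proj₂ s-period) i eq)
      ; blocks-finite = proj₂ (proj₂ s-period) d (∣-reflexive s≡) }
      where
      o≡ : o ≡ p ^ e * d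
      o≡ = trans (order-a o o-period) (ℕₚ.*-comm d (p ^ e))
      s≡ : s ≡ d
      s≡ = order-blocks s s-period

-- Powers of a primitive root

module ModArith (n : ℕ) .{{_ : NonZero n}} where

  infix 4 _∼_
  _∼_ : ℕ → ℕ → Set
  x ∼ y = x % n ≡ y % n

  ∼-setoid : Setoid 0ℓ 0ℓ
  ∼-setoid = record { Carrier = ℕ ; _≈_ = _∼_ ; isEquivalence = record { refl = refl ; sym = sym ; trans = trans } }

  module ∼-Reasoning = SetoidReasoning ∼-setoid

  ∼-+ : ∀ {x x′ y y′} → x ∼ x′ → y ∼ y′ → x + y ∼ x′ + y′
  ∼-+ {x} {x′} {y} {y′} eq eq′ = trans (%-distribˡ-+ x y n) (trans (cong₂ (λ s t → (s + t) % n) eq eq′) (sym (%-distribˡ-+ x′ y′ n)))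

  ∼-* : ∀ {x x′ y y′} → x ∼ x′ → y ∼ y′ → x * y ∼ x′ * y′
  ∼-* {x} {x′} {y} {y′} eq eq′ = trans (%-distribˡ-* x y n) (trans (cong₂ (λ s t → (s * t) % n) eq eq′) (sym (%-distribˡ-* x′ y′ n)))

  ∼-^ : ∀ {x y} k → x ∼ y → x ^ k ∼ y ^ k
  ∼-^ zero eq = refl
  ∼-^ {x} {y} (suc k) eq = ∼-* {x} {y} eq (∼-^ {x} {y} k eq)

  ∼-absorb : ∀ x k → x + k * n ∼ x
  ∼-absorb x k = [m+kn]%n≡m%n x k n

  ∣⇒∼0 : ∀ {x} → n ∣ x → x ∼ 0
  ∣⇒∼0 (divides k refl) = ∼-absorb 0 k

  ∼0⇒∣ : ∀ {x} → x ∼ 0 → n ∣ x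
  ∼0⇒∣ {x} eq = m%n≡0⇒n∣m x n (trans eq (m<n⇒m%n≡m (>-nonZero⁻¹ n)))

  -- (n ∸ 1) * z stands for − z.
  ∼-negate : ∀ z → z + (n ∸ 1) * z ∼ 0
  ∼-negate z = ∣⇒∼0 (divides z (trans (cong (_* z) (ℕₚ.m+[n∸m]≡n (>-nonZero⁻¹ n))) (ℕₚ.*-comm n z)))

  ∼-+0 : ∀ x {z} → z ∼ 0 → x + z ∼ x
  ∼-+0 x {z} eq = trans (∼-+ {x} {x} {z} {0} refl eq) (cong (_% n) (ℕₚ.+-identityʳ x))

  ∼-shift : ∀ x z → x + (n ∸ 1) * z + z ∼ x
  ∼-shift x z = trans (cong (_% n) (trans (ℕₚ.+-assoc x _ z) (cong (x +_) (ℕₚ.+-comm _ z)))) (∼-+0 x (∼-negate z))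

  ∼-cancelʳ : ∀ {x y} z → x + z ∼ y + z → x ∼ y
  ∼-cancelʳ {x} {y} z eq = begin
    x ≡⟨ ℕₚ.+-identityʳ x ⟨
    x + 0 ≈⟨ ∼-+ {x} {x} refl (∼-negate z) ⟨
    x + (z + (n ∸ 1) * z) ≡⟨ ℕₚ.+-assoc x z _ ⟨
    (x + z) + (n ∸ 1) * z ≈⟨ ∼-+ {x + z} {y + z} eq refl ⟩
    (y + z) + (n ∸ 1) * z ≡⟨ ℕₚ.+-assoc y z _ ⟩
    y + (z + (n ∸ 1) * z) ≈⟨ ∼-+ {y} {y} refl (∼-negate z) ⟩
    y + 0 ≡⟨ ℕₚ.+-identityʳ y ⟩
    y ∎
    where open ∼-Reasoning

  toℕ-mod : ∀ x → toℕ (x mod n) ∼ x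
  toℕ-mod x = trans (cong (_% n) (Finₚ.toℕ-fromℕ< (m%n<n x n))) (m%n%n≡m%n x n)

  mod-cong : ∀ {x y} → x ∼ y → x mod n ≡ y mod n
  mod-cong {x} {y} eq = Finₚ.fromℕ<-cong (x % n) (y % n) eq (m%n<n x n) (m%n<n y n)

  mod-injective : ∀ {x y} → x mod n ≡ y mod n → x ∼ y
  mod-injective {x} {y} eq = trans (sym (toℕ-mod x)) (trans (cong (λ i → toℕ i % n) eq) (toℕ-mod y))

  mod-toℕ : ∀ (i : Fin n) → toℕ i mod n ≡ i
  mod-toℕ i = Finₚ.toℕ-injective (trans (Finₚ.toℕ-fromℕ< _) (m<n⇒m%n≡m (Finₚ.toℕ<n i)))

  toℕ-∼ : ∀ {i j : Fin n} → toℕ i ∼ toℕ j → i ≡ j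
  toℕ-∼ {i} {j} eq = trans (sym (mod-toℕ i)) (trans (mod-cong eq) (mod-toℕ j))

  module Unit (r N : ℕ) (r^N : r ^ N ∼ 1) where

    r^*N : ∀ k → r ^ (N * k) ∼ 1
    r^*N k = trans (cong (_% n) (sym (ℕₚ.^-*-assoc r N k))) (trans (∼-^ {r ^ N} {1} k r^N) (cong (_% n) (ℕₚ.^-zeroˡ k)))

    r^-∼ : .{{_ : NonZero N}} → ∀ {i j} → i % N ≡ j % N → r ^ i ∼ r ^ j
    r^-∼ {i} {j} eq = trans (reduce i) (trans (cong (λ t → r ^ t % n) eq) (sym (reduce j)))
      where
      reduce : ∀ i → r ^ i ∼ r ^ (i % N)
      reduce i = begin
        r ^ i ≡⟨ cong (r ^_) (trans (m≡m%n+[m/n]*n i N) (cong (i % N +_) (ℕₚ.*-comm (i / N) N))) ⟩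
        r ^ (i % N + N * (i / N)) ≡⟨ ℕₚ.^-distribˡ-+-* r (i % N) _ ⟩
        r ^ (i % N) * r ^ (N * (i / N)) ≈⟨ ∼-* {r ^ (i % N)} refl (r^*N (i / N)) ⟩
        r ^ (i % N) * 1 ≡⟨ ℕₚ.*-identityʳ _ ⟩
        r ^ (i % N) ∎
        where open ∼-Reasoning

    r^-cancel : .{{_ : NonZero N}} → ∀ {x y} k → x * r ^ k ∼ y * r ^ k → x ∼ y
    r^-cancel {x} {y} k eq = trans (sym (expand x)) (trans (∼-* {x * r ^ k} {y * r ^ k} eq refl) (expand y))
      where
      expand : ∀ x → x * r ^ k * r ^ ((N ∸ 1) * k) ∼ x
      expand x = begin
        x * r ^ k * r ^ ((N ∸ 1) * k) ≡⟨ ℕₚ.*-assoc x _ _ ⟩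
        x * (r ^ k * r ^ ((N ∸ 1) * k)) ≡⟨ cong (x *_) (ℕₚ.^-distribˡ-+-* r k _) ⟨
        x * r ^ (k + (N ∸ 1) * k) ≡⟨ cong (λ t → x * r ^ (t * k)) (ℕₚ.m+[n∸m]≡n (>-nonZero⁻¹ N)) ⟩
        x * r ^ (N * k) ≈⟨ ∼-* {x} refl (r^*N k) ⟩
        x * 1 ≡⟨ ℕₚ.*-identityʳ x ⟩
        x ∎
        where open ∼-Reasoning

module PrimitiveRoots (d e : ℕ) (π : OddPrime d)
                      .{{_ : NonZero (nG (suc d) e)}} .{{_ : NonZero (qG (suc d) e)}} where

  open OddPrime π

  p n q h : ℕ
  p = suc d
  n = nG p e
  q = qG p e
  h = n / 2

  open ModArith q

  instance
    pe≢0 : NonZero (p ^ e)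
    pe≢0 = ℕₚ.m^n≢0 p e

  q≡ : q ≡ p ^ suc e
  q≡ = cong (p ^_) (ℕₚ.+-comm e 1)

  p∣q : p ∣ q
  p∣q = subst (p ∣_) (sym q≡) (m∣m*n (p ^ e))

  n≡ : n ≡ (p ^ e * half) * 2
  n≡ = trans (cong (p ^ e *_) d≡2half) (arith (p ^ e) half)
    where
    arith : ∀ r s → r * (s + s) ≡ r * s * 2
    arith = solve-∀

  h≡ : h ≡ p ^ e * half
  h≡ = trans (cong (_/ 2) n≡) (m*n/n≡m (p ^ e * half) 2)

  n≡h+h : n ≡ h + h
  n≡h+h = trans n≡ (trans (cong (_* 2) (sym h≡)) (arith h))
    where
    arith : ∀ h → h * 2 ≡ h + h
    arith = solve-∀

  h>0 : 0 < h
  h>0 with h in eq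
  ... | zero = contradiction (trans n≡h+h (cong₂ _+_ eq eq)) (ℕₚ.>⇒≢ (>-nonZero⁻¹ n))
  ... | suc _ = s≤s z≤n

  ∼⇒∼p : ∀ {x y} → x ∼ y → x % p ≡ y % p
  ∼⇒∼p {x} {y} eq = trans (sym (m∣n⇒o%n%m≡o%m p q x p∣q)) (trans (cong (_% p) eq) (m∣n⇒o%n%m≡o%m p q y p∣q))

  p∣⇒∼ : ∀ {x y} → x ∼ y → p ∣ x → p ∣ y
  p∣⇒∼ {x} {y} eq p∣x = m%n≡0⇒n∣m y p (trans (sym (∼⇒∼p {x} {y} eq)) (n∣m⇒m%n≡0 x p p∣x))

  digits-unique : ∀ {u v} → u < q → v < q → u % p ≡ v % p → (u / p) mod (p ^ e) ≡ (v / p) mod (p ^ e) → u ≡ v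
  digits-unique {u} {v} u<q v<q eq eq′ = trans (m≡m%n+[m/n]*n u p) (trans (cong₂ (λ s t → s + t * p) eq same) (sym (m≡m%n+[m/n]*n v p)))
    where
    small : ∀ {u} → u < q → u / p < p ^ e
    small u<q = m<n*o⇒m/o<n (subst (_ <_) (trans q≡ (ℕₚ.*-comm p (p ^ e))) u<q)
    same : u / p ≡ v / p
    same = trans (sym (m<n⇒m%n≡m (small u<q))) (trans (ModArith.mod-injective (p ^ e) {u / p} {v / p} eq′) (m<n⇒m%n≡m (small v<q)))

  module Root (r : ℕ) (root : IsPrimitiveRoot q n r) where

    open Unit r n (proj₁ root) public

    p∤r^ : ∀ k → ¬ (p ∣ r ^ k)
    p∤r^ k p∣ = p∤1 (p∣⇒∼ {r ^ (n * k)} {1} (r^*N k) (subst (p ∣_) (trans (sym (ℕₚ.^-distribˡ-+-* r k ((n ∸ 1) * k))) (cong (λ t → r ^ (t * k)) (ℕₚ.m+[n∸m]≡n (>-nonZero⁻¹ n))))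
      (∣m⇒∣m*n (r ^ ((n ∸ 1) * k)) p∣)))

    r^-distinct : ∀ {i j} → i < j → j < n → ¬ (r ^ i ∼ r ^ j)
    r^-distinct {i} {j} i<j j<n eq = proj₂ root (j ∸ i) (ℕₚ.m<n⇒0<n∸m i<j) (ℕₚ.≤-<-trans (ℕₚ.m∸n≤m j i) j<n)
      (r^-cancel {r ^ (j ∸ i)} {1} i (trans (cong (_% q) (trans (sym (ℕₚ.^-distribˡ-+-* r (j ∸ i) i)) (cong (r ^_) (ℕₚ.m∸n+n≡m (ℕₚ.<⇒≤ i<j)))))
        (trans (sym eq) (cong (_% q) (sym (ℕₚ.*-identityˡ (r ^ i)))))))

    r^-injective : ∀ {i j} → i < n → j < n → r ^ i ∼ r ^ j → i ≡ j
    r^-injective {i} {j} i<n j<n eq with ℕₚ.<-cmp i j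
    ... | tri< i<j _ _ = contradiction eq (r^-distinct i<j j<n)
    ... | tri≈ _ i≡j _ = i≡j
    ... | tri> _ _ j<i = contradiction (sym eq) (r^-distinct j<i i<n)

    private
      residue : ∀ u → ¬ (p ∣ u) → Fin.zero ≢ u mod p
      residue u p∤u eq = p∤u (ModArith.∼0⇒∣ p {u} (ModArith.mod-injective p {u} {0} (sym eq)))

      -- A unit modulo q = pᵉ⁺¹ is coded by its last digit in base p, which is nonzero, and by the
      -- remaining digits: n = pᵉ(p - 1) codes in all.
      encode : ∀ u → ¬ (p ∣ u) → Fin (p ^ e * d)
      encode u p∤u = combine ((u / p) mod (p ^ e)) (punchOut (residue u p∤u))

      encode-injective : ∀ {u v} (p∤u : ¬ (p ∣ u)) (p∤v : ¬ (p ∣ v)) → u < q → v < q → encode u p∤u ≡ encode v p∤v → u ≡ v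
      encode-injective {u} {v} p∤u p∤v u<q v<q eq = go (Finₚ.combine-injective ((u / p) mod (p ^ e)) (punchOut (residue u p∤u)) ((v / p) mod (p ^ e)) (punchOut (residue v p∤v)) eq)
        where
        go : (u / p) mod (p ^ e) ≡ (v / p) mod (p ^ e) × punchOut (residue u p∤u) ≡ punchOut (residue v p∤v) → u ≡ v
        go (eq₁ , eq₂) = digits-unique u<q v<q (ModArith.mod-injective p {u} {v} (Finₚ.punchOut-injective (residue u p∤u) (residue v p∤v) eq₂)) eq₁

      p∤% : ∀ u → ¬ (p ∣ u) → ¬ (p ∣ u % q)
      p∤% u p∤u p∣ = p∤u (p∣⇒∼ {u % q} {u} (m%n%n≡m%n u q) p∣)

    -- A count: the powers of r give n distinct units below q, and units have only n codes.
    powers-onto : ∀ u → ¬ (p ∣ u) → ∃ λ i → i < n × r ^ i ∼ u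
    powers-onto u p∤u = go (injective⇒surjective f inj (encode (u % q) (p∤% u p∤u)))
      where
      f : Fin n → Fin n
      f i = encode (r ^ toℕ i % q) (p∤% (r ^ toℕ i) (p∤r^ (toℕ i)))
      inj : ∀ {i j} → f i ≡ f j → i ≡ j
      inj {i} {j} eq = Finₚ.toℕ-injective (r^-injective (Finₚ.toℕ<n i) (Finₚ.toℕ<n j)
        (encode-injective (p∤% (r ^ toℕ i) (p∤r^ (toℕ i))) (p∤% (r ^ toℕ j) (p∤r^ (toℕ j))) (m%n<n (r ^ toℕ i) q) (m%n<n (r ^ toℕ j) q) eq))
      go : (∃ λ i → f i ≡ encode (u % q) (p∤% u p∤u)) → ∃ λ i → i < n × r ^ i ∼ u
      go (i , eq) = toℕ i , Finₚ.toℕ<n i , encode-injective (p∤% (r ^ toℕ i) (p∤r^ (toℕ i))) (p∤% u p∤u) (m%n<n (r ^ toℕ i) q) (m%n<n u q) eq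

    h<n : h < n
    h<n = subst (h <_) (sym n≡h+h) (ℕₚ.m<m+n h h>0)

    q-coprime : ∀ {s} → ¬ (p ∣ s) → Coprime q s
    q-coprime p∤s {t} (t∣q , t∣s) = ∣1⇒≡1 (coprime-∣^ (suc e) (λ (u∣t , u∣p) → Coprimality.sym (prime-coprime prime p∤s) (∣-trans u∣t t∣s , u∣p))
      (subst (t ∣_) (trans q≡ (sym (ℕₚ.*-identityʳ _))) t∣q))

    -- p divides at most one of rʰ ∓ 1, so all of q divides one of them.
    r^h≡-1 : r ^ h + 1 ∼ 0
    r^h≡-1 = go (r ^ h) refl
      where
      go : ∀ s → r ^ h ≡ s → r ^ h + 1 ∼ 0
      go zero eq = contradiction (subst (p ∣_) (sym eq) (p ∣0)) (p∤r^ h)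
      go (suc s) eq = decide (p ∣? s)
        where
        square : suc s * suc s ∼ 1
        square = trans (cong (_% q) (trans (cong₂ _*_ (sym eq) (sym eq)) (trans (sym (ℕₚ.^-distribˡ-+-* r h h)) (cong (r ^_) (sym n≡h+h))))) (proj₁ root)
        q∣ : q ∣ s * (s + 2)
        q∣ = ∼0⇒∣ (∼-cancelʳ {s * (s + 2)} {0} 1 (trans (cong (_% q) (arith s)) square))
          where
          arith : ∀ s → s * (s + 2) + 1 ≡ suc s * suc s
          arith = solve-∀
        decide : Dec (p ∣ s) → r ^ h + 1 ∼ 0
        decide (no p∤s) = trans (cong (_% q) (trans (cong (_+ 1) eq) (arith s))) (∣⇒∼0 (coprime-divisor (q-coprime p∤s) q∣))
          where
          arith : ∀ s → suc s + 1 ≡ s + 2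
          arith = solve-∀
        decide (yes p∣s) = contradiction
          (trans (cong (_% q) (trans eq (ℕₚ.+-comm 1 s))) (∼-+ {s} {0} {1} {1} (∣⇒∼0 (coprime-divisor (q-coprime λ p∣s+2 → p∤2 (∣m+n∣m⇒∣n p∣s+2 p∣s)) (subst (q ∣_) (ℕₚ.*-comm s (s + 2)) q∣))) refl))
          (proj₂ root h h>0 h<n)

-- The maps M₁(p, e, j)

reach-trans : ∀ {D : Set} {M : MapData D} {x y z} → Reach M x y → Reach M y z → Reach M x z
reach-trans here r′ = r′
reach-trans (stepR r) r′ = stepR (reach-trans r r′)
reach-trans (stepRinv r) r′ = stepRinv (reach-trans r r′)
reach-trans (stepL r) r′ = stepL (reach-trans r r′)

reach-R^ : ∀ {D : Set} {M : MapData D} m x → Reach M x (R^ M m x)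
reach-R^ zero x = here
reach-R^ (suc m) x = reach-trans (reach-R^ m x) (stepR here)

reach-fixed : ∀ {D : Set} {M : MapData D} → IsOrientableMap M → (f : Aut M) → ∀ {x y} → Reach M x y → fun f x ≡ x → fun f y ≡ y
reach-fixed o f here eq = eq
reach-fixed {M = M} o f (stepR r) eq = reach-fixed o f r (trans (fun-R f _) (cong (R M) eq))
reach-fixed {M = M} o f (stepL r) eq = reach-fixed o f r (trans (fun-L f _) (cong (L M) eq))
reach-fixed {M = M} o f {x} (stepRinv r) eq = reach-fixed o f r
  (trans (sym (Rinv-R (fun f (Rinv M x)))) (cong (Rinv M) (trans (sym (fun-R f _)) (trans (cong (fun f) (R-Rinv x)) eq))))
  where open IsOrientableMap o

module StandardMap (d e : ℕ) (π : OddPrime d)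
                   .{{_ : NonZero (nG (suc d) e)}} .{{_ : NonZero (qG (suc d) e)}}
                   (r : ℕ) (root : IsPrimitiveRoot (qG (suc d) e) (nG (suc d) e) r) where

  open OddPrime π
  open PrimitiveRoots d e π
  open Root r root
  open G1 n q r
  module A = ModArith n
  module Q = ModArith q

  𝕄 : ℕ → MapData (Dart1 p e)
  𝕄 j = cosetMap _·_ inverse (pow gen-a j) (pow gen-a h · gen-c)

  -- The element aⁱcᵏ with unreduced exponents, so that identities in G₁ become congruences between
  -- natural numbers.
  ⟦_,_⟧ : ℕ → ℕ → Carrier
  ⟦ i , k ⟧ = i mod n , k mod q

  ⟦⟧-cong : ∀ {i i′ k k′} → i A.∼ i′ → k Q.∼ k′ → ⟦ i , k ⟧ ≡ ⟦ i′ , k′ ⟧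
  ⟦⟧-cong {i} {i′} {k} {k′} eq eq′ = cong₂ _,_ (A.mod-cong {i} {i′} eq) (Q.mod-cong {k} {k′} eq′)

  ⟦⟧-surjective : ∀ x → ⟦ toℕ (proj₁ x) , toℕ (proj₂ x) ⟧ ≡ x
  ⟦⟧-surjective (i , k) = cong₂ _,_ (A.mod-toℕ i) (Q.mod-toℕ k)

  everywhere : (P : Carrier → Set) → (∀ i k → P ⟦ i , k ⟧) → ∀ x → P x
  everywhere P on x = subst P (⟦⟧-surjective x) (on _ _)

  ·-⟦⟧ : ∀ i k j l → ⟦ i , k ⟧ · ⟦ j , l ⟧ ≡ ⟦ i + j , k * r ^ j + l ⟧
  ·-⟦⟧ i k j l = ⟦⟧-cong {toℕ (i mod n) + toℕ (j mod n)} {i + j} {toℕ (k mod q) * r ^ toℕ (j mod n) + toℕ (l mod q)} {k * r ^ j + l}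
    (A.∼-+ {toℕ (i mod n)} {i} (A.toℕ-mod i) (A.toℕ-mod j))
    (Q.∼-+ {toℕ (k mod q) * r ^ toℕ (j mod n)} {k * r ^ j} (Q.∼-* {toℕ (k mod q)} {k} (Q.toℕ-mod k) (r^-∼ {toℕ (j mod n)} {j} (A.toℕ-mod j))) (Q.toℕ-mod l))

  pow-a : ∀ j → pow gen-a j ≡ ⟦ j , 0 ⟧
  pow-a zero = refl
  pow-a (suc j) = trans (cong (gen-a ·_) (pow-a j)) (·-⟦⟧ 1 0 j 0)

  R-⟦⟧ : ∀ j i k → R (𝕄 j) ⟦ i , k ⟧ ≡ ⟦ j + i , k ⟧
  R-⟦⟧ j i k = trans (cong (_· ⟦ i , k ⟧) (pow-a j)) (·-⟦⟧ j 0 i k)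

  L-⟦⟧ : ∀ j i k → L (𝕄 j) ⟦ i , k ⟧ ≡ ⟦ h + i , r ^ i + k ⟧
  L-⟦⟧ j i k = trans (cong (_· ⟦ i , k ⟧) (trans (cong (_· gen-c) (pow-a h)) (trans (·-⟦⟧ h 0 0 1) (cong (λ t → ⟦ t , 1 ⟧) (ℕₚ.+-identityʳ h)))))
    (trans (·-⟦⟧ h 1 i k) (cong (λ t → ⟦ h + i , t + k ⟧) (ℕₚ.*-identityˡ (r ^ i))))

  inverse-⟦⟧ : ∀ j → inverse ⟦ j , 0 ⟧ ≡ ⟦ (n ∸ 1) * j , 0 ⟧
  inverse-⟦⟧ j = cong₂ _,_
    (A.mod-cong {n ∸ toℕ (j mod n)} {(n ∸ 1) * j} (A.∼-cancelʳ {n ∸ toℕ (j mod n)} {(n ∸ 1) * j} j (begin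
      n ∸ toℕ (j mod n) + j ≈⟨ A.∼-+ {n ∸ toℕ (j mod n)} refl (A.toℕ-mod j) ⟨
      n ∸ toℕ (j mod n) + toℕ (j mod n) ≡⟨ ℕₚ.m∸n+n≡m (ℕₚ.<⇒≤ (Finₚ.toℕ<n (j mod n))) ⟩
      n ≈⟨ A.∣⇒∼0 ∣-refl ⟩
      0 ≈⟨ A.∼-negate j ⟨
      j + (n ∸ 1) * j ≡⟨ ℕₚ.+-comm j _ ⟩
      (n ∸ 1) * j + j ∎)))
    (Q.mod-cong {q ∸ ((toℕ (0 mod q) * r ^ (n ∸ toℕ (j mod n))) % q)} {0} (trans (cong (λ t → (q ∸ ((t * r ^ (n ∸ toℕ (j mod n))) % q)) % q) zero-residue)
      (trans (cong (λ t → (q ∸ t) % q) (m<n⇒m%n≡m (>-nonZero⁻¹ q))) (Q.∣⇒∼0 ∣-refl))))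
    where
    open A.∼-Reasoning
    zero-residue : toℕ (0 mod q) ≡ 0
    zero-residue = trans (Finₚ.toℕ-fromℕ< (m%n<n 0 q)) (m<n⇒m%n≡m (>-nonZero⁻¹ q))

  Rinv-⟦⟧ : ∀ j i k → Rinv (𝕄 j) ⟦ i , k ⟧ ≡ ⟦ (n ∸ 1) * j + i , k ⟧
  Rinv-⟦⟧ j i k = trans (cong (λ x → inverse x · ⟦ i , k ⟧) (pow-a j)) (trans (cong (_· ⟦ i , k ⟧) (inverse-⟦⟧ j)) (·-⟦⟧ ((n ∸ 1) * j) 0 i k))

  R^-⟦⟧ : ∀ j m i k → R^ (𝕄 j) m ⟦ i , k ⟧ ≡ ⟦ m * j + i , k ⟧
  R^-⟦⟧ j zero i k = refl
  R^-⟦⟧ j (suc m) i k = trans (cong (R (𝕄 j)) (R^-⟦⟧ j m i k)) (trans (R-⟦⟧ j (m * j + i) k) (cong (λ t → ⟦ t , k ⟧) (sym (ℕₚ.+-assoc j (m * j) i))))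

  -- The vertex ⟨a⟩cᵏ is named by k, split into its part k modulo p and its remaining digits.
  -- Reversal adds the unit rⁱ to k, so the ends of an edge differ modulo p.
  part : Carrier → Fin p × Fin (p ^ e)
  part (i , k) = toℕ k mod p , (toℕ k / p) mod (p ^ e)

  part-⟦⟧ : ∀ i k → proj₁ (part ⟦ i , k ⟧) ≡ k mod p
  part-⟦⟧ i k = ModArith.mod-cong p {toℕ (k mod q)} {k} (∼⇒∼p {toℕ (k mod q)} {k} (Q.toℕ-mod k))

  part-injective : ∀ x y → part x ≡ part y → proj₂ x ≡ proj₂ y
  part-injective (i , k) (i′ , k′) eq = Finₚ.toℕ-injective (digits-unique (Finₚ.toℕ<n k) (Finₚ.toℕ<n k′)
    (ModArith.mod-injective p {toℕ k} {toℕ k′} (cong proj₁ eq)) (cong proj₂ eq))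

  part-R : ∀ j x → part (R (𝕄 j) x) ≡ part x
  part-R j = everywhere _ λ i k → cong part (R-⟦⟧ j i k)

  part-R^ : ∀ j m x → part (R^ (𝕄 j) m x) ≡ part x
  part-R^ j zero x = refl
  part-R^ j (suc m) x = trans (part-R j (R^ (𝕄 j) m x)) (part-R^ j m x)

  part-L : ∀ j x → ¬ (proj₁ (part x) ≡ proj₁ (part (L (𝕄 j) x)))
  part-L j = everywhere _ λ i k eq → p∤r^ i (ModArith.∼0⇒∣ p {r ^ i} (ModArith.∼-cancelʳ p {r ^ i} {0} k
    (sym (ModArith.mod-injective p {k} {r ^ i + k} (trans (sym (part-⟦⟧ i k)) (trans eq (trans (cong (λ x → proj₁ (part x)) (L-⟦⟧ j i k)) (part-⟦⟧ (h + i) (r ^ i + k)))))))))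

  part-onto : ∀ v → ∃ λ x → part x ≡ v
  part-onto (s , t) = ⟦ 0 , k ⟧ , cong₂ _,_ (trans (part-⟦⟧ 0 k) (trans (ModArith.mod-cong p {k} {toℕ s} (ModArith.∼-absorb p (toℕ s) (toℕ t))) (ModArith.mod-toℕ p s)))
      (trans (cong (λ u → (u / p) mod (p ^ e)) (trans (Finₚ.toℕ-fromℕ< (m%n<n k q)) (m<n⇒m%n≡m k<q))) (trans (cong (_mod (p ^ e)) k/p) (ModArith.mod-toℕ (p ^ e) t)))
    where
    k : ℕ
    k = toℕ s + toℕ t * p
    k<q : k < q
    k<q = subst (k <_) (trans (ℕₚ.*-comm (p ^ e) p) (sym q≡))
      (ℕₚ.<-≤-trans (ℕₚ.+-monoˡ-< (toℕ t * p) (Finₚ.toℕ<n s)) (ℕₚ.*-monoˡ-≤ p (Finₚ.toℕ<n t)))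
    k/p : k / p ≡ toℕ t
    k/p = trans (+-distrib-/-∣ʳ (toℕ s) (n∣m*n (toℕ t))) (cong₂ _+_ (m<n⇒m/n≡0 (Finₚ.toℕ<n s)) (m*n/n≡m (toℕ t) p))

  n∤1 : ¬ (n ∣ 1)
  n∤1 n∣1 = ℕₚ.<⇒≱ (subst (1 <_) (sym n≡h+h) (ℕₚ.+-mono-≤ h>0 h>0)) (∣⇒≤ n∣1)

  n-wrap : ∀ s → s + (n ∸ 1) * s ≡ n * s
  n-wrap s = cong (_* s) (ℕₚ.m+[n∸m]≡n (>-nonZero⁻¹ n))

  translation : ∀ j → ℕ → ℕ → Aut (𝕄 j)
  translation j s t = record
    { fun = _· ⟦ s , t ⟧
    ; inv = _· ⟦ s′ , t′ ⟧
    ; inv-fun = everywhere _ λ i k → trans (cong (_· ⟦ s′ , t′ ⟧) (·-⟦⟧ i k s t)) (trans (·-⟦⟧ (i + s) (k * r ^ s + t) s′ t′)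
        (⟦⟧-cong {i + s + s′} {i} {(k * r ^ s + t) * r ^ s′ + t′} {k} (trans (cong (_% n) (ℕₚ.+-assoc i s s′)) (A.∼-+0 i (A.∼-negate s)))
          (begin
            (k * r ^ s + t) * r ^ s′ + t′ ≡⟨ arith k (r ^ s) t (r ^ s′) t′ ⟩
            k * (r ^ s * r ^ s′) + (t * r ^ s′ + t′) ≈⟨ Q.∼-+ {k * (r ^ s * r ^ s′)} {k * 1} (Q.∼-* {k} refl round) (Q.∼-negate (t * r ^ s′)) ⟩
            k * 1 + 0 ≡⟨ trans (ℕₚ.+-identityʳ _) (ℕₚ.*-identityʳ k) ⟩
            k ∎)))
    ; fun-inv = everywhere _ λ i k → trans (cong (_· ⟦ s , t ⟧) (·-⟦⟧ i k s′ t′)) (trans (·-⟦⟧ (i + s′) (k * r ^ s′ + t′) s t)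
        (⟦⟧-cong {i + s′ + s} {i} {(k * r ^ s′ + t′) * r ^ s + t} {k} (trans (cong (_% n) (trans (ℕₚ.+-assoc i s′ s) (cong (i +_) (ℕₚ.+-comm s′ s)))) (A.∼-+0 i (A.∼-negate s)))
          (begin
            (k * r ^ s′ + t′) * r ^ s + t ≡⟨ arith′ k (r ^ s) t (r ^ s′) (q ∸ 1) ⟩
            k * (r ^ s * r ^ s′) + ((q ∸ 1) * t * (r ^ s * r ^ s′) + t) ≈⟨ Q.∼-+ {k * (r ^ s * r ^ s′)} {k * 1} (Q.∼-* {k} refl round) (Q.∼-+ {(q ∸ 1) * t * (r ^ s * r ^ s′)} {(q ∸ 1) * t * 1} (Q.∼-* {(q ∸ 1) * t} refl round) refl) ⟩
            k * 1 + ((q ∸ 1) * t * 1 + t) ≡⟨ arith″ k ((q ∸ 1) * t) t ⟩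
            k + (t + (q ∸ 1) * t) ≈⟨ Q.∼-+ {k} refl (Q.∼-negate t) ⟩
            k + 0 ≡⟨ ℕₚ.+-identityʳ k ⟩
            k ∎)))
    ; fun-R = everywhere _ λ i k → trans (cong (_· ⟦ s , t ⟧) (R-⟦⟧ j i k)) (trans (·-⟦⟧ (j + i) k s t) (trans (cong (λ u → ⟦ u , k * r ^ s + t ⟧) (ℕₚ.+-assoc j i s))
        (sym (trans (cong (R (𝕄 j)) (·-⟦⟧ i k s t)) (R-⟦⟧ j (i + s) (k * r ^ s + t))))))
    ; fun-L = everywhere _ λ i k → trans (cong (_· ⟦ s , t ⟧) (L-⟦⟧ j i k)) (trans (·-⟦⟧ (h + i) (r ^ i + k) s t) (trans (cong₂ ⟦_,_⟧ (ℕₚ.+-assoc h i s)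
          (trans (distribute (r ^ i) k (r ^ s) t) (cong (_+ (k * r ^ s + t)) (sym (ℕₚ.^-distribˡ-+-* r i s)))))
        (sym (trans (cong (L (𝕄 j)) (·-⟦⟧ i k s t)) (L-⟦⟧ j (i + s) (k * r ^ s + t)))))) }
    where
    open Q.∼-Reasoning
    -- The inverse of aˢcᵗ is a⁻ˢ times c to the power -t r⁻ˢ.
    s′ t′ : ℕ
    s′ = (n ∸ 1) * s
    t′ = (q ∸ 1) * (t * r ^ s′)
    round : r ^ s * r ^ s′ Q.∼ 1
    round = trans (cong (_% q) (trans (sym (ℕₚ.^-distribˡ-+-* r s s′)) (cong (r ^_) (n-wrap s)))) (r^*N s)
    arith : ∀ k u t v w → (k * u + t) * v + w ≡ k * (u * v) + (t * v + w)
    arith = solve-∀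
    arith′ : ∀ k u t v m → (k * v + m * (t * v)) * u + t ≡ k * (u * v) + (m * t * (u * v) + t)
    arith′ = solve-∀
    arith″ : ∀ k m t → k * 1 + (m * 1 + t) ≡ k + (t + m)
    arith″ = solve-∀
    distribute : ∀ u k v t → (u + k) * v + t ≡ u * v + (k * v + t)
    distribute = solve-∀

  transitive : ∀ j x y → Σ (Aut (𝕄 j)) λ f → fun f x ≡ y
  transitive j x y = subst (λ x → Σ (Aut (𝕄 j)) λ f → fun f x ≡ y) (⟦⟧-surjective x) (translation j s t ,
      trans (·-⟦⟧ i k s t) (trans (⟦⟧-cong {i + s} {i′} {k * r ^ s + t} {k′}
          (trans (cong (_% n) (swap i i′ ((n ∸ 1) * i))) (A.∼-+0 i′ (A.∼-negate i)))
          (trans (cong (_% q) (swap (k * r ^ s) k′ ((q ∸ 1) * (k * r ^ s)))) (Q.∼-+0 k′ (Q.∼-negate (k * r ^ s)))))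
        (⟦⟧-surjective y)))
    where
    i k i′ k′ s t : ℕ
    i = toℕ (proj₁ x)
    k = toℕ (proj₂ x)
    i′ = toℕ (proj₁ y)
    k′ = toℕ (proj₂ y)
    s = i′ + (n ∸ 1) * i
    t = k′ + (q ∸ 1) * (k * r ^ s)
    swap : ∀ x y z → x + (y + z) ≡ y + (x + z)
    swap = solve-∀

  module _ (j : ℕ) (coprime : Coprime j n) where

    -- j is invertible modulo n, so aʲ generates ⟨a⟩.
    same-vertex : ∀ i i′ k → ∃ λ m → R^ (𝕄 j) m ⟦ i , k ⟧ ≡ ⟦ i′ , k ⟧
    same-vertex i i′ k = go (inverse-mod coprime n∤1)
      where
      go : (∃₂ λ u t → j * u ≡ 1 + t * n) → ∃ λ m → R^ (𝕄 j) m ⟦ i , k ⟧ ≡ ⟦ i′ , k ⟧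
      go (u , t , eq) = u * w , trans (R^-⟦⟧ j (u * w) i k) (⟦⟧-cong {u * w * j + i} {i′} {k} {k} (begin
          u * w * j + i ≡⟨ arith u w j i ⟩
          j * u * w + i ≡⟨ cong (λ s → s * w + i) eq ⟩
          (1 + t * n) * w + i ≡⟨ arith′ t n w i ⟩
          (w + i) + (t * w) * n ≈⟨ A.∼-absorb (w + i) (t * w) ⟩
          i′ + (n ∸ 1) * i + i ≈⟨ A.∼-shift i′ i ⟩
          i′ ∎) refl)
        where
        open A.∼-Reasoning
        w : ℕ
        w = i′ + (n ∸ 1) * i
        arith : ∀ u w j i → u * w * j + i ≡ j * u * w + i
        arith = solve-∀
        arith′ : ∀ t n w i → (1 + t * n) * w + i ≡ (w + i) + (t * w) * n
        arith′ = solve-∀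

    reach-vertex : ∀ i i′ k → Reach (𝕄 j) ⟦ i , k ⟧ ⟦ i′ , k ⟧
    reach-vertex i i′ k = go (same-vertex i i′ k)
      where
      go : (∃ λ m → R^ (𝕄 j) m ⟦ i , k ⟧ ≡ ⟦ i′ , k ⟧) → Reach (𝕄 j) ⟦ i , k ⟧ ⟦ i′ , k ⟧
      go (m , eq) = subst (Reach (𝕄 j) ⟦ i , k ⟧) eq (reach-R^ m ⟦ i , k ⟧)

    -- At first coordinate 0 the reversal adds r⁰ = 1 to the second coordinate and lands at first
    -- coordinate h; rotation then returns to 0.
    reach-up : ∀ i k m → Reach (𝕄 j) ⟦ i , k ⟧ ⟦ h + 0 , m + k ⟧
    reach-up i k zero = reach-vertex i (h + 0) k
    reach-up i k (suc m) = reach-trans (reach-up i k m) (reach-trans (reach-vertex (h + 0) 0 (m + k))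
      (stepL (subst (λ x → Reach (𝕄 j) x ⟦ h + 0 , suc (m + k) ⟧) (sym (L-⟦⟧ j 0 (m + k))) here)))

    connected : ∀ x y → Reach (𝕄 j) x y
    connected x y = subst₂ (Reach (𝕄 j)) (⟦⟧-surjective x) (⟦⟧-surjective y)
      (subst (Reach (𝕄 j) ⟦ i , k ⟧) target (reach-trans (reach-up i k m) (reach-vertex (h + 0) i′ (m + k))))
      where
      i k i′ k′ m : ℕ
      i = toℕ (proj₁ x)
      k = toℕ (proj₂ x)
      i′ = toℕ (proj₁ y)
      k′ = toℕ (proj₂ y)
      m = k′ + (q ∸ 1) * k
      target : ⟦ i′ , m + k ⟧ ≡ ⟦ i′ , k′ ⟧
      target = ⟦⟧-cong {i′} {i′} {m + k} {k′} refl (Q.∼-shift k′ k)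

    orientable : IsOrientableMap (𝕄 j)
    orientable = record
      { R-Rinv = everywhere _ λ i k → trans (cong (R (𝕄 j)) (Rinv-⟦⟧ j i k)) (trans (R-⟦⟧ j ((n ∸ 1) * j + i) k)
          (⟦⟧-cong {j + ((n ∸ 1) * j + i)} {i} {k} {k} (trans (cong (_% n) (arith j ((n ∸ 1) * j) i)) (A.∼-+0 i (A.∼-negate j))) refl))
      ; Rinv-R = everywhere _ λ i k → trans (cong (Rinv (𝕄 j)) (R-⟦⟧ j i k)) (trans (Rinv-⟦⟧ j (j + i) k)
          (⟦⟧-cong {(n ∸ 1) * j + (j + i)} {i} {k} {k} (trans (cong (_% n) (arith′ j ((n ∸ 1) * j) i)) (A.∼-+0 i (A.∼-negate j))) refl))
      -- Two reversals change k by rⁱ(rʰ + 1), which vanishes because rʰ ≡ -1.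
      ; L-invol = everywhere _ λ i k → trans (cong (L (𝕄 j)) (L-⟦⟧ j i k)) (trans (L-⟦⟧ j (h + i) (r ^ i + k))
          (⟦⟧-cong {h + (h + i)} {i} {r ^ (h + i) + (r ^ i + k)} {k}
            (trans (cong (_% n) (trans (sym (ℕₚ.+-assoc h h i)) (trans (cong (_+ i) (sym n≡h+h)) (ℕₚ.+-comm n i)))) (A.∼-+0 i (A.∣⇒∼0 ∣-refl)))
            (trans (cong (_% q) (trans (cong (_+ (r ^ i + k)) (ℕₚ.^-distribˡ-+-* r h i)) (arith″ (r ^ h) (r ^ i) k)))
              (Q.∼-+0 k (Q.∼-* {r ^ h + 1} {0} r^h≡-1 refl)))))
      ; L-nofix = λ x eq → part-L j x (cong (λ y → proj₁ (part y)) (sym eq))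
      ; connected = connected }
      where
      arith : ∀ j m i → j + (m + i) ≡ i + (j + m)
      arith = solve-∀
      arith′ : ∀ j m i → m + (j + i) ≡ i + (j + m)
      arith′ = solve-∀
      arith″ : ∀ s u k → s * u + (u + k) ≡ k + (s + 1) * u
      arith″ = solve-∀

    -- Since the parts differ, k′ - k is a unit and hence a power rⁱ; the dart aⁱcᵏ then joins the
    -- two vertices.
    adjacent : ∀ v w → ¬ (proj₁ v ≡ proj₁ w) → ∃ λ x → (part x ≡ v) × (part (L (𝕄 j) x) ≡ w)
    adjacent v w v≁w = go (part-onto v) (part-onto w)
      where
      go : (∃ λ x → part x ≡ v) → (∃ λ y → part y ≡ w) → ∃ λ x → (part x ≡ v) × (part (L (𝕄 j) x) ≡ w)
      go (x , eq) (y , eq′) = found (powers-onto u p∤u)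
        where
        k k′ u : ℕ
        k = toℕ (proj₂ x)
        k′ = toℕ (proj₂ y)
        u = k′ + (q ∸ 1) * k
        k+u : u + k Q.∼ k′
        k+u = Q.∼-shift k′ k
        p∤u : ¬ (p ∣ u)
        p∤u p∣u = v≁w (trans (cong proj₁ (sym eq)) (trans (ModArith.mod-cong p {k} {k′}
          (trans (sym (%-remove-+ˡ k p∣u)) (∼⇒∼p {u + k} {k′} k+u))) (cong proj₁ eq′)))
        found : (∃ λ i → i < n × r ^ i Q.∼ u) → ∃ λ x → (part x ≡ v) × (part (L (𝕄 j) x) ≡ w)
        found (i , _ , ri) = ⟦ i , k ⟧ , trans (cong part (cong (i mod n ,_) (Q.mod-toℕ (proj₂ x)))) eq ,
          trans (cong part (trans (L-⟦⟧ j i k) (cong ((h + i) mod n ,_) (trans (Q.mod-cong {r ^ i + k} {k′} (trans (Q.∼-+ {r ^ i} {u} {k} {k} ri refl) k+u)) (Q.mod-toℕ (proj₂ y)))))) eq′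

    -- The ends k and k + rⁱ of a dart determine rⁱ, and so i modulo n.
    simple : ∀ x y → part x ≡ part y → part (L (𝕄 j) x) ≡ part (L (𝕄 j) y) → x ≡ y
    simple x y eq eq′ = cong₂ _,_ (Finₚ.toℕ-injective (r^-injective (Finₚ.toℕ<n (proj₁ x)) (Finₚ.toℕ<n (proj₁ y))
        (Q.∼-cancelʳ {r ^ i} {r ^ i′} k (trans (Q.mod-injective {r ^ i + k} {r ^ i′ + k′} after) (cong (λ t → (r ^ i′ + t) % q) (sym (cong toℕ same)))))))
      same
      where
      i k i′ k′ : ℕ
      i = toℕ (proj₁ x)
      k = toℕ (proj₂ x)
      i′ = toℕ (proj₁ y)
      k′ = toℕ (proj₂ y)
      same : proj₂ x ≡ proj₂ y
      same = part-injective x y eq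
      L-at : ∀ x → proj₂ (L (𝕄 j) x) ≡ (r ^ toℕ (proj₁ x) + toℕ (proj₂ x)) mod q
      L-at x = cong proj₂ (trans (cong (L (𝕄 j)) (sym (⟦⟧-surjective x))) (L-⟦⟧ j (toℕ (proj₁ x)) (toℕ (proj₂ x))))
      after : (r ^ i + k) mod q ≡ (r ^ i′ + k′) mod q
      after = trans (sym (L-at x)) (trans (part-injective (L (𝕄 j) x) (L (𝕄 j) y) eq′) (L-at y))

    embedding : IsOREmbeddingK (𝕄 j) p (p ^ e)
    embedding = (orientable , transitive j , λ f x eq y → reach-fixed orientable f (connected x y) eq) ,
      part ,
      (λ x y eq → ⇒sameVertex (𝕄 j) x y (vertex x y (part-injective x y eq))) ,
      (λ x y s → invariant x y (sameVertex⇒ (𝕄 j) x y s)) ,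
      part-onto , part-L j , adjacent , simple
      where
      vertex : ∀ x y → proj₂ x ≡ proj₂ y → ∃ λ m → R^ (𝕄 j) m x ≡ y
      vertex x y eq = subst₂ (λ x y → ∃ λ m → R^ (𝕄 j) m x ≡ y) (⟦⟧-surjective x)
        (trans (cong (λ k → ⟦ toℕ (proj₁ y) , toℕ k ⟧) eq) (⟦⟧-surjective y)) (same-vertex (toℕ (proj₁ x)) (toℕ (proj₁ y)) (toℕ (proj₂ x)))
      invariant : ∀ x y → (∃ λ m → R^ (𝕄 j) m x ≡ y) → part x ≡ part y
      invariant x y (m , eq) = trans (sym (part-R^ j m x)) (cong part eq)

    -- Left multiplication by c in terms of the map alone: n is even, so j is odd, Rʰ is
    -- multiplication by aʲʰ = aʰ, and it cancels the aʰ in the reversing element aʰc.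
    C : Carrier → Carrier
    C x = R^ (𝕄 j) h (L (𝕄 j) x)

    odd : ∃ λ v → j ≡ 1 + v * 2
    odd with j % 2 in eq | m%n<n j 2
    ... | zero | _ = contradiction (coprime {2} (m%n≡0⇒n∣m j 2 eq , divides h (trans n≡h+h (arith h)))) (λ ())
      where
      arith : ∀ h → h + h ≡ h * 2
      arith = solve-∀
    ... | suc zero | _ = j / 2 , trans (m≡m%n+[m/n]*n j 2) (cong (_+ j / 2 * 2) eq)
    ... | suc (suc _) | s≤s (s≤s ())

    C-⟦⟧ : ∀ i k → C ⟦ i , k ⟧ ≡ ⟦ i , r ^ i + k ⟧
    C-⟦⟧ i k = trans (cong (R^ (𝕄 j) h) (L-⟦⟧ j i k)) (trans (R^-⟦⟧ j h (h + i) (r ^ i + k))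
      (cong (_, (r ^ i + k) mod q) (A.mod-cong {h * j + (h + i)} {i} (go odd))))
      where
      go : (∃ λ v → j ≡ 1 + v * 2) → h * j + (h + i) A.∼ i
      go (v , eq) = trans (cong (_% n) (trans (cong (λ j → h * j + (h + i)) eq) (trans (arith h v i) (cong (λ t → i + (1 + v) * t) (sym n≡h+h))))) (A.∼-absorb i (1 + v))
        where
        arith : ∀ h v i → h * (1 + v * 2) + (h + i) ≡ i + (1 + v) * (h + h)
        arith = solve-∀

    C^-⟦⟧ : ∀ m i k → iterate C m ⟦ i , k ⟧ ≡ ⟦ i , m * r ^ i + k ⟧
    C^-⟦⟧ zero i k = refl
    C^-⟦⟧ (suc m) i k = trans (cong C (C^-⟦⟧ m i k)) (trans (C-⟦⟧ i (m * r ^ i + k)) (cong (λ t → ⟦ i , t ⟧) (sym (ℕₚ.+-assoc (r ^ i) (m * r ^ i) k))))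

    C-R : ∀ x → C (R (𝕄 j) x) ≡ R (𝕄 j) (iterate C (r ^ j) x)
    C-R = everywhere _ λ i k → trans (cong C (R-⟦⟧ j i k)) (trans (C-⟦⟧ (j + i) k)
      (trans (cong (λ t → ⟦ j + i , t + k ⟧) (ℕₚ.^-distribˡ-+-* r j i))
        (sym (trans (cong (R (𝕄 j)) (C^-⟦⟧ (r ^ j) i k)) (R-⟦⟧ j i (r ^ j * r ^ i + k))))))

    -- The relation at a single dart already fixes m modulo q, which makes rʲ an invariant of the
    -- map.
    C-R-exponent : ∀ m x → C (R (𝕄 j) x) ≡ R (𝕄 j) (iterate C m x) → m Q.∼ r ^ j
    C-R-exponent m = everywhere _ λ i k eq → r^-cancel {m} {r ^ j} i (Q.∼-cancelʳ {m * r ^ i} {r ^ j * r ^ i} k (Q.mod-injective {m * r ^ i + k} {r ^ j * r ^ i + k}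
      (cong proj₂ (trans (sym (trans (cong (R (𝕄 j)) (C^-⟦⟧ m i k)) (R-⟦⟧ j i (m * r ^ i + k))))
        (trans (sym eq) (trans (C-R ⟦ i , k ⟧) (trans (cong (R (𝕄 j)) (C^-⟦⟧ (r ^ j) i k)) (R-⟦⟧ j i (r ^ j * r ^ i + k)))))))))

  -- An isomorphism transports the relation C R = R C^(rʲ), where C = Rʰ L.
  non-isomorphic : ∀ j₁ j₂ → j₁ < n → (cop₁ : Coprime j₁ n) → j₂ < n → (cop₂ : Coprime j₂ n) → MapIso (𝕄 j₁) (𝕄 j₂) → j₁ ≡ j₂
  non-isomorphic j₁ j₂ j₁<n cop₁ j₂<n cop₂ iso = r^-injective j₁<n j₂<n (C-R-exponent j₂ cop₂ (r ^ j₁) (to one) (begin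
      C j₂ cop₂ (R (𝕄 j₂) (to one)) ≡⟨ cong (C j₂ cop₂) (to-R one) ⟨
      C j₂ cop₂ (to (R (𝕄 j₁) one)) ≡⟨ to-C (R (𝕄 j₁) one) ⟨
      to (C j₁ cop₁ (R (𝕄 j₁) one)) ≡⟨ cong to (C-R j₁ cop₁ one) ⟩
      to (R (𝕄 j₁) (iterate (C j₁ cop₁) (r ^ j₁) one)) ≡⟨ to-R _ ⟩
      R (𝕄 j₂) (to (iterate (C j₁ cop₁) (r ^ j₁) one)) ≡⟨ cong (R (𝕄 j₂)) (to-C^ (r ^ j₁) one) ⟩
      R (𝕄 j₂) (iterate (C j₂ cop₂) (r ^ j₁) (to one)) ∎))
    where
    open MapIso iso
    open ≡-Reasoning
    to-R^ : ∀ m x → to (R^ (𝕄 j₁) m x) ≡ R^ (𝕄 j₂) m (to x)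
    to-R^ zero x = refl
    to-R^ (suc m) x = trans (to-R _) (cong (R (𝕄 j₂)) (to-R^ m x))
    to-C : ∀ x → to (C j₁ cop₁ x) ≡ C j₂ cop₂ (to x)
    to-C x = trans (to-R^ h _) (cong (R^ (𝕄 j₂) h) (to-L x))
    to-C^ : ∀ m x → to (iterate (C j₁ cop₁) m x) ≡ iterate (C j₂ cop₂) m (to x)
    to-C^ zero x = refl
    to-C^ (suc m) x = trans (to-C _) (cong (C j₂ cop₂) (to-C^ m x))

-- Classification

module Classification (d e : ℕ) (π : OddPrime d)
                      .{{_ : NonZero (nG (suc d) e)}} .{{_ : NonZero (qG (suc d) e)}}
                      (r : ℕ) (root : IsPrimitiveRoot (qG (suc d) e) (nG (suc d) e) r)
                      {D : Set} {𝔾 : GroupOn D} (Γ : Geometry 𝔾 d e) where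

  open OddPrime π
  open GroupTheory 𝔾
  open Geometry Γ
  open Blocks Γ π using (τ; c; x-finite; yx-unique; fix-ε)
  open Descent Γ π
  open Layers Γ π
  open PrimitiveRoots d e π
  open StandardMap d e π r root using (𝕄; ⟦_,_⟧; ⟦⟧-surjective; R-⟦⟧; L-⟦⟧; odd)
  open ModArith q
  open Metacyclic 𝔾 ≡-congruence
  open Modulo ≡-congruence using (cancelˡ; cancelʳ; ↑-∣; ↑-%; commute⇒conj; conj⇒commute; commute-↑; commute-∙; ↑⁻¹)
  module A = ModArith n

  top : Layer e
  top = record
    { C = ≡-congruence
    ; _≈?_ = _≟_
    ; fine = λ { refl → fix-ε }
    ; x-order = x-finite
    ; independent = yx-unique }

  module _ (k : ℕ) (action : conj a c ≡ c ↑ k) (exponent : c ↑ (p ^ suc e) ≡ ε) (exact : ¬ (c ↑ (p ^ e) ≡ ε)) where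

    open Factorisation ≡-congruence k action using (factored)

    c^q : c ↑ q ≡ ε
    c^q = trans (cong (c ↑_) q≡) exponent

    -- The order of c divides pᵉ⁺¹ but not pᵉ.
    c-order : ∀ i → c ↑ i ≡ ε → q ∣ i
    c-order i eq = go (period (λ i → (c ↑ i) ≟ ε)
        (λ m n Sm Sn → trans (↑-+ c m n) (trans (cong₂ _∙_ Sm Sn) (identityʳ ε)))
        (λ m n Smn Sm → trans (sym (identityˡ _)) (trans (cong (_∙ c ↑ n) (sym Sm)) (trans (sym (↑-+ c m n)) Smn)))
        q (>-nonZero⁻¹ q) c^q)
      where
      go : ∃ (IsPeriod (λ i → c ↑ i ≡ ε)) → q ∣ i
      go (s , _ , s∣ , ∣s) = decide (∣p^1+f⇒∣p^f⊎ prime e s (s∣ (p ^ suc e) exponent))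
        where
        decide : s ∣ p ^ e ⊎ p ^ suc e ∣ s → q ∣ i
        decide (inj₁ s∣pe) = contradiction (∣s (p ^ e) s∣pe) exact
        decide (inj₂ ∣s) = ∣-trans (subst (_∣ s) (sym q≡) ∣s) (s∣ i eq)

    c-∼ : ∀ {i j} → i ∼ j → c ↑ i ≡ c ↑ j
    c-∼ {i} {j} eq = trans (sym (↑-% {c} {q} c^q i)) (trans (cong (c ↑_) eq) (↑-% {c} {q} c^q j))

    a-∼ : ∀ {i j} → i A.∼ j → a ↑ i ≡ a ↑ j
    a-∼ {i} {j} eq = trans (sym (↑-% {a} {n} a-finite i)) (trans (cong (a ↑_) eq) (↑-% {a} {n} a-finite j))

    c-injective : ∀ i j → c ↑ i ≡ c ↑ j → i ∼ j
    c-injective i j eq = ∼-cancelʳ {i} {j} ((q ∸ 1) * j) (trans (∣⇒∼0 (c-order (i + (q ∸ 1) * j) (trans (↑-+ c i _)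
        (trans (cong₂ _∙_ eq (sym (↑⁻¹ (>-nonZero⁻¹ q) c^q j))) (inverseʳ (c ↑ j)))))) (sym (∼-negate j)))

    -- If aⁱ centralises c, it commutes with b = τc as well, so aⁱba⁻ⁱ = b, and `cell-unique` gives
    -- aⁱ = 1.
    faithful : ∀ i → conj (a ↑ i) c ≡ c → a ↑ i ≡ ε
    faithful i eq = proj₁ (cell-unique i ((n ∸ 1) * i) (begin
        a ↑ i ∙ (b ∙ a ↑ ((n ∸ 1) * i)) ≡⟨ cong (λ u → a ↑ i ∙ (b ∙ u)) (↑⁻¹ (>-nonZero⁻¹ n) a-finite i) ⟨
        a ↑ i ∙ (b ∙ (a ↑ i) ⁻¹) ≡⟨ assoc (a ↑ i) b _ ⟨
        (a ↑ i ∙ b) ∙ (a ↑ i) ⁻¹ ≡⟨ cong (_∙ (a ↑ i) ⁻¹) commutes-b ⟩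
        (b ∙ a ↑ i) ∙ (a ↑ i) ⁻¹ ≡⟨ solve 2 (λ b u → (b ⊕ u) ⊕ u ⁻ ⊜ b) refl b (a ↑ i) ⟩
        b ∎))
      where
      open ≡-Reasoning
      commutes-b : a ↑ i ∙ b ≡ b ∙ a ↑ i
      commutes-b = trans (cong (a ↑ i ∙_) b≡τc) (trans (commute-∙ {a ↑ i} (↑-comm a i (p ^ e * half)) (sym (conj⇒commute {c} eq)))
        (cong (_∙ a ↑ i) (sym b≡τc)))

    -- By faithfulness k has the same order n as a. Like r it is thus a primitive root, so each of k
    -- and r is a power of the other.
    k-root : IsPrimitiveRoot q n k
    k-root = c-injective (k ^ n) 1 (trans (sym (iterated-act k action n)) (trans (cong (λ g → conj g c) a-finite) (trans (conj-by-ε c) (sym (identityʳ c))))) ,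
      λ i i>0 i<n eq → ℕₚ.<⇒≱ i<n (∣⇒≤ {{>-nonZero i>0}} (a-order i (faithful i (trans (iterated-act k action i) (trans (c-∼ {k ^ i} {1} eq) (identityʳ c))))))

    module _ (j′ : ℕ) (k^j′ : k ^ j′ ∼ r) (j : ℕ) (r^j : r ^ j ∼ k) where

      -- The generator of ⟨a⟩ that acts on c as the fixed root r, so the counterpart of `gen-a`; by
      -- `a′^j` its j-th power is the rotation a.
      a′ : D
      a′ = a ↑ j′

      a′-act : conj a′ c ≡ c ↑ r
      a′-act = trans (iterated-act k action j′) (c-∼ {k ^ j′} {r} k^j′)

      -- Both sides raise c to the power k, and ⟨a⟩ acts faithfully.
      a′^j : a′ ↑ j ≡ a
      a′^j = cancelʳ (a ⁻¹) (trans power (sym (inverseʳ a)))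
        where
        open ≡-Reasoning
        a′^j∙a⁻¹ : a ↑ (j′ * j + (n ∸ 1)) ≡ a′ ↑ j ∙ a ⁻¹
        a′^j∙a⁻¹ = trans (↑-+ a (j′ * j) (n ∸ 1)) (cong₂ _∙_ (↑-* a j′ j)
          (sym (trans (cong _⁻¹ (sym (identityʳ a))) (trans (↑⁻¹ (>-nonZero⁻¹ n) a-finite 1) (cong (a ↑_) (ℕₚ.*-identityʳ (n ∸ 1)))))))
        power : a′ ↑ j ∙ a ⁻¹ ≡ ε
        power = trans (sym a′^j∙a⁻¹) (faithful (j′ * j + (n ∸ 1)) (begin
          conj (a ↑ (j′ * j + (n ∸ 1))) c ≡⟨ cong (λ g → conj g c) a′^j∙a⁻¹ ⟩
          conj (a′ ↑ j ∙ a ⁻¹) c ≡⟨ conj-conj (a′ ↑ j) (a ⁻¹) c ⟨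
          conj (a ⁻¹) (conj (a′ ↑ j) c) ≡⟨ cong (conj (a ⁻¹)) (trans (iterated-act r a′-act j) (trans (c-∼ {r ^ j} {k} r^j) (sym action))) ⟩
          conj (a ⁻¹) (conj a c) ≡⟨ conj-cancel a c ⟩
          c ∎))

      a′^n : a′ ↑ n ≡ ε
      a′^n = trans (sym (↑-* a j′ n)) (trans (cong (a ↑_) (ℕₚ.*-comm j′ n)) (trans (↑-* a n j′) (trans (cong (_↑ j′) a-finite) (ε↑ j′))))

      a′-∼ : ∀ {i i′} → i A.∼ i′ → a′ ↑ i ≡ a′ ↑ i′
      a′-∼ {i} {i′} eq = trans (sym (↑-* a j′ i)) (trans (a-∼ {j′ * i} {j′ * i′} (A.∼-* {j′} {j′} {i} {i′} refl eq)) (↑-* a j′ i′))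

      -- If s divides j and n = ts, then aᵗ = a′ʲᵗ is trivial, so n divides t and s = 1.
      coprime : Coprime j n
      coprime {s} (divides u ju , divides t nt) = ∣1⇒≡1 (divides-one t≢0 (subst (_∣ t) nt (a-order t a^t)))
        where
        a^t : a ↑ t ≡ ε
        a^t = trans (cong (_↑ t) (sym a′^j)) (trans (sym (↑-* a′ j t)) (↑-∣ {a′} {n} {j * t} a′^n
          (divides u (trans (cong (_* t) ju) (trans (ℕₚ.*-assoc u s t) (cong (u *_) (trans (ℕₚ.*-comm s t) (sym nt))))))))
        t≢0 : t ≢ 0
        t≢0 refl = ℕₚ.>⇒≢ (>-nonZero⁻¹ n) nt
        divides-one : t ≢ 0 → t * s ∣ t → s ∣ 1
        divides-one t≢0 div = *-cancelˡ-∣ t {{≢-nonZero t≢0}} (subst (t * s ∣_) (sym (ℕₚ.*-identityʳ t)) div)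

      from : Dart1 p e → D
      from (i , l) = a′ ↑ toℕ i ∙ c ↑ toℕ l

      from-⟦⟧ : ∀ i l → from ⟦ i , l ⟧ ≡ a′ ↑ i ∙ c ↑ l
      from-⟦⟧ i l = cong₂ _∙_ (a′-∼ {toℕ (i mod n)} {i} (A.toℕ-mod i)) (c-∼ {toℕ (l mod q)} {l} (toℕ-mod l))

      from-R : ∀ x → from (R (𝕄 j) x) ≡ a ∙ from x
      from-R x = subst (λ x → from (R (𝕄 j) x) ≡ a ∙ from x) (⟦⟧-surjective x) (trans (cong from (R-⟦⟧ j i l)) (begin
        from ⟦ j + i , l ⟧ ≡⟨ from-⟦⟧ (j + i) l ⟩
        a′ ↑ (j + i) ∙ c ↑ l ≡⟨ cong (_∙ c ↑ l) (trans (↑-+ a′ j i) (cong (_∙ a′ ↑ i) a′^j)) ⟩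
        (a ∙ a′ ↑ i) ∙ c ↑ l ≡⟨ assoc a (a′ ↑ i) (c ↑ l) ⟩
        a ∙ (a′ ↑ i ∙ c ↑ l) ≡⟨ cong (a ∙_) (from-⟦⟧ i l) ⟨
        a ∙ from ⟦ i , l ⟧ ∎))
        where
        open ≡-Reasoning
        i l : ℕ
        i = toℕ (proj₁ x)
        l = toℕ (proj₂ x)

      -- j is odd, so a′ʰ = a′^(jh) = aʰ = τ.
      a′^h : a′ ↑ h ≡ τ
      a′^h = go (odd j coprime)
        where
        arith : ∀ v h → (1 + v * 2) * h ≡ h + v * (h + h)
        arith = solve-∀
        go : (∃ λ v → j ≡ 1 + v * 2) → a′ ↑ h ≡ τ
        go (v , j≡) = trans (a′-∼ {h} {j * h} (sym (trans (cong (_% n) j*h) (A.∼-absorb h v))))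
          (trans (↑-* a′ j h) (cong₂ _↑_ a′^j h≡))
          where
          j*h : j * h ≡ h + v * n
          j*h = trans (cong (_* h) j≡) (trans (arith v h) (cong (λ t → h + v * t) (sym n≡h+h)))

      from-L : ∀ x → from (L (𝕄 j) x) ≡ b ∙ from x
      from-L x = subst (λ x → from (L (𝕄 j) x) ≡ b ∙ from x) (⟦⟧-surjective x) (trans (cong from (L-⟦⟧ j i l)) (begin
        from ⟦ h + i , r ^ i + l ⟧ ≡⟨ from-⟦⟧ (h + i) (r ^ i + l) ⟩
        a′ ↑ (h + i) ∙ c ↑ (r ^ i + l) ≡⟨ cong₂ _∙_ (trans (↑-+ a′ h i) (cong (_∙ a′ ↑ i) a′^h)) (trans (↑-+ c (r ^ i) l) (cong (λ t → c ↑ t ∙ c ↑ l) (sym (ℕₚ.*-identityʳ (r ^ i))))) ⟩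
        (τ ∙ a′ ↑ i) ∙ (c ↑ (r ^ i * 1) ∙ c ↑ l) ≡⟨ solve 4 (λ t u v w → (t ⊕ u) ⊕ (v ⊕ w) ⊜ t ⊕ ((u ⊕ v) ⊕ w)) refl τ (a′ ↑ i) (c ↑ (r ^ i * 1)) (c ↑ l) ⟩
        τ ∙ ((a′ ↑ i ∙ c ↑ (r ^ i * 1)) ∙ c ↑ l) ≡⟨ cong (λ u → τ ∙ (u ∙ c ↑ l)) (push r a′-act 1 i) ⟨
        τ ∙ ((c ↑ 1 ∙ a′ ↑ i) ∙ c ↑ l) ≡⟨ cong (λ u → τ ∙ ((u ∙ a′ ↑ i) ∙ c ↑ l)) (identityʳ c) ⟩
        τ ∙ ((c ∙ a′ ↑ i) ∙ c ↑ l) ≡⟨ solve 4 (λ t u v w → t ⊕ ((u ⊕ v) ⊕ w) ⊜ (t ⊕ u) ⊕ (v ⊕ w)) refl τ c (a′ ↑ i) (c ↑ l) ⟩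
        (τ ∙ c) ∙ (a′ ↑ i ∙ c ↑ l) ≡⟨ cong₂ _∙_ b≡τc (from-⟦⟧ i l) ⟨
        b ∙ from ⟦ i , l ⟧ ∎))
        where
        open ≡-Reasoning
        i l : ℕ
        i = toℕ (proj₁ x)
        l = toℕ (proj₂ x)

      -- Powers of c centralise c, so by faithfulness ⟨a⟩ and ⟨c⟩ meet trivially.
      c∈⟨a⟩ : ∀ i l → a ↑ i ≡ c ↑ l → a ↑ i ≡ ε
      c∈⟨a⟩ i l eq = faithful i (trans (cong (λ g → conj g c) eq) (commute⇒conj {c} {c ↑ l} (commute-↑ {c} {c} l refl)))

      a-injective : ∀ i i′ → a ↑ i ≡ a ↑ i′ → i A.∼ i′
      a-injective i i′ eq = A.∼-cancelʳ {i} {i′} ((n ∸ 1) * i′) (trans (A.∣⇒∼0 (a-order (i + (n ∸ 1) * i′) (trans (↑-+ a i _)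
        (trans (cong₂ _∙_ eq (sym (↑⁻¹ (>-nonZero⁻¹ n) a-finite i′))) (inverseʳ (a ↑ i′)))))) (sym (A.∼-negate i′)))

      a′-injective : ∀ i i′ → a′ ↑ i ≡ a′ ↑ i′ → i A.∼ i′
      a′-injective i i′ eq = a-injective i i′ (trans (unfold i) (trans (cong (_↑ j) eq) (sym (unfold i′))))
        where
        unfold : ∀ i → a ↑ i ≡ a′ ↑ i ↑ j
        unfold i = trans (cong (_↑ i) (sym a′^j)) (trans (sym (↑-* a′ j i)) (trans (cong (a′ ↑_) (ℕₚ.*-comm j i)) (↑-* a′ i j)))

      from-injective : ∀ x y → from x ≡ from y → x ≡ y
      from-injective (i , l) (i′ , l′) eq = cong₂ _,_ (A.toℕ-∼ (a′-injective (toℕ i) (toℕ i′) a′-eq))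
          (toℕ-∼ (c-injective (toℕ l) (toℕ l′) (cancelˡ (a′ ↑ toℕ i) (trans eq (cong (_∙ c ↑ toℕ l′) (sym a′-eq))))))
        where
        open ≡-Reasoning
        s t : ℕ
        s = toℕ i + (n ∸ 1) * toℕ i′
        t = toℕ l′ + (q ∸ 1) * toℕ l
        shifted : a′ ↑ s ≡ c ↑ t
        shifted = begin
          a′ ↑ s ≡⟨ ↑-+ a′ (toℕ i) _ ⟩
          a′ ↑ toℕ i ∙ a′ ↑ ((n ∸ 1) * toℕ i′) ≡⟨ ↑-comm a′ (toℕ i) ((n ∸ 1) * toℕ i′) ⟩
          a′ ↑ ((n ∸ 1) * toℕ i′) ∙ a′ ↑ toℕ i ≡⟨ cong (_∙ a′ ↑ toℕ i) (↑⁻¹ (>-nonZero⁻¹ n) a′^n (toℕ i′)) ⟨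
          (a′ ↑ toℕ i′) ⁻¹ ∙ a′ ↑ toℕ i ≡⟨ solve 3 (λ u v w → u ⁻ ⊕ v ⊜ u ⁻ ⊕ ((v ⊕ w) ⊕ w ⁻)) refl (a′ ↑ toℕ i′) (a′ ↑ toℕ i) (c ↑ toℕ l) ⟩
          (a′ ↑ toℕ i′) ⁻¹ ∙ (from (i , l) ∙ (c ↑ toℕ l) ⁻¹) ≡⟨ cong (λ g → (a′ ↑ toℕ i′) ⁻¹ ∙ (g ∙ (c ↑ toℕ l) ⁻¹)) eq ⟩
          (a′ ↑ toℕ i′) ⁻¹ ∙ (from (i′ , l′) ∙ (c ↑ toℕ l) ⁻¹) ≡⟨ solve 3 (λ u v w → u ⁻ ⊕ ((u ⊕ v) ⊕ w ⁻) ⊜ v ⊕ w ⁻) refl (a′ ↑ toℕ i′) (c ↑ toℕ l′) (c ↑ toℕ l) ⟩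
          c ↑ toℕ l′ ∙ (c ↑ toℕ l) ⁻¹ ≡⟨ cong (c ↑ toℕ l′ ∙_) (↑⁻¹ (>-nonZero⁻¹ q) c^q (toℕ l)) ⟩
          c ↑ toℕ l′ ∙ c ↑ ((q ∸ 1) * toℕ l) ≡⟨ ↑-+ c (toℕ l′) _ ⟨
          c ↑ t ∎
        a′-eq : a′ ↑ toℕ i ≡ a′ ↑ toℕ i′
        a′-eq = cancelʳ ((a′ ↑ toℕ i′) ⁻¹) (trans (trans (cong (a′ ↑ toℕ i ∙_) (↑⁻¹ (>-nonZero⁻¹ n) a′^n (toℕ i′))) (sym (↑-+ a′ (toℕ i) ((n ∸ 1) * toℕ i′))))
          (trans (trans (sym (↑-* a j′ s)) (c∈⟨a⟩ (j′ * s) t (trans (↑-* a j′ s) shifted))) (sym (inverseʳ (a′ ↑ toℕ i′)))))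

      from-surjective : ∀ g → ∃ λ x → from x ≡ g
      from-surjective g = go (factored g)
        where
        go : (∃₂ λ i l → g ≡ a ↑ i ∙ c ↑ l) → ∃ λ x → from x ≡ g
        go (i , l , eq) = ⟦ j * i , l ⟧ , trans (from-⟦⟧ (j * i) l) (trans (cong (_∙ c ↑ l) (trans (↑-* a′ j i) (cong (_↑ i) a′^j))) (sym eq))

      to : D → Dart1 p e
      to g = proj₁ (from-surjective g)

      from-to : ∀ g → from (to g) ≡ g
      from-to g = proj₂ (from-surjective g)

      module _ (M : MapData D) (R-left : ∀ g → R M g ≡ a ∙ g) (L-left : ∀ g → L M g ≡ b ∙ g) where

        isomorphism : MapIso M (𝕄 j)
        isomorphism = record
          { to = to
          ; from = from
          ; from-to = from-to
          ; to-from = λ x → from-injective (to (from x)) x (from-to (from x))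
          ; to-R = λ g → from-injective _ _ (trans (from-to (R M g)) (trans (R-left g) (trans (cong (a ∙_) (sym (from-to g))) (sym (from-R (to g))))))
          ; to-L = λ g → from-injective _ _ (trans (from-to (L M g)) (trans (L-left g) (trans (cong (b ∙_) (sym (from-to g))) (sym (from-L (to g)))))) }

  module _ (M : MapData D) (R-left : ∀ g → R M g ≡ a ∙ g) (L-left : ∀ g → L M g ≡ b ∙ g) where

    classified : CyclicMod top → ∃ λ j → (j < n) × Coprime j n × MapIso M (𝕄 j)
    classified cyc = go (K.powers-onto r (λ p∣r → Root.p∤r^ r root 1 (subst (p ∣_) (sym (ℕₚ.*-identityʳ r)) p∣r)))
                        (Root.powers-onto r root k (λ p∣k → K.p∤r^ 1 (subst (p ∣_) (sym (ℕₚ.*-identityʳ k)) p∣k)))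
      where
      open CyclicMod cyc
      module K = Root k (k-root k action exponent exact)
      go : (∃ λ i → i < n × k ^ i ∼ r) → (∃ λ i → i < n × r ^ i ∼ k) → ∃ λ j → (j < n) × Coprime j n × MapIso M (𝕄 j)
      go (j′ , _ , k^j′) (j , j<n , r^j) = j , j<n , (λ {s} → coprime k action exponent exact j′ k^j′ j r^j {s}) ,
        isomorphism k action exponent exact j′ k^j′ j r^j M R-left L-left

oddPrime : ∀ d → Prime (suc d) → 5 ≤ suc d → OddPrime d
oddPrime d pr (s≤s 4≤d) = go (d % 2) refl (m%n<n d 2)
  where
  double : ∀ m → m * 2 ≡ m + m
  double = solve-∀
  go : ∀ t → d % 2 ≡ t → t < 2 → OddPrime d
  go zero eq _ = record
    { prime = pr
    ; half = d / 2
    ; half>0 = m≥n⇒m/n>0 (ℕₚ.≤-trans (s≤s (s≤s z≤n)) 4≤d)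
    ; d≡2half = trans (m≡m%n+[m/n]*n d 2) (trans (cong (_+ d / 2 * 2) eq) (double (d / 2))) }
  go (suc zero) eq _ = contradiction (∣prime∧≢1⇒≡ pr 2∣p (λ ())) λ 2≡p → ℕₚ.<⇒≱ (s≤s (ℕₚ.≤-trans (s≤s (s≤s z≤n)) 4≤d)) (ℕₚ.≤-reflexive (sym 2≡p))
    where
    2∣p : 2 ∣ suc d
    2∣p = divides (suc (d / 2)) (cong suc (trans (m≡m%n+[m/n]*n d 2) (cong (_+ d / 2 * 2) eq)))
  go (suc (suc _)) _ (s≤s (s≤s ()))

classification : ∀ d e (π : OddPrime d)
  .{{_ : NonZero (nG (suc d) e)}} .{{_ : NonZero (qG (suc d) e)}}
  r (root : IsPrimitiveRoot (qG (suc d) e) (nG (suc d) e) r) N (M : MapData (Fin N)) →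
  IsOREmbeddingK M (suc d) (suc d ^ e) →
  (Σ (Subgroup M) λ P → IsSylow (suc d) P × HasExponent P (suc d ^ (e + 1))) →
  ∃ λ j → (j < nG (suc d) e) × Coprime j (nG (suc d) e) × MapIso M (StandardMap.𝕄 d e π r root j)
classification d e π r root N M
  ((orientable , transitive , rigid) , φ , φ-same , same-φ , φ-onto , φ-L , adjacent , simple)
  (P , _ , _ , P-exponent , P-minimal) = classified M R-left L-left (cyclic top exceeds)
  where
  open OddPrime π
  p : ℕ
  p = suc d
  d₀ : Fin N
  d₀ = proj₁ (φ-onto (Fin.zero , fromℕ< (ℕₚ.m^n>0 p e)))
  open DartGroup M orientable transitive rigid d₀
  open GroupTheory 𝔾
  open MultipartiteMap M orientable transitive rigid d₀ d e φ φ-same same-φ φ-onto φ-L adjacent simple using (geometry)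
  open Translation geometry π using (p-element)
  open Descent geometry π using (InP)
  open Induction geometry π using (Exceeds; cyclic)
  open Classification d e π r root geometry using (top; classified)
  exceeds : ¬ (∀ g → InP g → g ↑ (p ^ e) ≡ ε)
  -- If pᵉ killed `InP`, it would kill P, against the minimality of the exponent pᵉ⁺¹.
  exceeds all = ℕₚ.<⇒≱ (ℕₚ.^-monoʳ-< p (s≤s d>0) (ℕₚ.≤-reflexive (ℕₚ.+-comm 1 e))) (P-minimal (p ^ e) (ℕₚ.m^n>0 p e) λ f f∈P →
      trivial-aut-power f (p ^ e) (all (fun f d₀) (p-element (e + 1) (fun f d₀) (aut-power-trivial f (p ^ (e + 1)) (P-exponent f f∈P)))))

theorem3p1 : (p e : ℕ) → Prime p → (hp : 5 ≤ p) → 1 ≤ e →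
    (r : ℕ) → IsGeneratorModPower p e r (5≤⇒2≤ hp) →
    ((N : ℕ) (M : MapData (Fin N)) → IsOREmbeddingK M p (p ^ e) →
    (Σ (Subgroup M) λ P → IsSylow p P × HasExponent P (p ^ (e + 1))) →
    ∃ λ j → (j < nG p e) × Coprime j (nG p e) × MapIso M (M1 p e r j (5≤⇒2≤ hp)))
    × (∀ j → j < nG p e → Coprime j (nG p e) →
    IsOREmbeddingK (M1 p e r j (5≤⇒2≤ hp)) p (p ^ e))
    × (∀ j₁ j₂ → j₁ < nG p e → Coprime j₁ (nG p e) →
    j₂ < nG p e → Coprime j₂ (nG p e) →
    MapIso (M1 p e r j₁ (5≤⇒2≤ hp)) (M1 p e r j₂ (5≤⇒2≤ hp)) → j₁ ≡ j₂)
theorem3p1 (suc d) e pr hp _ r root =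
    classification d e π r root ,
    (λ j _ coprime → embedding j coprime) ,
    (λ j₁ j₂ j₁<n coprime₁ j₂<n coprime₂ → non-isomorphic j₁ j₂ j₁<n coprime₁ j₂<n coprime₂)
  where
  instance
    n≢0 : NonZero (nG (suc d) e)
    n≢0 = nG-nz (suc d) e (5≤⇒2≤ hp)
    q≢0 : NonZero (qG (suc d) e)
    q≢0 = qG-nz (suc d) e (5≤⇒2≤ hp)
  π : OddPrime d
  π = oddPrime d pr hp
  open StandardMap d e π r root
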